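{- Let $G$ be a graph and let $Q$, $R$, $S$, $T$ be subsets of $V(G)$ such that $Q\cap R=S\cap T=\emptyset$. Let $\kappa_{G}(Q,R)=k$, $\kappa_{G}(S,T)=\ell$, and $F=V(G)-(Q\cup R\cup S\cup T)$. If $|F|\geq (2\ell+1)2^{2k}$, then there exists a vertex $v$ in $F$ such that at least two of the following three statements hold: (i) $\kappa_{G\setminus v}(Q,R)=k$ and $\kappa_{G\setminus v}(S,T)=\ell$. (ii) $\kappa_{G*v\setminus v}(Q,R)=k$ and $\kappa_{G*v\setminus v}(S,T)=\ell$. (iii) $\kappa_{G\wedge uv\setminus v}(Q,R)=k$ and $\kappa_{G\wedge uv\setminus v}(S,T)=\ell$ for each neighbor $u$ of $v$ in $G$.
   Context: All graphs are finite and simple (no loops or parallel edges). $G\setminus v$ denotes the graph obtained from $G$ by deleting the vertex $v$. For a vertex $v$ of $G$, $G*v$ denotes the local complementation of $G$ at $v$: the graph on the same vertex set obtained from $G$ by, for each pair $x,y$ of distinct neighbors of $v$, adding the edge $xy$ if $x,y$ are non-adjacent in $G$ and removing it otherwise. For an edge $uv$ of $G$, pivoting $uv$ gives $G\wedge uv=G*u*v*u$ (operations applied left to right; this equals $G*v*u*v$). For $X\subseteq V(G)$, the cut-rank $\rho_G(X)$ is the rank over $\mathrm{GF}(2)$ of the $X\times (V(G)-X)$ matrix whose $(i,j)$-entry is $1$ if $i$ and $j$ are adjacent in $G$ and $0$ otherwise. For disjoint $S,T\subseteq V(G)$, the connectivity between $S$ and $T$ is $\kappa_G(S,T)=\min_{S\subseteq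 X\subseteq V(G)-T}\rho_G(X)$. -}

module Defs where

open import Algebra.Bundles using (CommutativeRing)
open import Data.Bool.Base using (Bool; true; false; not; _∧_; _xor_)
open import Data.Bool.Properties as Bool
  using (xor-∧-commutativeRing; ∧-comm; ∧-zeroʳ)
open import Data.Fin.Base using (Fin; zero; suc)
open import Data.Fin.Properties using (_≟_; all?)
open import Data.Fin.Subset
  using (Subset; inside; outside; _∈_; _⊆_; _─_; _-_; ∣_∣; Empty; Nonempty)
open import Data.Fin.Subset.Properties
  using (_∈?_; _⊆?_; anySubset?; nonempty?; x∈p∧x≢y⇒x∈p-y)
open import Data.List.Base using (List; []; _∷_; _++_; map; filter)
open import Data.List.Extrema.Nat using (max; min)
open import Data.Nat.Base using (ℕ; zero; suc)
open import Data.Product.Base using (_×_; _,_; ∃)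
open import Data.Sum.Base using (_⊎_)
import Data.Vec.Base as Vec
open import Relation.Binary.PropositionalEquality
  using (_≡_; refl; trans; cong; cong₂)
open import Relation.Nullary using (¬_; Dec; yes; no; does; contradiction)
open import Relation.Nullary.Decidable
  using (map′; _×-dec_; _→-dec_; ¬?; dec-true)

open import Algebra.Properties.CommutativeMonoid.Sum
  (CommutativeRing.+-commutativeMonoid xor-∧-commutativeRing) public
  using () renaming (sum to sum₂)

private
  variable
    n : ℕ

-- The vertex set is an arbitrary subset of Fin n, so that deleting a vertex
-- stays within Graph n and subsets of the vertex set need no re-indexing.
record Graph (n : ℕ) : Set where
  field
    V          : Subset n
    adj        : Fin n → Fin n → Bool
    adj-sym    : ∀ x y → adj x y ≡ adj y x
    adj-irrefl : ∀ x → adj x x ≡ false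
    adj⇒∈V     : ∀ x y → adj x y ≡ true → x ∈ V

  Adjacent : Fin n → Fin n → Set
  Adjacent x y = adj x y ≡ true

open Graph public

private
  ==-sym : (x y : Fin n) → does (x ≟ y) ≡ does (y ≟ x)
  ==-sym x y with x ≟ y | y ≟ x
  ... | yes _    | yes _    = refl
  ... | no  _    | no  _    = refl
  ... | yes refl | no  x≢x  = contradiction refl x≢x
  ... | no  x≢x  | yes refl = contradiction refl x≢x

infixl 6 _∖_ _⋆_ _∧[_,_]

_∖_ : Graph n → Fin n → Graph n
V (G ∖ v) = V G - v
adj (G ∖ v) x y = adj G x y ∧ (not (does (x ≟ v)) ∧ not (does (y ≟ v)))
adj-sym (G ∖ v) x y = cong₂ _∧_ (adj-sym G x y) (∧-comm (not (does (x ≟ v))) _)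
adj-irrefl (G ∖ v) x = cong (_∧ _) (adj-irrefl G x)
adj⇒∈V (G ∖ v) x y e with adj G x y in xy | x ≟ v
... | true | no x≢v = x∈p∧x≢y⇒x∈p-y (adj⇒∈V G x y xy) x≢v

-- Local complementation G * v.
_⋆_ : Graph n → Fin n → Graph n
V (G ⋆ v) = V G
adj (G ⋆ v) x y =
  adj G x y xor ((adj G v x ∧ adj G v y) ∧ not (does (x ≟ y)))
adj-sym (G ⋆ v) x y =
  cong₂ _xor_ (adj-sym G x y)
    (cong₂ _∧_ (∧-comm (adj G v x) _) (cong not (==-sym x y)))
adj-irrefl (G ⋆ v) x
  rewrite adj-irrefl G x | dec-true (x ≟ x) refl = ∧-zeroʳ _
adj⇒∈V (G ⋆ v) x y e with adj G x y in xy | adj G v x in vx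
... | true  | _    = adj⇒∈V G x y xy
... | false | true = adj⇒∈V G x v (trans (adj-sym G x v) vx)

-- Pivoting; meaningful only when u and v are adjacent.
_∧[_,_] : Graph n → Fin n → Fin n → Graph n
G ∧[ u , v ] = G ⋆ u ⋆ v ⋆ u

subsets : ∀ n → List (Subset n)
subsets zero    = Vec.[] ∷ []
subsets (suc n) =
  map (outside Vec.∷_) (subsets n) ++ map (inside Vec.∷_) (subsets n)

-- GF(2) is Bool with addition _xor_ and multiplication _∧_.
Matrix₂ : ℕ → Set
Matrix₂ n = Fin n → Fin n → Bool

-- Linear independence over GF(2) of the rows of M indexed by A, restricted to
-- the columns in Y.  A coefficient vector supported on A is a subset C of A.
Independent : Matrix₂ n → Subset n → Subset n → Set
Independent M A Y =
  ∀ C → C ⊆ A →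
  (∀ j → j ∈ Y → sum₂ (λ i → Vec.lookup C i ∧ M i j) ≡ false) →
  Empty C

independent? : (M : Matrix₂ n) (A Y : Subset n) → Dec (Independent M A Y)
independent? M A Y =
  map′ {A = ¬ ∃ Dependency}
       (λ ¬dep C C⊆A C≡0 ne → ¬dep (C , C⊆A , C≡0 , ne))
       (λ ind (C , C⊆A , C≡0 , ne) → ind C C⊆A C≡0 ne)
       (¬? (anySubset? {P = Dependency} λ C →
         (C ⊆? A) ×-dec
         all? (λ j → (j ∈? Y) →-dec (_ Bool.≟ false)) ×-dec
         nonempty? C))
  where
  Dependency : Subset _ → Set
  Dependency C =
    C ⊆ A ×
    (∀ j → j ∈ Y → sum₂ (λ i → Vec.lookup C i ∧ M i j) ≡ false) ×
    Nonempty C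

-- The rank over GF(2) of the X × Y submatrix of M: the maximum number of
-- linearly independent rows.  The empty family is independent, so the default
-- value 0 does not affect the maximum.
rank : Matrix₂ n → Subset n → Subset n → ℕ
rank M X Y =
  max 0 (map ∣_∣ (filter (λ A → (A ⊆? X) ×-dec independent? M A Y) (subsets _)))

cutRank : Graph n → Subset n → ℕ
cutRank G X = rank (adj G) X (V G ─ X)

-- The minimum of cutRank G X over S ⊆ X ⊆ V(G) - T.  For disjoint S, T ⊆ V(G),
-- the set S is itself such an X, so the default value cutRank G S does not
-- affect the minimum.
κ : Graph n → Subset n → Subset n → ℕ
κ G S T =
  min (cutRank G S)
      (map (cutRank G) (filter (λ X → (S ⊆? X) ×-dec (X ⊆? (V G ─ T))) (subsets _)))

AtLeastTwo : Set → Set → Set → Set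
AtLeastTwo A B C = (A × B) ⊎ (A × C) ⊎ (B × C)

-- For C ⊆ V(G) let z_C(v) = (C(v), |C ∩ N(v)| mod 2).  These vectors form a Lagrangian subspace L of
-- (GF(2)²)ⁿ, and |X| − ρ(X) is the dimension of the space of vectors in L supported on X.  Removing v by
-- G \ v, G * v \ v or G ∧ uv \ v amounts to keeping the vectors of L that are 0 or a at v, for the three
-- nonzero a ∈ GF(2)².  By submodularity at most one a destroys κ(Q,R), and at most one destroys κ(S,T).
--
-- If no v ∈ F is as required, each v ∈ F has directions t_v ≠ s_v destroying κ(Q,R) and κ(S,T)
-- respectively; let n_v be the third one.  Remove all vertices outside Q ∪ R keeping κ(Q,R), those in F
-- along n_v.  Then each v ∈ F has vectors x_v, x'_v ∈ L vanishing on R and Q respectively, equal to t_v at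
-- v and with values in {0, n_i} at the other i ∈ F.  A minimum cut divides the sums x_v + x'_v into 2^(2k)
-- classes.  Among |F| + 1 candidates (zero is a further one) 2ℓ + 2 lie in one class; their differences
-- yield 2ℓ + 1 vectors w_j ∈ L vanishing on Q ∪ R, with w_j(j) = t_j and w_j(i) = 0 for the other chosen i.
-- A minimum cut for (S,T) has only 2^(2ℓ) classes, so two subset sums of the w_j agree, and their
-- difference must vanish on F because t_i and n_i are harmless for κ(S,T): a contradiction.
module Submission where

open import Defs
import Data.Empty as Empty
import Data.List.Relation.Unary.All as All
open import Algebra.Bundles using (CommutativeMonoid; CommutativeRing)
open import Data.Bool.Base using (Bool; true; false; not; _∧_; _∨_; _xor_; if_then_else_)
open import Data.Bool.Properties as Bool
  using (xor-same; xor-assoc; xor-comm; xor-identityʳ; xor-∧-commutativeRing; ∧-assoc; ∧-comm;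
    ∧-idem; ∧-identityʳ; ∧-zeroʳ; ¬-not)
open import Data.Fin.Base using (Fin; zero; suc; combine; funToFin; finToFun)
open import Data.Fin.Properties
  using (_≟_; all?; any?; injective⇒≤; funToFin-finToFin; finToFun-funToFin; 2↔Bool; ¬∀⟶∃¬)
open import Data.Fin.Subset
  using (Subset; _∈_; _⊆_; _∩_; _∪_; _─_; _-_; ∣_∣; ⁅_⁆; ⊥; Empty; Nonempty)
open import Data.Fin.Subset.Properties
  using (_∈?_; _⊆?_; anySubset?; nonempty?; Empty-unique; ∉⊥; ∣⊥∣≡0; ∣⁅x⁆∣≡1; x∈⁅x⁆; x∈⁅y⁆⇒x≡y;
    x∈p∩q⁺; p⊆q⇒∣p∣≤∣q∣; p⊂q⇒∣p∣<∣q∣)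
open import Data.List.Base using (List; []; _∷_; allFin; filter; map)
open import Data.List.Extrema.Nat using (argmin-sel; max≤v⁺; min≤v⁺; v≤max⁺)
open import Data.List.Membership.Propositional using (lose) renaming (_∈_ to _∈ₗ_)
open import Data.List.Membership.Propositional.Properties
  using (∈-allFin; ∈-filter⁺; ∈-filter⁻; ∈-map⁺; ∈-map⁻; ∈-++⁺ˡ; ∈-++⁺ʳ)
open import Data.List.Relation.Unary.Any using (here; there)
open import Data.Maybe.Base using (Maybe; just; nothing)
open import Data.Nat.Base using (ℕ; zero; suc; _+_; _*_; _^_; _≤_; _<_; _≥_; z≤n; s≤s)
open import Data.Nat.Properties as ℕ
  using (_≤?_; ≤-refl; ≤-reflexive; ≤-trans; ≤-antisym; ≤-pred; ≤-<-trans; ≤∧≢⇒<; ≤⇒≯; <⇒≱; ≰⇒>;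
    1+n≰n; n≤1+n; m≤m+n; +-0-commutativeMonoid; +-assoc; +-comm; +-identityʳ; +-suc; +-cancelˡ-≡;
    +-cancelʳ-≡; +-cancelˡ-≤; +-cancelʳ-≤; +-cancelʳ-<; +-mono-≤; +-monoˡ-≤; +-monoʳ-≤;
    +-monoʳ-<; *-identityʳ; ^-monoʳ-<; module ≤-Reasoning)
open import Data.Nat.Tactic.RingSolver using (solve-∀)
open import Data.Product.Base using (Σ; ∃; ∃₂; ∃-syntax; _×_; _,_; proj₁; proj₂)
open import Data.Sum.Base using (_⊎_; inj₁; inj₂; [_,_]′)
open import Data.Unit.Base using (⊤; tt)
open import Data.Vec.Base
  using (Vec; []; _∷_; _++_; drop; head; lookup; tabulate; tail; take; zipWith)
open import Data.Vec.Properties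
  using (++-injective; ∷-injective; []=⇒lookup; lookup⇒[]=; lookup-replicate; lookup-zipWith;
    lookup∘tabulate; tabulate∘lookup; tabulate-cong; take++drop≡id)
open import Function.Base using (_∘_; id)
open import Function.Bundles using (Inverse)
open import Relation.Binary.PropositionalEquality
  using (_≡_; _≢_; _≗_; refl; sym; trans; cong; cong₂; subst; subst₂; module ≡-Reasoning)
open import Relation.Nullary using (¬_; Dec; yes; no; does; contradiction)
open import Relation.Nullary.Decidable
  using (_×-dec_; _⊎-dec_; _→-dec_; ¬?; map′; dec-true; dec-false; decidable-stable)
open import Algebra.Properties.CommutativeMonoid.Sum +-0-commutativeMonoid
  using () renaming (sum to sumℕ; sum-cong-≗ to sumℕ-cong; ∑-distrib-+ to sumℕ-distrib-+)
open import Algebra.Properties.Semiring.Sum (CommutativeRing.semiring xor-∧-commutativeRing)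
  using (sum-cong-≗; ∑-distrib-+; ∑-comm; *-distribˡ-sum; *-distribʳ-sum; sum-replicate-zero)
open import Algebra.Properties.CommutativeSemigroup
  (CommutativeMonoid.commutativeSemigroup (CommutativeRing.+-commutativeMonoid xor-∧-commutativeRing))
  using () renaming (interchange to xor-interchange)

-- Linear algebra over GF(2)

-- Put e_v = x_v + x'_v. A vector of L that vanishes on R (or on Q) and follows directions keeping
-- κ(Q,R) at all removed vertices is zero on F; otherwise the critical direction t_v would be
-- harmless too. Cutting the difference of e_u and e_v in one class into its two sides therefore
-- shows that they agree on F, and e_v(v) = 0 because both summands are the only nonzero vector in
-- direction t_v at v. The cut that shows the damage done by t_v leaves i on one of its sides, so
-- x_v or x'_v vanishes at i, hence both do. If a + a' are the two sides of the difference, then x_u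
-- + x_v + a = x'_u + x'_v + a' vanishes on R by the first expression and on Q by the second: this
-- gives the w_j. The direction n_v, critical for neither pair, is usable in both countings. One
-- member of the class is subtracted from the others, so 2ℓ+1 vectors need a class of 2ℓ+2; the zero
-- candidate supplies the one element that is missing when |F| = (2ℓ+1)2^(2k).

infixl 6 _⊕_
infixl 9 _!_

_!_ : ∀ {n} {A : Set} → Vec A n → Fin n → A
_!_ = lookup

_⊕_ : ∀ {n} → Subset n → Subset n → Subset n
_⊕_ = zipWith _xor_

!-⊕ : ∀ {n} (z w : Subset n) i → (z ⊕ w) ! i ≡ (z ! i) xor (w ! i)
!-⊕ z w i = lookup-zipWith _xor_ i z w

!-⊥ : ∀ {n} (i : Fin n) → ⊥ ! i ≡ false
!-⊥ i = lookup-replicate i false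

!-ext : ∀ {n} {A : Set} {z w : Vec A n} → (∀ i → z ! i ≡ w ! i) → z ≡ w
!-ext {z = z} {w} e =
  trans (sym (tabulate∘lookup z)) (trans (tabulate-cong e) (tabulate∘lookup w))

xor-false⇒≡ : ∀ {a b} → a xor b ≡ false → a ≡ b
xor-false⇒≡ {false} {false} _ = refl
xor-false⇒≡ {true}  {true}  _ = refl

≡⇒xor-false : ∀ {a b} → a ≡ b → a xor b ≡ false
≡⇒xor-false {a} refl = xor-same a

xor-exchange : ∀ a b c d → a xor b ≡ c xor d → a xor c ≡ b xor d
xor-exchange false false false false _ = refl
xor-exchange false false true  true  _ = refl
xor-exchange false true  false true  _ = refl
xor-exchange false true  true  false _ = refl
xor-exchange true  false false true  _ = refl
xor-exchange true  false true  false _ = refl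
xor-exchange true  true  false false _ = refl
xor-exchange true  true  true  true  _ = refl

⊕≡⊥⇒≡ : ∀ {n} {z w : Subset n} → z ⊕ w ≡ ⊥ → z ≡ w
⊕≡⊥⇒≡ {z = z} {w} e = !-ext λ i → xor-false⇒≡
  (trans (sym (!-⊕ z w i)) (trans (cong (_! i) e) (!-⊥ i)))

⊕-cancel : ∀ {n} (z w : Subset n) → (z ⊕ w) ⊕ w ≡ z
⊕-cancel z w = !-ext λ i → trans (!-⊕ (z ⊕ w) w i)
  (trans (cong (_xor (w ! i)) (!-⊕ z w i))
  (trans (xor-assoc (z ! i) _ _)
  (trans (cong ((z ! i) xor_) (xor-same (w ! i))) (xor-identityʳ (z ! i)))))

⊕-comm : ∀ {n} (z w : Subset n) → z ⊕ w ≡ w ⊕ z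
⊕-comm z w = !-ext λ i → trans (!-⊕ z w i) (trans (xor-comm (z ! i) _) (sym (!-⊕ w z i)))

record Subspace (n : ℕ) : Set₁ where
  field
    Mem  : Subset n → Set
    mem? : ∀ z → Dec (Mem z)
    ⊥-mem : Mem ⊥
    ⊕-mem : ∀ {z w} → Mem z → Mem w → Mem (z ⊕ w)

open Subspace

infix 4 _≼_
_≼_ : ∀ {n} → Subspace n → Subspace n → Set
S ≼ T = ∀ {z} → Mem S z → Mem T z

-- Binary encoding reduces this to the pigeonhole principle for `Fin`. Most dimension bounds below
-- come from injections of this kind, so no bases have to be handled.
vecInjection⇒≤ : ∀ {m p} (f : Vec Bool m → Vec Bool p) →
  (∀ {u v} → f u ≡ f v → u ≡ v) → m ≤ p
vecInjection⇒≤ {m} {p} f f-inj with m ≤? p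
... | yes m≤p = m≤p
... | no  m≰p = contradiction (injective⇒≤ g-inj)
                  (<⇒≱ (^-monoʳ-< 2 (s≤s (s≤s z≤n)) (≰⇒> m≰p)))
  where
  open Inverse 2↔Bool
  decode : ∀ {q} → Fin (2 ^ q) → Vec Bool q
  decode {q} x = tabulate (to ∘ finToFun {2} {q} x)
  encode : ∀ {q} → Vec Bool q → Fin (2 ^ q)
  encode v = funToFin (from ∘ lookup v)
  funToFin-cong : ∀ {a b} {h h′ : Fin a → Fin b} → (∀ i → h i ≡ h′ i) → funToFin h ≡ funToFin h′
  funToFin-cong {zero}  e = refl
  funToFin-cong {suc a} e = cong₂ combine (e zero) (funToFin-cong (e ∘ suc))
  decode-inj : ∀ {q} {x y : Fin (2 ^ q)} → decode {q} x ≡ decode {q} y → x ≡ y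
  decode-inj {q} {x} {y} e =
    trans (sym (funToFin-finToFin {q} {2} x))
      (trans (funToFin-cong λ i →
        trans (sym (strictlyInverseʳ _))
        (trans (cong from (trans (sym (lookup∘tabulate _ i))
                 (trans (cong (_! i) e) (lookup∘tabulate _ i))))
               (strictlyInverseʳ _)))
      (funToFin-finToFin {q} {2} y))
  encode-inj : ∀ {q} {u v : Vec Bool q} → encode u ≡ encode v → u ≡ v
  encode-inj {u = u} {v} e = !-ext λ i →
    trans (sym (strictlyInverseˡ (u ! i)))
      (trans (cong to (trans (sym (finToFun-funToFin (from ∘ lookup u) i))
                (trans (cong (λ x → finToFun x i) e) (finToFun-funToFin (from ∘ lookup v) i))))
        (strictlyInverseˡ (v ! i)))
  g : Fin (2 ^ m) → Fin (2 ^ p)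
  g x = encode (f (decode x))
  g-inj : ∀ {x y} → g x ≡ g y → x ≡ y
  g-inj e = decode-inj {m} (f-inj (encode-inj e))

_⊑_ : ∀ {n} → Subset n → Subset n → Set
C ⊑ A = ∀ i → A ! i ≡ false → C ! i ≡ false

expand : ∀ {n} (A : Subset n) → Vec Bool ∣ A ∣ → Subset n
expand []          v       = []
expand (true ∷ A)  (b ∷ v) = b ∷ expand A v
expand (false ∷ A) v       = false ∷ expand A v

expand-⊑ : ∀ {n} (A : Subset n) v → expand A v ⊑ A
expand-⊑ (true ∷ A)  (b ∷ v) (suc i) e = expand-⊑ A v i e
expand-⊑ (false ∷ A) v       zero    e = refl
expand-⊑ (false ∷ A) v       (suc i) e = expand-⊑ A v i e

expand-injective : ∀ {n} (A : Subset n) {u v} → expand A u ≡ expand A v → u ≡ v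
expand-injective []          {[]}    {[]}    e = refl
expand-injective (true ∷ A)  {b ∷ u} {c ∷ v} e =
  cong₂ _∷_ (proj₁ (∷-injective e)) (expand-injective A (proj₂ (∷-injective e)))
expand-injective (false ∷ A) e = expand-injective A (proj₂ (∷-injective e))

compress : ∀ {n} (A : Subset n) → Subset n → Vec Bool ∣ A ∣
compress []          z       = []
compress (true ∷ A)  (b ∷ z) = b ∷ compress A z
compress (false ∷ A) (b ∷ z) = compress A z

compress-≡ : ∀ {n} (A : Subset n) {z w} → compress A z ≡ compress A w →
  ∀ i → A ! i ≡ true → z ! i ≡ w ! i
compress-≡ (true ∷ A)  {b ∷ z} {c ∷ w} e zero    _ = proj₁ (∷-injective e)
compress-≡ (true ∷ A)  {b ∷ z} {c ∷ w} e (suc i) t = compress-≡ A (proj₂ (∷-injective e)) i t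
compress-≡ (false ∷ A) {b ∷ z} {c ∷ w} e (suc i) t = compress-≡ A e i t

subsetInjection⇒≤ : ∀ {m n p} (A : Subset m) (B : Subset n) (f : Subset m → Subset n → Vec Bool p) →
  (∀ {C C′ D D′} → C ⊑ A → C′ ⊑ A → D ⊑ B → D′ ⊑ B → f C D ≡ f C′ D′ → C ≡ C′ × D ≡ D′) →
  ∣ A ∣ + ∣ B ∣ ≤ p
subsetInjection⇒≤ A B f f-inj = vecInjection⇒≤ g g-inj
  where
  g : Vec Bool (∣ A ∣ + ∣ B ∣) → Vec Bool _
  g v = f (expand A (take ∣ A ∣ v)) (expand B (drop ∣ A ∣ v))
  g-inj : ∀ {u v} → g u ≡ g v → u ≡ v
  g-inj {u} {v} e with f-inj (expand-⊑ A _) (expand-⊑ A _) (expand-⊑ B _) (expand-⊑ B _) e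
  ... | e₁ , e₂ = trans (sym (take++drop≡id ∣ A ∣ u))
        (trans (cong₂ _++_ (expand-injective A e₁) (expand-injective B e₂)) (take++drop≡id ∣ A ∣ v))

shift : ∀ {n} → Subspace (suc n) → Subspace n
shift S .Mem z = Mem S (false ∷ z)
shift S .mem? z = mem? S (false ∷ z)
shift S .⊥-mem = ⊥-mem S
shift S .⊕-mem = ⊕-mem S

-- The set of positions of the first true entry of the members of S; its size is the dimension of S.
lead : ∀ {n} → Subspace n → Subset n
lead {zero}  S = []
lead {suc n} S = does (anySubset? (λ z → mem? S (true ∷ z))) ∷ lead (shift S)

dim : ∀ {n} → Subspace n → ℕ
dim S = ∣ lead S ∣

-- A nonzero member has a first `true` entry, whose position belongs to `lead S`.
avoids-lead⇒⊥ : ∀ {n} (S : Subspace n) {z} → Mem S z →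
  (∀ i → lead S ! i ≡ true → z ! i ≡ false) → z ≡ ⊥
avoids-lead⇒⊥ {zero}  S {[]} _ _ = refl
avoids-lead⇒⊥ {suc n} S {true ∷ z} z∈S avoid =
  contradiction (avoid zero (dec-true (anySubset? (λ z → mem? S (true ∷ z))) (z , z∈S))) λ ()
avoids-lead⇒⊥ {suc n} S {false ∷ z} z∈S avoid =
  cong (false ∷_) (avoids-lead⇒⊥ (shift S) z∈S (avoid ∘ suc))

-- Gaussian elimination from the first coordinate on. Together with `agree-on-lead⇒≡` it identifies
-- the members of `S` with all bit patterns on `lead S`; hence `dim` is the usual dimension.
representative : ∀ {n} (S : Subspace n) (z : Subset n) →
  Σ (Subset n) λ p → Mem S p × (∀ i → lead S ! i ≡ true → z ! i ≡ p ! i)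
representative {zero} S [] = [] , ⊥-mem S , λ ()
representative {suc n} S (b ∷ z) with anySubset? (λ z → mem? S (true ∷ z))
representative {suc n} S (true ∷ z) | yes (w , w∈S) with representative (shift S) (z ⊕ w)
... | p , p∈S , agree = true ∷ (w ⊕ p) , ⊕-mem S w∈S p∈S , λ where
    zero    _ → refl
    (suc i) e → begin
      z ! i                             ≡⟨ cong (_! i) (⊕-cancel z w) ⟨
      ((z ⊕ w) ⊕ w) ! i                 ≡⟨ !-⊕ (z ⊕ w) w i ⟩
      ((z ⊕ w) ! i) xor (w ! i)         ≡⟨ cong (_xor (w ! i)) (agree i e) ⟩
      (p ! i) xor (w ! i)               ≡⟨ xor-comm (p ! i) _ ⟩
      (w ! i) xor (p ! i)               ≡⟨ !-⊕ w p i ⟨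
      (w ⊕ p) ! i                       ∎
  where open ≡-Reasoning
representative {suc n} S (false ∷ z) | yes _ with representative (shift S) z
... | p , p∈S , agree = false ∷ p , p∈S , λ where
  zero    _ → refl
  (suc i) e → agree i e
representative {suc n} S (b ∷ z) | no _ with representative (shift S) z
... | p , p∈S , agree = false ∷ p , p∈S , λ where
  (suc i) e → agree i e

agree-on-lead⇒≡ : ∀ {n} (S : Subspace n) {z w} → Mem S z → Mem S w →
  (∀ i → lead S ! i ≡ true → z ! i ≡ w ! i) → z ≡ w
agree-on-lead⇒≡ S {z} {w} z∈S w∈S agree = ⊕≡⊥⇒≡ (avoids-lead⇒⊥ S (⊕-mem S z∈S w∈S) λ i e →
  trans (!-⊕ z w i) (≡⇒xor-false (agree i e)))

lead⇒mem : ∀ {n} (S : Subspace n) i → lead S ! i ≡ true → ∃ λ z → Mem S z × z ! i ≡ true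
lead⇒mem {suc n} S zero e with anySubset? (λ z → mem? S (true ∷ z))
... | yes (z , z∈S) = true ∷ z , z∈S , refl
lead⇒mem {suc n} S (suc i) e with lead⇒mem (shift S) i e
... | z , z∈S , zi = false ∷ z , z∈S , zi

lead-mono : ∀ {n} (S T : Subspace n) → S ≼ T → lead S ⊆ lead T
lead-mono S T S≼T {i} i∈S = lookup⇒[]= i (lead T) (go S T S≼T i ([]=⇒lookup i∈S))
  where
  go : ∀ {n} (S T : Subspace n) → S ≼ T → ∀ i → lead S ! i ≡ true → lead T ! i ≡ true
  go S T S≼T zero e with anySubset? (λ z → mem? S (true ∷ z))
  ... | yes (z , z∈S) = dec-true (anySubset? (λ z → mem? T (true ∷ z))) (z , S≼T z∈S)
  go S T S≼T (suc i) e = go (shift S) (shift T) S≼T i e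

dim-mono : ∀ {n} (S T : Subspace n) → S ≼ T → dim S ≤ dim T
dim-mono S T S≼T = p⊆q⇒∣p∣≤∣q∣ (lead-mono S T S≼T)

-- The sets `lead S` and `lead T` must coincide, so the member of `S` that matches `z` on `lead S`
-- matches it on `lead T` and equals it.
dim-≤⇒≽ : ∀ {n} (S T : Subspace n) → S ≼ T → dim T ≤ dim S → T ≼ S
dim-≤⇒≽ S T S≼T dT≤dS {z} z∈T with representative S z
... | p , p∈S , agree = subst (Mem S) (sym (agree-on-lead⇒≡ T z∈T (S≼T p∈S) agree′)) p∈S
  where
  agree′ : ∀ i → lead T ! i ≡ true → z ! i ≡ p ! i
  agree′ i i∈T with lead S ! i in eq
  ... | true = agree i eq
  ... | false = contradiction (p⊂q⇒∣p∣<∣q∣ (lead-mono S T S≼T , i , lookup⇒[]= i _ i∈T , i∉S))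
                  (≤⇒≯ dT≤dS)
    where
    i∉S : ¬ (i ∈ lead S)
    i∉S i∈S = contradiction (trans (sym eq) ([]=⇒lookup i∈S)) λ ()

dim-<⇒∃ : ∀ {n} (S T : Subspace n) → dim S < dim T → ∃ λ z → Mem T z × ¬ Mem S z
dim-<⇒∃ S T dS<dT with anySubset? (λ z → mem? T z ×-dec ¬? (mem? S z))
... | yes found = found
... | no none = contradiction dS<dT (≤⇒≯ (dim-mono T S λ {z} z∈T →
        decidable-stable (mem? S z) λ z∉S → none (z , z∈T , z∉S)))

injection⇒dim-+-≤ : ∀ {m n p} (S : Subspace m) (T : Subspace n) (f : Subset m → Subset n → Vec Bool p) →
  (∀ {z z′ w w′} → Mem S z → Mem S z′ → Mem T w → Mem T w′ → f z w ≡ f z′ w′ → z ≡ z′ × w ≡ w′) →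
  dim S + dim T ≤ p
injection⇒dim-+-≤ S T f f-inj = subsetInjection⇒≤ (lead S) (lead T)
  (λ C D → f (rep S C) (rep T D))
  λ C⊑ C′⊑ D⊑ D′⊑ e →
    let e₁ , e₂ = f-inj (rep-mem S _) (rep-mem S _) (rep-mem T _) (rep-mem T _) e
    in rep-inj S C⊑ C′⊑ e₁ , rep-inj T D⊑ D′⊑ e₂
  where
  rep : ∀ {q} → Subspace q → Subset q → Subset q
  rep U C = proj₁ (representative U C)
  rep-mem : ∀ {q} (U : Subspace q) C → Mem U (rep U C)
  rep-mem U C = proj₁ (proj₂ (representative U C))
  rep-inj : ∀ {q} (U : Subspace q) {C C′} → C ⊑ lead U → C′ ⊑ lead U → rep U C ≡ rep U C′ → C ≡ C′
  rep-inj U {C} {C′} C⊑ C′⊑ e = !-ext go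
    where
    go : ∀ i → C ! i ≡ C′ ! i
    go i with lead U ! i in eq
    ... | false = trans (C⊑ i eq) (sym (C′⊑ i eq))
    ... | true  = trans (proj₂ (proj₂ (representative U C)) i eq)
                    (trans (cong (_! i) e) (sym (proj₂ (proj₂ (representative U C′)) i eq)))

injection⇒dim-≤ : ∀ {n p} (S : Subspace n) (f : Subset n → Vec Bool p) →
  (∀ {z z′} → Mem S z → Mem S z′ → f z ≡ f z′ → z ≡ z′) → dim S ≤ p
injection⇒dim-≤ {n} S f f-inj = ≤-trans (≤-reflexive (sym (+-identityʳ _)))
  (injection⇒dim-+-≤ S point (λ z _ → f z) λ {_} {_} {w} {w′} z z′ _ _ e →
    f-inj z z′ e , []-unique w w′)
  where
  point : Subspace 0
  point .Mem _ = ⊤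
  point .mem? _ = yes _
  point .⊥-mem = _
  point .⊕-mem _ _ = _
  []-unique : (w w′ : Subset 0) → w ≡ w′
  []-unique [] [] = refl

injection⇒dim-≤-dim : ∀ {m n} (S : Subspace m) (T : Subspace n) (f : Subset m → Subset n) →
  (∀ {z} → Mem S z → Mem T (f z)) →
  (∀ {z z′} → Mem S z → Mem S z′ → f z ≡ f z′ → z ≡ z′) → dim S ≤ dim T
injection⇒dim-≤-dim S T f f-mem f-inj = injection⇒dim-≤ S (compress (lead T) ∘ f) λ z z′ e →
  f-inj z z′ (agree-on-lead⇒≡ T (f-mem z) (f-mem z′) (compress-≡ (lead T) e))

-- The modular law, with `I` above the intersection and `J` above the sum. A pair is determined by
-- the lead entries of `z` for `I` and of `z ⊕ w` for `J`: once the sums agree, `z ⊕ z′` equals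
-- `w ⊕ w′` and so lies in `I`.
modular : ∀ {n} (S T I J : Subspace n) →
  (∀ {z} → Mem S z → Mem T z → Mem I z) →
  (∀ {z w} → Mem S z → Mem T w → Mem J (z ⊕ w)) →
  dim S + dim T ≤ dim I + dim J
modular S T I J ∩⊆I +⊆J = injection⇒dim-+-≤ S T f f-inj
  where
  f : Subset _ → Subset _ → Vec Bool (dim I + dim J)
  f z w = compress (lead I) z ++ compress (lead J) (z ⊕ w)
  f-inj : ∀ {z z′ w w′} → Mem S z → Mem S z′ → Mem T w → Mem T w′ → f z w ≡ f z′ w′ → z ≡ z′ × w ≡ w′
  f-inj {z} {z′} {w} {w′} zS zS′ wT wT′ e = z≡z′ ,
      !-ext λ i → xor-false⇒≡ (trans (sym (zz≡ww i)) (≡⇒xor-false (cong (_! i) z≡z′)))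
    where
    e₁ = proj₁ (++-injective (compress (lead I) z) _ e)
    e₂ = proj₂ (++-injective (compress (lead I) z) _ e)
    sum≡ : z ⊕ w ≡ z′ ⊕ w′
    sum≡ = agree-on-lead⇒≡ J (+⊆J zS wT) (+⊆J zS′ wT′) (compress-≡ (lead J) e₂)
    zz≡ww : ∀ i → (z ! i) xor (z′ ! i) ≡ (w ! i) xor (w′ ! i)
    zz≡ww i = xor-exchange (z ! i) _ _ _ (trans (sym (!-⊕ z w i)) (trans (cong (_! i) sum≡) (!-⊕ z′ w′ i)))
    zz∈I : Mem I (z ⊕ z′)
    zz∈I = ∩⊆I (⊕-mem S zS zS′) (subst (Mem T)
      (!-ext λ i → trans (!-⊕ w w′ i) (trans (sym (zz≡ww i)) (sym (!-⊕ z z′ i)))) (⊕-mem T wT wT′))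
    z≡z′ : z ≡ z′
    z≡z′ = ⊕≡⊥⇒≡ (avoids-lead⇒⊥ I zz∈I λ i i∈ →
      trans (!-⊕ z z′ i) (≡⇒xor-false (compress-≡ (lead I) e₁ i i∈)))

-- A member of `S` is determined by `φ` and its entries on `lead T`: if two members agree in these,
-- their difference lies in `T` and avoids `lead T`.
hyperplane : ∀ {n} (S T : Subspace n) (φ : Subset n → Bool) →
  (∀ z w → φ (z ⊕ w) ≡ φ z xor φ w) →
  (∀ {z} → Mem S z → φ z ≡ false → Mem T z) →
  dim S ≤ suc (dim T)
hyperplane S T φ φ-⊕ kernel⊆T = injection⇒dim-≤ S (λ z → φ z ∷ compress (lead T) z)
  λ {z} {z′} zS zS′ e → ⊕≡⊥⇒≡ (avoids-lead⇒⊥ T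
    (kernel⊆T (⊕-mem S zS zS′) (trans (φ-⊕ z z′) (≡⇒xor-false (proj₁ (∷-injective e)))))
    λ i i∈ → trans (!-⊕ z z′ i) (≡⇒xor-false (compress-≡ (lead T) (proj₂ (∷-injective e)) i i∈)))

∣─∣ : ∀ {n} (A L : Subset n) → L ⊑ A → ∣ zipWith (λ a l → a ∧ not l) A L ∣ + ∣ L ∣ ≡ ∣ A ∣
∣─∣ []          []          _   = refl
∣─∣ (true ∷ A)  (true ∷ L)  L⊑A = trans (+-suc _ _) (cong suc (∣─∣ A L (L⊑A ∘ suc)))
∣─∣ (true ∷ A)  (false ∷ L) L⊑A = cong suc (∣─∣ A L (L⊑A ∘ suc))
∣─∣ (false ∷ A) (true ∷ L)  L⊑A = contradiction (L⊑A zero refl) λ ()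
∣─∣ (false ∷ A) (false ∷ L) L⊑A = ∣─∣ A L (L⊑A ∘ suc)

-- Coordinates for the subsets of `A` modulo `S`, when all members of `S` are contained in `A`. In
-- `rank-nullity` they become a largest independent set of rows.
_∖lead_ : ∀ {n} → Subset n → Subspace n → Subset n
A ∖lead S = zipWith (λ a l → a ∧ not l) A (lead S)

∣∖lead∣ : ∀ {n} (S : Subspace n) (A : Subset n) → (∀ {z} → Mem S z → z ⊑ A) → ∣ A ∖lead S ∣ + dim S ≡ ∣ A ∣
∣∖lead∣ S A S⊑A = ∣─∣ A (lead S) lead⊑A
  where
  lead⊑A : lead S ⊑ A
  lead⊑A i i∉A with lead S ! i in eq
  ... | false = refl
  ... | true with lead⇒mem S i eq
  ... | z , z∈S , zi = trans (sym zi) (S⊑A z∈S i i∉A)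

∖lead-∌ : ∀ {n} (S : Subspace n) (A : Subset n) i → (A ∖lead S) ! i ≡ false → A ! i ≡ true → lead S ! i ≡ true
∖lead-∌ S A i e i∈A with lead S ! i | trans (sym (lookup-zipWith (λ a l → a ∧ not l) i A (lead S))) e
... | true  | _  = refl
... | false | e′ rewrite i∈A = contradiction e′ λ ()

∖lead-⊑ : ∀ {n} (S : Subspace n) (A : Subset n) → (A ∖lead S) ⊑ A
∖lead-⊑ S A i i∉A = trans (lookup-zipWith _ i A (lead S)) (cong (_∧ _) i∉A)

∖lead-lead : ∀ {n} (S : Subspace n) (A : Subset n) i → lead S ! i ≡ true → (A ∖lead S) ! i ≡ false
∖lead-lead S A i e = trans (lookup-zipWith _ i A (lead S)) (trans (cong (λ l → A ! i ∧ not l) e) (∧-zeroʳ (A ! i)))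

-- Adding the member of `S` that matches `z` on `lead S` leaves a remainder within `A ∖lead S`, and
-- `c` reads off its `k` bits.
quotient-map : ∀ {n k} (S : Subspace n) (A : Subset n) → (∀ {z} → Mem S z → z ⊑ A) → ∣ A ∣ ≡ dim S + k →
  Σ (Subset n → Vec Bool k) λ c → ∀ {z w} → z ⊑ A → w ⊑ A → c z ≡ c w → Mem S (z ⊕ w)
quotient-map {n} {k} S A S⊑A ∣A∣≡ = subst (λ k → Σ (Subset n → Vec Bool k) λ c → ∀ {z w} → z ⊑ A → w ⊑ A → c z ≡ c w → Mem S (z ⊕ w))
    (+-cancelʳ-≡ (dim S) _ _ (trans (∣∖lead∣ S A S⊑A) (trans ∣A∣≡ (+-comm (dim S) k))))
    (c , separates)
  where
  rep : Subset n → Subset n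
  rep z = proj₁ (representative S z)
  rep∈S : ∀ z → Mem S (rep z)
  rep∈S z = proj₁ (proj₂ (representative S z))
  c : Subset n → Vec Bool ∣ A ∖lead S ∣
  c z = compress (A ∖lead S) (z ⊕ rep z)
  vanishes : ∀ {z} → z ⊑ A → ∀ i → (A ∖lead S) ! i ≡ false → (z ⊕ rep z) ! i ≡ false
  vanishes {z} z⊑A i e with A ! i in i∈A
  ... | false = trans (!-⊕ z (rep z) i) (cong₂ _xor_ (z⊑A i i∈A) (S⊑A (rep∈S z) i i∈A))
  ... | true  = trans (!-⊕ z (rep z) i) (≡⇒xor-false (proj₂ (proj₂ (representative S z)) i (∖lead-∌ S A i e i∈A)))
  separates : ∀ {z w} → z ⊑ A → w ⊑ A → c z ≡ c w → Mem S (z ⊕ w)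
  separates {z} {w} z⊑A w⊑A e = subst (Mem S) (sym z⊕w≡) (⊕-mem S (rep∈S z) (rep∈S w))
    where
    reduced≡ : ∀ i → (z ⊕ rep z) ! i ≡ (w ⊕ rep w) ! i
    reduced≡ i with (A ∖lead S) ! i in eq
    ... | true  = compress-≡ (A ∖lead S) e i eq
    ... | false = trans (vanishes {z} z⊑A i eq) (sym (vanishes {w} w⊑A i eq))
    z⊕w≡ : z ⊕ w ≡ rep z ⊕ rep w
    z⊕w≡ = !-ext λ i → trans (!-⊕ z w i) (trans
      (xor-exchange (z ! i) _ _ _ (trans (sym (!-⊕ z (rep z) i)) (trans (reduced≡ i) (!-⊕ w (rep w) i))))
      (sym (!-⊕ (rep z) (rep w) i)))

-- Pigeonhole principle, finite choice and subset sums

∣∩∣+∣─∣ : ∀ {n} (A H : Subset n) →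
  ∣ zipWith _∧_ A H ∣ + ∣ zipWith (λ a h → a ∧ not h) A H ∣ ≡ ∣ A ∣
∣∩∣+∣─∣ []          []          = refl
∣∩∣+∣─∣ (true ∷ A)  (true ∷ H)  = cong suc (∣∩∣+∣─∣ A H)
∣∩∣+∣─∣ (true ∷ A)  (false ∷ H) = trans (+-suc _ _) (cong suc (∣∩∣+∣─∣ A H))
∣∩∣+∣─∣ (false ∷ A) (true ∷ H)  = ∣∩∣+∣─∣ A H
∣∩∣+∣─∣ (false ∷ A) (false ∷ H) = ∣∩∣+∣─∣ A H

-- Splitting by the first bit of the colour leaves more than `M * 2 ^ K` elements in one of the two
-- halves.
pigeonhole : ∀ {n} K (A : Subset n) (c : Fin n → Vec Bool K) M → M * 2 ^ K < ∣ A ∣ →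
  Σ (Subset n) λ J → (∀ i → J ! i ≡ true → A ! i ≡ true) × M < ∣ J ∣ ×
    (∀ i j → J ! i ≡ true → J ! j ≡ true → c i ≡ c j)
pigeonhole zero A c M M<∣A∣ = A , (λ _ e → e) , subst (_< ∣ A ∣) (*-identityʳ M) M<∣A∣ , λ i j _ _ → []-unique (c i) (c j)
  where
  []-unique : (u v : Vec Bool 0) → u ≡ v
  []-unique [] [] = refl
pigeonhole {n} (suc K) A c M M<∣A∣ = result
  where
  H A₁ A₀ : Subset n
  H = tabulate (head ∘ c)
  A₁ = zipWith _∧_ A H
  A₀ = zipWith (λ a h → a ∧ not h) A H
  A₁⇒ : ∀ i → A₁ ! i ≡ true → A ! i ≡ true × head (c i) ≡ true
  A₁⇒ i e with A ! i | head (c i) | trans (sym (trans (lookup-zipWith _∧_ i A H) (cong (A ! i ∧_) (lookup∘tabulate (head ∘ c) i)))) e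
  ... | true | true | _ = refl , refl
  A₀⇒ : ∀ i → A₀ ! i ≡ true → A ! i ≡ true × head (c i) ≡ false
  A₀⇒ i e with A ! i | head (c i) | trans (sym (trans (lookup-zipWith (λ a h → a ∧ not h) i A H)
                                      (cong (λ h → A ! i ∧ not h) (lookup∘tabulate (head ∘ c) i)))) e
  ... | true | false | _ = refl , refl
  Result : Set
  Result = Σ (Subset n) λ J → (∀ i → J ! i ≡ true → A ! i ≡ true) × M < ∣ J ∣ ×
    (∀ i j → J ! i ≡ true → J ! j ≡ true → c i ≡ c j)
  refine : (B : Subset n) (b : Bool) → (∀ i → B ! i ≡ true → A ! i ≡ true × head (c i) ≡ b) →
    M * 2 ^ K < ∣ B ∣ → Result
  refine B b B⇒ M< with pigeonhole K B (tail ∘ c) M M<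
  ... | J , J⇒B , M<∣J∣ , mono = J , (λ i e → proj₁ (B⇒ i (J⇒B i e))) , M<∣J∣ , λ i j i∈ j∈ →
    head-tail (c i) (c j) (trans (proj₂ (B⇒ i (J⇒B i i∈))) (sym (proj₂ (B⇒ j (J⇒B j j∈))))) (mono i j i∈ j∈)
    where
    head-tail : (u v : Vec Bool (suc K)) → head u ≡ head v → tail u ≡ tail v → u ≡ v
    head-tail (_ ∷ _) (_ ∷ _) = cong₂ _∷_
  result : Result
  result with suc (M * 2 ^ K) ≤? ∣ A₁ ∣ | suc (M * 2 ^ K) ≤? ∣ A₀ ∣
  ... | yes p | _     = refine A₁ true A₁⇒ p
  ... | no _  | yes p = refine A₀ false A₀⇒ p
  ... | no ¬p | no ¬q = contradiction M<∣A∣ (≤⇒≯ (begin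
    ∣ A ∣                            ≡⟨ ∣∩∣+∣─∣ A H ⟨
    ∣ A₁ ∣ + ∣ A₀ ∣                  ≤⟨ +-mono-≤ (≤-pred (≰⇒> ¬p)) (≤-pred (≰⇒> ¬q)) ⟩
    M * 2 ^ K + M * 2 ^ K            ≡⟨ double M (2 ^ K) ⟩
    M * 2 ^ suc K                    ∎))
    where
    open ≤-Reasoning
    double : ∀ a b → a * b + a * b ≡ a * (2 * b)
    double = solve-∀

choice : ∀ {n} {A : Set} {P : Fin n → A → Set} (F : Subset n) → A → (∀ v → F ! v ≡ true → Σ A (P v)) →
  Σ (Fin n → A) λ f → ∀ v → F ! v ≡ true → P v (f v)
choice {A = A} {P} F default g = (λ v → proj₁ (pick v)) , λ v → proj₂ (pick v)
  where
  pick : ∀ v → Σ A λ a → F ! v ≡ true → P v a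
  pick v with F ! v | g v
  ... | false | _ = default , λ ()
  ... | true  | h = proj₁ (h refl) , λ _ → proj₂ (h refl)

⨁ : ∀ {m n} → Subset m → (Fin m → Subset n) → Subset n
⨁ []      w = ⊥
⨁ (b ∷ I) w = (if b then w zero else ⊥) ⊕ ⨁ I (w ∘ suc)

⨁-preserves : ∀ {m n} (P : Subset n → Set) → P ⊥ → (∀ {z w} → P z → P w → P (z ⊕ w)) →
  (I : Subset m) (w : Fin m → Subset n) → (∀ j → I ! j ≡ true → P (w j)) → P (⨁ I w)
⨁-preserves P P⊥ P⊕ []          w h = P⊥
⨁-preserves P P⊥ P⊕ (true ∷ I)  w h = P⊕ (h zero refl) (⨁-preserves P P⊥ P⊕ I (w ∘ suc) (h ∘ suc))
⨁-preserves P P⊥ P⊕ (false ∷ I) w h = P⊕ P⊥ (⨁-preserves P P⊥ P⊕ I (w ∘ suc) (h ∘ suc))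

-- With one such functional for each `j`, dual to the vectors `w`, the set `I` can be recovered from
-- its subset sum.
⨁-coordinate : ∀ {m n} (φ : Subset n → Bool) → φ ⊥ ≡ false → (∀ z w → φ (z ⊕ w) ≡ φ z xor φ w) →
  (I : Subset m) (w : Fin m → Subset n) (j : Fin m) → φ (w j) ≡ true →
  (∀ i → I ! i ≡ true → i ≢ j → φ (w i) ≡ false) → φ (⨁ I w) ≡ I ! j
⨁-coordinate φ φ⊥ φ⊕ (b ∷ I) w zero φj others = begin
  φ ((if b then w zero else ⊥) ⊕ ⨁ I (w ∘ suc))         ≡⟨ φ⊕ _ _ ⟩
  φ (if b then w zero else ⊥) xor φ (⨁ I (w ∘ suc))     ≡⟨ cong₂ _xor_ (first b) rest ⟩
  b xor false                                           ≡⟨ xor-identityʳ b ⟩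
  b                                                     ∎
  where
  open ≡-Reasoning
  first : ∀ b → φ (if b then w zero else ⊥) ≡ b
  first true  = φj
  first false = φ⊥
  rest : φ (⨁ I (w ∘ suc)) ≡ false
  rest = ⨁-preserves (λ z → φ z ≡ false) φ⊥ (λ {z} {w} e e′ → trans (φ⊕ z w) (cong₂ _xor_ e e′)) I (w ∘ suc)
    λ i i∈ → others (suc i) i∈ λ ()
⨁-coordinate φ φ⊥ φ⊕ (b ∷ I) w (suc j) φj others = begin
  φ ((if b then w zero else ⊥) ⊕ ⨁ I (w ∘ suc))         ≡⟨ φ⊕ _ _ ⟩
  φ (if b then w zero else ⊥) xor φ (⨁ I (w ∘ suc))     ≡⟨ cong₂ _xor_ (first b refl) (⨁-coordinate φ φ⊥ φ⊕ I (w ∘ suc) j φj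
                                                              λ i i∈ i≢j → others (suc i) i∈ λ { refl → i≢j refl }) ⟩
  I ! j                                                 ∎
  where
  open ≡-Reasoning
  first : ∀ c → b ≡ c → φ (if c then w zero else ⊥) ≡ false
  first true  refl = others zero refl λ ()
  first false _    = φ⊥

-- The Lagrangian subspace of a graph

infixl 8 _[_≔_]

_[_≔_] : ∀ {n} {A : Set} → (Fin n → A) → Fin n → A → Fin n → A
(f [ v ≔ a ]) i = if does (i ≟ v) then a else f i

[≔]-same : ∀ {n} {A : Set} (f : Fin n → A) v {a} → (f [ v ≔ a ]) v ≡ a
[≔]-same f v with v ≟ v
... | yes _   = refl
... | no  v≢v = contradiction refl v≢v

[≔]-other : ∀ {n} {A : Set} (f : Fin n → A) v {a i} → i ≢ v → (f [ v ≔ a ]) i ≡ f i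
[≔]-other f v {i = i} i≢v with i ≟ v
... | yes i≡v = contradiction i≡v i≢v
... | no  _   = refl

[≔]-id : ∀ {n} {A : Set} (f : Fin n → A) v {a} → f v ≡ a → f [ v ≔ a ] ≗ f
[≔]-id f v fv≡a i with i ≟ v
... | yes refl = sym fv≡a
... | no  _    = refl

module _ {n} {A : Set} (Φ : (Fin n → A) → Set) (Φ-resp : ∀ {f g} → f ≗ g → Φ f → Φ g)
  (R : Fin n → A → A → Set) (R-refl : ∀ {i a b} → R i a b → R i b b)
  (step : ∀ f v a → R v (f v) a → Φ f → Φ (f [ v ≔ a ])) where

  -- Extends a change at one vertex to a change everywhere by going through a list of all vertices;
  -- `R-refl` covers a vertex that already has its new value.
  change-pointwise : ∀ f g → (∀ i → R i (f i) (g i)) → Φ f → Φ g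
  change-pointwise f g r Φf = Φ-resp (λ i → changed (∈-allFin i)) (reach (allFin n))
    where
    mix : List (Fin n) → Fin n → A
    mix []       = f
    mix (v ∷ vs) = mix vs [ v ≔ g v ]
    mix-R : ∀ vs i → R i (mix vs i) (g i)
    mix-R []       i = r i
    mix-R (v ∷ vs) i with i ≟ v
    ... | yes refl = R-refl (r i)
    ... | no  _    = mix-R vs i
    reach : ∀ vs → Φ (mix vs)
    reach []       = Φf
    reach (v ∷ vs) = step (mix vs) v (g v) (mix-R vs v) (reach vs)
    changed : ∀ {i vs} → i ∈ₗ vs → mix vs i ≡ g i
    changed {i} {v ∷ vs} i∈ with i ≟ v
    ... | yes refl = refl
    changed {i} {v ∷ vs} (here i≡v) | no i≢v = contradiction i≡v i≢v
    changed {i} {v ∷ vs} (there i∈) | no _   = changed i∈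

sum-single : ∀ {n} (f : Fin n → Bool) v → (∀ i → i ≢ v → f i ≡ false) → sum₂ f ≡ f v
sum-single {suc n} f zero e =
  trans (cong (f zero xor_) (trans (sum-cong-≗ {n} λ i → e (suc i) λ ()) (sum-replicate-zero n)))
    (xor-identityʳ (f zero))
sum-single {suc n} f (suc v) e rewrite e zero (λ ()) =
  sum-single (f ∘ suc) v λ i i≢v → e (suc i) λ { refl → i≢v refl }

sum-zero : ∀ {n} (f : Fin n → Bool) → (∀ i → f i ≡ false) → sum₂ f ≡ false
sum-zero {n} f e = trans (sum-cong-≗ {n} e) (sum-replicate-zero n)

sumℕ-exchange : ∀ {n} (f g : Fin n → ℕ) v → (∀ i → i ≢ v → f i ≡ g i) →
  sumℕ f + g v ≡ sumℕ g + f v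
sumℕ-exchange {suc n} f g zero e
  rewrite sumℕ-cong {n} {f ∘ suc} {g ∘ suc} (λ i → e (suc i) λ ()) =
  lemma (f zero) (sumℕ (g ∘ suc)) (g zero)
  where
  lemma : ∀ a s b → a + s + b ≡ b + s + a
  lemma = solve-∀
sumℕ-exchange {suc n} f g (suc v) e
  rewrite e zero (λ ()) = trans (lemma (g zero) _ _) (trans
    (cong (g zero +_) (sumℕ-exchange (f ∘ suc) (g ∘ suc) v λ i i≢v → e (suc i) λ { refl → i≢v refl }))
    (sym (lemma (g zero) _ _)))
  where
  lemma : ∀ a s b → a + s + b ≡ a + (s + b)
  lemma = solve-∀

-- The nonzero vectors (0,1), (1,1), (1,0) of GF(2)²; removing v along each of them is G ∖ v, G ⋆ v ∖ v
-- and G ∧[ u , v ] ∖ v respectively.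
data Direction : Set where
  del star piv : Direction

_≟ᵈ_ : (a b : Direction) → Dec (a ≡ b)
del  ≟ᵈ del  = yes refl
del  ≟ᵈ star = no λ ()
del  ≟ᵈ piv  = no λ ()
star ≟ᵈ del  = no λ ()
star ≟ᵈ star = yes refl
star ≟ᵈ piv  = no λ ()
piv  ≟ᵈ del  = no λ ()
piv  ≟ᵈ star = no λ ()
piv  ≟ᵈ piv  = yes refl

-- The symplectic product with the vector of the given direction.
along : Direction → Bool → Bool → Bool
along del  c d = c
along star c d = c xor d
along piv  c d = d

-- What a state prescribes at a vertex: nothing, the zero vector, or a multiple of the given direction.
data Constraint : Set where
  free null : Constraint
  line      : Direction → Constraint

Sat : Constraint → Bool → Bool → Set
Sat free     c d = ⊤
Sat null     c d = c ≡ false × d ≡ false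
Sat (line a) c d = along a c d ≡ false

Sat? : ∀ s c d → Dec (Sat s c d)
Sat? free     c d = yes tt
Sat? null     c d = (c Bool.≟ false) ×-dec (d Bool.≟ false)
Sat? (line a) c d = along a c d Bool.≟ false

along-xor : ∀ a c d c′ d′ → along a (c xor c′) (d xor d′) ≡ along a c d xor along a c′ d′
along-xor del  c d c′ d′ = refl
along-xor piv  c d c′ d′ = refl
along-xor star false d c′ d′ with c′
... | false = refl
... | true with d | d′
... | false | false = refl
... | false | true = refl
... | true | false = refl
... | true | true = refl
along-xor star true d c′ d′ with c′ | d | d′
... | false | false | false = refl
... | false | false | true  = refl
... | false | true  | false = refl
... | false | true  | true  = refl
... | true  | false | false = refl
... | true  | false | true  = refl
... | true  | true  | false = refl
... | true  | true  | true  = refl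

Sat-xor : ∀ s {c d c′ d′} → Sat s c d → Sat s c′ d′ → Sat s (c xor c′) (d xor d′)
Sat-xor free     _ _ = tt
Sat-xor null     (refl , refl) (refl , refl) = refl , refl
Sat-xor (line a) {c} {d} {c′} {d′} e e′ = trans (along-xor a c d c′ d′) (cong₂ _xor_ e e′)

Sat-null⇒Sat : ∀ s {c d} → Sat null c d → Sat s c d
Sat-null⇒Sat free        _             = tt
Sat-null⇒Sat null        e             = e
Sat-null⇒Sat (line del)  (refl , refl) = refl
Sat-null⇒Sat (line star) (refl , refl) = refl
Sat-null⇒Sat (line piv)  (refl , refl) = refl

two-lines⇒null : ∀ a b {c d} → a ≢ b → Sat (line a) c d → Sat (line b) c d → Sat null c d
two-lines⇒null del  del  a≢b _ _ = contradiction refl a≢b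
two-lines⇒null star star a≢b _ _ = contradiction refl a≢b
two-lines⇒null piv  piv  a≢b _ _ = contradiction refl a≢b
two-lines⇒null del  star {false} {false} _ _ _ = refl , refl
two-lines⇒null del  piv  {false} {false} _ _ _ = refl , refl
two-lines⇒null star del  {false} {false} _ _ _ = refl , refl
two-lines⇒null star piv  {false} {false} _ _ _ = refl , refl
two-lines⇒null piv  del  {false} {false} _ _ _ = refl , refl
two-lines⇒null piv  star {false} {false} _ _ _ = refl , refl

-- The orthogonal complement for the symplectic `form`; each line of GF(2)² is its own.
dual : Constraint → Constraint
dual free     = null
dual null     = free
dual (line a) = line a

dual-involutive : ∀ s → dual (dual s) ≡ s
dual-involutive free     = refl
dual-involutive null     = refl
dual-involutive (line a) = refl

form : Bool → Bool → Bool → Bool → Bool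
form c d c′ d′ = (c ∧ d′) xor (d ∧ c′)

form-dual : ∀ s {c d c′ d′} → Sat s c d → Sat (dual s) c′ d′ → form c d c′ d′ ≡ false
form-dual free {false} {false} _ (refl , refl) = refl
form-dual free {false} {true}  _ (refl , refl) = refl
form-dual free {true}  {false} _ (refl , refl) = refl
form-dual free {true}  {true}  _ (refl , refl) = refl
form-dual null (refl , refl) _ = refl
form-dual (line del)  {false} {false} {false} _ _ = refl
form-dual (line del)  {false} {true}  {false} _ _ = refl
form-dual (line star) {false} {false} _ _ = refl
form-dual (line star) {true} {true} {false} {false} _ _ = refl
form-dual (line star) {true} {true} {true} {true} _ _ = refl
form-dual (line piv)  {false} {false} {c′} {false} _ _ = refl
form-dual (line piv)  {true}  {false} {c′} {false} _ _ = refl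

frees : Constraint → ℕ
frees free     = 1
frees null     = 0
frees (line a) = 0

meet join : Constraint → Constraint → Constraint
meet free     t        = t
meet null     t        = null
meet (line a) free     = line a
meet (line a) null     = null
meet (line a) (line b) with a ≟ᵈ b
... | yes _ = line a
... | no  _ = null
join free     t        = free
join null     t        = t
join (line a) free     = free
join (line a) null     = line a
join (line a) (line b) with a ≟ᵈ b
... | yes _ = line a
... | no  _ = free

Sat-meet : ∀ s t {c d} → Sat s c d → Sat t c d → Sat (meet s t) c d
Sat-meet free     t        _ e = e
Sat-meet null     t        e _ = e
Sat-meet (line a) free     e _ = e
Sat-meet (line a) null     _ e = e
Sat-meet (line a) (line b) e e′ with a ≟ᵈ b
... | yes _   = e
... | no  a≢b = two-lines⇒null a b a≢b e e′

Sat-join : ∀ s t {c d c′ d′} → Sat s c d → Sat t c′ d′ → Sat (join s t) (c xor c′) (d xor d′)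
Sat-join free     t        _ _ = tt
Sat-join null     t        (refl , refl) e = e
Sat-join (line a) free     _ _ = tt
Sat-join (line a) null     {c} {d} e (refl , refl) =
  trans (cong₂ (along a) (xor-identityʳ c) (xor-identityʳ d)) e
Sat-join (line a) (line b) e e′ with a ≟ᵈ b
... | yes refl = Sat-xor (line a) e e′
... | no  _    = tt

data Clash : Constraint → Constraint → Set where
  clash : ∀ {a b} → a ≢ b → Clash (line a) (line b)

-- Two distinct lines are the only exception: they meet in `null` and join to `free`, which raises
-- the count by one.
frees-meet-join : ∀ s t → ¬ Clash s t → frees (meet s t) + frees (join s t) ≡ frees s + frees t
frees-meet-join free     t        _ = +-comm (frees t) 1
frees-meet-join null     t        _ = refl
frees-meet-join (line a) free     _ = refl
frees-meet-join (line a) null     _ = refl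
frees-meet-join (line a) (line b) ¬clash with a ≟ᵈ b
... | yes _   = refl
... | no  a≢b = contradiction (clash a≢b) ¬clash

frees-meet-join-≤ : ∀ s t → frees (meet s t) + frees (join s t) ≤ suc (frees s + frees t)
frees-meet-join-≤ free     t        = ≤-trans (≤-reflexive (+-comm (frees t) 1)) (n≤1+n _)
frees-meet-join-≤ null     t        = n≤1+n _
frees-meet-join-≤ (line a) free     = n≤1+n _
frees-meet-join-≤ (line a) null     = n≤1+n _
frees-meet-join-≤ (line a) (line b) with a ≟ᵈ b
... | yes _ = z≤n
... | no  _ = ≤-refl

-- The steps of codimension one in the chain from the plane through a line to zero. They are small
-- enough for the dimension to change by at most one, and `dual` reverses them.
data Tighten : Constraint → Constraint → Set where
  to-line : ∀ {a} → Tighten free (line a)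
  to-null : ∀ {a} → Tighten (line a) null

Tighten-dual : ∀ {s t} → Tighten s t → Tighten (dual t) (dual s)
Tighten-dual to-line = to-null
Tighten-dual to-null = to-line

another : Direction → Direction
another del  = star
another star = piv
another piv  = del

another-≢ : ∀ a → a ≢ another a
another-≢ del  ()
another-≢ star ()
another-≢ piv  ()

Tighten-Sat : ∀ {s t c d} → Tighten s t → Sat t c d → Sat s c d
Tighten-Sat to-line         _ = tt
Tighten-Sat (to-null {a})   e = Sat-null⇒Sat (line a) e

-- A vector of `s` outside `t` spans `s` together with `t`, so what is orthogonal to both is
-- orthogonal to `s`.
form-Tighten : ∀ {s t} → Tighten s t → ∀ {c d c′ d′} → Sat s c d → ¬ Sat t c d →
  Sat (dual t) c′ d′ → form c d c′ d′ ≡ false → Sat (dual s) c′ d′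
form-Tighten (to-line {a}) {c} {d} _ ¬t t e = go a c d ¬t t e
  where
  go : ∀ a c d {c′ d′} → ¬ along a c d ≡ false → along a c′ d′ ≡ false → form c d c′ d′ ≡ false → Sat null c′ d′
  go del  true  d {false} {false} ¬t _ _ = refl , refl
  go del  true  false {false} {true} _ _ ()
  go del  true  true {false} {true} _ _ ()
  go del  false d ¬t _ _ = contradiction refl ¬t
  go star true  true ¬t _ _ = contradiction refl ¬t
  go star false false ¬t _ _ = contradiction refl ¬t
  go star c d {false} {false} ¬t _ _ = refl , refl
  go star true false {true} {true} _ _ ()
  go star false true {true} {true} _ _ ()
  go piv  c false ¬t _ _ = contradiction refl ¬t
  go piv  c true {false} {false} _ _ _ = refl , refl
  go piv  false true {true} {false} _ _ ()
  go piv  true true {true} {false} _ _ ()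
form-Tighten (to-null {a}) {c} {d} e ¬t _ f = go a c d ¬t e f
  where
  go : ∀ a c d {c′ d′} → ¬ Sat null c d → along a c d ≡ false → form c d c′ d′ ≡ false → along a c′ d′ ≡ false
  go a    false false ¬t _ _ = contradiction (refl , refl) ¬t
  go del  false true {false} _ _ _ = refl
  go del  false true {true} _ _ ()
  go star true true {false} {false} _ _ _ = refl
  go star true true {true} {true} _ _ _ = refl
  go star true true {false} {true} _ _ ()
  go star true true {true} {false} _ _ ()
  go piv  true false {c′} {false} _ _ _ = refl
  go piv  true false {false} {true} _ _ ()
  go piv  true false {true} {true} _ _ ()

-- What removing a vertex on either side of a cut does to its constraint. Such a change never raises
-- `free# − D`, as `D-relax` shows, so connectivity passes back from the second state to the first.
data Relax : Constraint → Constraint → Set where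
  same     : ∀ {s} → Relax s s
  fix-free : ∀ {a} → Relax free (line a)
  fix-null : ∀ {a} → Relax null (line a)

-- States, the dimensions of their spaces, and connectivity

State : ℕ → Set
State n = Fin n → Constraint

dualₛ : ∀ {n} → State n → State n
dualₛ σ i = dual (σ i)

free# : ∀ {n} → State n → ℕ
free# σ = sumℕ (frees ∘ σ)

free#-cong : ∀ {n} {σ τ : State n} → σ ≗ τ → free# σ ≡ free# τ
free#-cong {n} e = sumℕ-cong {n} (cong frees ∘ e)

AgreeOff : ∀ {n} → Fin n → State n → State n → Set
AgreeOff v σ τ = ∀ i → i ≢ v → σ i ≡ τ i

AgreeOff-dual : ∀ {n v} {σ τ : State n} → AgreeOff v σ τ → AgreeOff v (dualₛ τ) (dualₛ σ)
AgreeOff-dual e i i≢v = cong dual (sym (e i i≢v))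

module Vectors {n} (G : Graph n) where

  -- z ↦ (z ! v , nb z v) identifies the subsets of the vertices with a Lagrangian subspace of (GF(2)²)ⁿ.
  nb : Subset n → Fin n → Bool
  nb z v = sum₂ (λ i → z ! i ∧ adj G i v)

  nb-⊕ : ∀ z w v → nb (z ⊕ w) v ≡ nb z v xor nb w v
  nb-⊕ z w v = trans
    (sum-cong-≗ {n} λ i → trans (cong (_∧ adj G i v) (!-⊕ z w i)) (distribʳ (adj G i v) (z ! i) (w ! i)))
    (∑-distrib-+ {n} _ _)
    where open CommutativeRing xor-∧-commutativeRing using (distribʳ)

  nb-⊥ : ∀ v → nb ⊥ v ≡ false
  nb-⊥ v = sum-zero _ λ i → cong (_∧ adj G i v) (!-⊥ i)

  -- A record, because `Sat` reduces and would conceal `s`, `z` and `v` from unification.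
  record SatAt (s : Constraint) (z : Subset n) (v : Fin n) : Set where
    constructor ⟪_⟫
    field sat : Sat s (z ! v) (nb z v)

  open SatAt public

  SatAt? : ∀ s z v → Dec (SatAt s z v)
  SatAt? s z v = map′ ⟪_⟫ sat (Sat? s (z ! v) (nb z v))

  SatAt-⊕ : ∀ s {z w} v → SatAt s z v → SatAt s w v → SatAt s (z ⊕ w) v
  SatAt-⊕ s {z} {w} v ⟪ e ⟫ ⟪ e′ ⟫ = ⟪ subst₂ (Sat s) (sym (!-⊕ z w v)) (sym (nb-⊕ z w v)) (Sat-xor s e e′) ⟫

  SatAt-⊥ : ∀ s v → SatAt s ⊥ v
  SatAt-⊥ s v = ⟪ Sat-null⇒Sat s (!-⊥ v , nb-⊥ v) ⟫

  space : State n → Subspace n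
  space σ .Mem z       = ∀ i → SatAt (σ i) z i
  space σ .mem? z      = all? λ i → SatAt? (σ i) z i
  space σ .⊥-mem i     = SatAt-⊥ (σ i) i
  space σ .⊕-mem z w i = SatAt-⊕ (σ i) i (z i) (w i)

  D : State n → ℕ
  D σ = dim (space σ)

  space-mono : ∀ {σ τ} → (∀ i {z} → SatAt (σ i) z i → SatAt (τ i) z i) → space σ ≼ space τ
  space-mono imp z∈ i = imp i (z∈ i)

  D-mono : ∀ {σ τ} → (∀ i {z} → SatAt (σ i) z i → SatAt (τ i) z i) → D σ ≤ D τ
  D-mono {σ} {τ} imp = dim-mono (space σ) (space τ) (space-mono {σ} {τ} imp)

  D-cong : ∀ {σ τ} → σ ≗ τ → D σ ≡ D τ
  D-cong e = ≤-antisym (D-mono λ i {z} → subst (λ s → SatAt s z i) (e i))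
                       (D-mono λ i {z} → subst (λ s → SatAt s z i) (sym (e i)))

  -- Isotropy. By the symmetry of adjacency both halves of the form are the same double sum.
  form-total : ∀ z w → sum₂ (λ v → form (z ! v) (nb z v) (w ! v) (nb w v)) ≡ false
  form-total z w = begin
    sum₂ (λ v → form (z ! v) (nb z v) (w ! v) (nb w v))
      ≡⟨ ∑-distrib-+ {n} (λ v → z ! v ∧ nb w v) (λ v → nb z v ∧ w ! v) ⟩
    sum₂ (λ v → z ! v ∧ nb w v) xor sum₂ (λ v → nb z v ∧ w ! v)
      ≡⟨ ≡⇒xor-false (trans (sum-cong-≗ {n} λ v → *-distribˡ-sum {n} (z ! v) _) (trans (sum-cong-≗ {n} λ v → sum-cong-≗ {n} λ i → swap v i)
          (trans (∑-comm {n} {n} _) (sym (sum-cong-≗ {n} λ v → *-distribʳ-sum {n} (w ! v) _))))) ⟩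
    false ∎
    where
    open ≡-Reasoning
    swap : ∀ v i → z ! v ∧ (w ! i ∧ adj G i v) ≡ (z ! v ∧ adj G v i) ∧ w ! i
    swap v i = trans (cong (z ! v ∧_) (trans (∧-comm (w ! i) _) (cong (_∧ w ! i) (adj-sym G i v))))
      (sym (∧-assoc (z ! v) _ _))

  -- The local forms add up to zero, and duality makes all of them vanish except the one at `v`.
  form-at : ∀ (σ : State n) v {z w} → (∀ i → i ≢ v → SatAt (σ i) z i) → (∀ i → i ≢ v → SatAt (dual (σ i)) w i) →
    form (z ! v) (nb z v) (w ! v) (nb w v) ≡ false
  form-at σ v {z} {w} z∈ w∈ = trans (sym (sum-single _ v λ i i≢v → form-dual (σ i) (sat (z∈ i i≢v)) (sat (w∈ i i≢v))))
    (form-total z w)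

  along-⊕ : ∀ a v z w → along a ((z ⊕ w) ! v) (nb (z ⊕ w) v) ≡ along a (z ! v) (nb z v) xor along a (w ! v) (nb w v)
  along-⊕ a v z w = trans (cong₂ (along a) (!-⊕ z w v) (nb-⊕ z w v)) (along-xor a (z ! v) (nb z v) _ _)

  mem-transfer : ∀ {v σ τ z} → AgreeOff v σ τ → Mem (space σ) z → SatAt (τ v) z v → Mem (space τ) z
  mem-transfer {v} {σ} {τ} {z} e z∈ zv i with i ≟ v
  ... | yes refl = zv
  ... | no  i≢v  = subst (λ s → SatAt s z i) (e i i≢v) (z∈ i)

  D-tighten : ∀ {v σ τ} → AgreeOff v σ τ → Tighten (σ v) (τ v) → D σ ≤ suc (D τ)
  D-tighten {v} {σ} {τ} e t with σ v in σv | τ v in τv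
  D-tighten {v} {σ} {τ} e (to-line {a}) | free | line a =
    hyperplane (space σ) (space τ) (λ z → along a (z ! v) (nb z v)) (along-⊕ a v) λ {z} z∈ zv →
      mem-transfer e z∈ (subst (λ s → SatAt s z v) (sym τv) ⟪ zv ⟫)
  D-tighten {v} {σ} {τ} e (to-null {a}) | line a | null =
    -- On the line `a`, the product with any other direction detects the nonzero vector.
    hyperplane (space σ) (space τ) (λ z → along (another a) (z ! v) (nb z v)) (along-⊕ (another a) v)
      λ {z} z∈ zv → mem-transfer e z∈ (subst (λ s → SatAt s z v) (sym τv)
        ⟪ two-lines⇒null a (another a) (another-≢ a) (sat (subst (λ s → SatAt s z v) σv (z∈ v))) zv ⟫)

  tighten-≼ : ∀ {v σ τ} → AgreeOff v σ τ → Tighten (σ v) (τ v) → space τ ≼ space σ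
  tighten-≼ {v} {σ} {τ} e t {z} z∈ =
    mem-transfer (λ i i≢v → sym (e i i≢v)) z∈ ⟪ Tighten-Sat t (sat (z∈ v)) ⟫

  -- By isotropy a vector gained in space σ over space τ forbids gaining one in the dual spaces.
  D-tighten-dual : ∀ {v σ τ} → AgreeOff v σ τ → Tighten (σ v) (τ v) →
    D σ + D (dualₛ τ) ≤ suc (D τ + D (dualₛ σ))
  D-tighten-dual {v} {σ} {τ} e t with D σ ≤? D τ
  ... | yes Dσ≤Dτ = ≤-trans (+-mono-≤ Dσ≤Dτ (D-tighten (AgreeOff-dual e) (Tighten-dual t)))
                      (≤-reflexive (+-suc (D τ) _))
  ... | no Dσ≰Dτ with dim-<⇒∃ (space τ) (space σ) (≰⇒> Dσ≰Dτ)
  ... | z , z∈σ , z∉τ = +-mono-≤ (D-tighten e t)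
        (dim-mono (space (dualₛ τ)) (space (dualₛ σ)) λ {w} w∈ → mem-transfer (AgreeOff-dual e) w∈
          ⟪ form-Tighten t (sat (z∈σ v)) (λ zv → z∉τ (mem-transfer e z∈σ ⟪ zv ⟫)) (sat (w∈ v))
            (form-at σ v (λ i _ → z∈σ i) λ i i≢v → subst (λ s → SatAt s w i) (cong dual (sym (e i i≢v))) (w∈ i)) ⟫)

  -- For the state that is `free` everywhere both sides can be computed well enough: the left is `n`
  -- and the right at least `n`. Every `Tighten` step then preserves the inequality by
  -- `D-tighten-dual`.
  D-duality-≤ : ∀ σ → D (dualₛ σ) + free# σ ≤ D σ + free# (dualₛ σ)
  D-duality-≤ σ = tighten half σ to-σ (tighten (λ _ → free) half to-half start)
    where
    Φ : State n → Set
    Φ ρ = D (dualₛ ρ) + free# ρ ≤ D ρ + free# (dualₛ ρ)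
    R : Constraint → Constraint → Set
    R s t = s ≡ t ⊎ Tighten s t
    Φ-resp : ∀ {ρ τ} → ρ ≗ τ → Φ ρ → Φ τ
    Φ-resp e p = subst₂ _≤_
      (cong₂ _+_ (D-cong (cong dual ∘ e)) (free#-cong e))
      (cong₂ _+_ (D-cong e) (free#-cong (cong dual ∘ e))) p
    arith : ∀ dr dt′ dt dr′ fr ft fr′ ft′ → dr + dt′ ≤ suc (dt + dr′) → suc (ft + fr′) ≡ fr + ft′ →
      dr′ + fr ≤ dr + fr′ → dt′ + ft ≤ dt + ft′
    arith dr dt′ dt dr′ fr ft fr′ ft′ a b c = +-cancelˡ-≤ (dr + dr′ + fr) _ _ (begin
      dr + dr′ + fr + (dt′ + ft)        ≡⟨ e₁ dr dr′ fr dt′ ft ⟩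
      (dr + dt′) + ((dr′ + fr) + ft)    ≤⟨ +-mono-≤ a (+-monoˡ-≤ ft c) ⟩
      suc (dt + dr′) + (dr + fr′ + ft)  ≡⟨ e₂ dt dr′ dr fr′ ft ⟩
      dr + dr′ + dt + suc (ft + fr′)    ≡⟨ cong (dr + dr′ + dt +_) b ⟩
      dr + dr′ + dt + (fr + ft′)        ≡⟨ e₃ dr dr′ dt fr ft′ ⟩
      dr + dr′ + fr + (dt + ft′)        ∎)
      where
      open ≤-Reasoning
      e₁ : ∀ a b c d e → a + b + c + (d + e) ≡ a + d + (b + c + e)
      e₁ = solve-∀
      e₂ : ∀ dt dr′ dr fr′ ft → suc (dt + dr′) + (dr + fr′ + ft) ≡ dr + dr′ + dt + suc (ft + fr′)
      e₂ = solve-∀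
      e₃ : ∀ a b c d e → a + b + c + (d + e) ≡ a + b + d + (c + e)
      e₃ = solve-∀
    counts : ∀ ρ τ v → AgreeOff v ρ τ → Tighten (ρ v) (τ v) →
      suc (free# τ + free# (dualₛ ρ)) ≡ free# ρ + free# (dualₛ τ)
    counts ρ τ v e t = +-cancelʳ-≡ (frees (ρ v) + frees (dual (τ v))) _ _ (begin
      suc (free# τ + free# (dualₛ ρ)) + (frees (ρ v) + frees (dual (τ v)))
        ≡⟨ e₁ (free# τ) _ _ _ ⟩
      suc ((free# τ + frees (ρ v)) + (free# (dualₛ ρ) + frees (dual (τ v))))
        ≡⟨ cong₂ (λ a b → suc (a + b))
             (sym (sumℕ-exchange (frees ∘ ρ) (frees ∘ τ) v (λ i i≢v → cong frees (e i i≢v))))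
             (sumℕ-exchange (frees ∘ dualₛ ρ) (frees ∘ dualₛ τ) v (λ i i≢v → cong (frees ∘ dual) (e i i≢v))) ⟩
      suc ((free# ρ + frees (τ v)) + (free# (dualₛ τ) + frees (dual (ρ v))))
        ≡⟨ e₂ (free# ρ) _ _ _ ⟩
      (free# ρ + free# (dualₛ τ)) + suc (frees (τ v) + frees (dual (ρ v)))
        ≡⟨ cong (free# ρ + free# (dualₛ τ) +_) (local t) ⟩
      (free# ρ + free# (dualₛ τ)) + (frees (ρ v) + frees (dual (τ v))) ∎)
      where
      open ≡-Reasoning
      e₁ : ∀ a b c d → suc (a + b) + (c + d) ≡ suc ((a + c) + (b + d))
      e₁ = solve-∀
      e₂ : ∀ a b c d → suc ((a + b) + (c + d)) ≡ (a + c) + suc (b + d)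
      e₂ = solve-∀
      local : ∀ {s t} → Tighten s t → suc (frees t + frees (dual s)) ≡ frees s + frees (dual t)
      local to-line = refl
      local to-null = refl
    step : ∀ ρ v s → R (ρ v) s → Φ ρ → Φ (ρ [ v ≔ s ])
    step ρ v s (inj₁ ρv≡s) = Φ-resp λ i → sym ([≔]-id ρ v ρv≡s i)
    step ρ v s (inj₂ t) p =
      arith (D ρ) (D (dualₛ ρ′)) (D ρ′) (D (dualₛ ρ)) (free# ρ) (free# ρ′) (free# (dualₛ ρ)) (free# (dualₛ ρ′))
        (D-tighten-dual off t′) (counts ρ ρ′ v off t′) p
      where
      ρ′ = ρ [ v ≔ s ]
      off : AgreeOff v ρ ρ′
      off i i≢v = sym ([≔]-other ρ v i≢v)
      t′ : Tighten (ρ v) (ρ′ v)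
      t′ = subst (Tighten (ρ v)) (sym ([≔]-same ρ v)) t
    tighten : ∀ ρ τ → (∀ i → R (ρ i) (τ i)) → Φ ρ → Φ τ
    tighten = change-pointwise Φ Φ-resp (λ _ → R) (λ _ → inj₁ refl) step
    -- Two steps lead from `free` to `null`, so there are two passes; `line del` is an arbitrary
    -- stop between them.
    half : State n
    half i with σ i
    ... | null = line del
    ... | s    = s
    to-half : ∀ i → R free (half i)
    to-half i with σ i
    ... | free   = inj₁ refl
    ... | null   = inj₂ to-line
    ... | line a = inj₂ to-line
    to-σ : ∀ i → R (half i) (σ i)
    to-σ i with σ i
    ... | free   = inj₁ refl
    ... | null   = inj₂ to-null
    ... | line a = inj₁ refl
    start : Φ (λ _ → free)
    start = begin
      D (λ _ → null) + free# {n} (λ _ → free)  ≤⟨ +-monoˡ-≤ _ D-null ⟩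
      free# {n} (λ _ → free)                   ≡⟨ free#-free n ⟩
      n                                        ≤⟨ D-free ⟩
      D (λ _ → free)                           ≤⟨ m≤m+n _ _ ⟩
      D (λ _ → free) + free# {n} (λ _ → null)  ∎
      where
      open ≤-Reasoning
      D-null : D (λ _ → null) ≤ 0
      D-null = injection⇒dim-≤ (space (λ _ → null)) (λ _ → []) λ z∈ w∈ _ →
        !-ext λ i → trans (proj₁ (sat (z∈ i))) (sym (proj₁ (sat (w∈ i))))
      D-free : n ≤ D (λ _ → free)
      D-free = vecInjection⇒≤ (compress (lead (space (λ _ → free)))) λ e →
        agree-on-lead⇒≡ (space (λ _ → free)) _ _ (compress-≡ (lead (space (λ _ → free))) e)
      free#-free : ∀ m → free# {m} (λ _ → free) ≡ m
      free#-free zero    = refl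
      free#-free (suc m) = cong suc (free#-free m)

  -- For a Lagrangian subspace L and any W, dim (L ∩ W) - dim (L ∩ W⊥) is half of dim W - dim W⊥, to
  -- which a `free` plane contributes 1 and a `null` one -1. For cuts this is the symmetry of
  -- cut-rank under complements.
  D-duality : ∀ σ → D σ + free# (dualₛ σ) ≡ D (dualₛ σ) + free# σ
  D-duality σ = ≤-antisym
    (subst (λ d → d ≤ D (dualₛ σ) + free# σ) (cong₂ _+_ (D-cong σ**) (refl {x = free# (dualₛ σ)}))
      (≤-trans (D-duality-≤ (dualₛ σ)) (≤-reflexive (cong (D (dualₛ σ) +_) (free#-cong σ**)))))
    (D-duality-≤ σ)
    where
    σ** : dualₛ (dualₛ σ) ≗ σ
    σ** i = dual-involutive (σ i)

  -- If σ is free on X and null elsewhere then free# σ ∸ D σ is the cut-rank of X.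
  record Conn (k : ℕ) (σ : State n) : Set where
    constructor conn-bound
    field bound : D σ + k ≤ free# σ

  open Conn public

  Conn? : ∀ k σ → Dec (Conn k σ)
  Conn? k σ = map′ conn-bound bound (D σ + k ≤? free# σ)

  Conn-cong : ∀ {k σ τ} → σ ≗ τ → Conn k σ → Conn k τ
  Conn-cong {k} e (conn-bound c) = conn-bound (subst₂ _≤_ (cong (_+ k) (D-cong e)) (free#-cong e) c)

  Conn-dual : ∀ {k σ} → Conn k σ → Conn k (dualₛ σ)
  Conn-dual {k} {σ} (conn-bound c) = conn-bound (+-cancelˡ-≤ (free# σ) _ _ (begin
    free# σ + (D (dualₛ σ) + k)   ≡⟨ e₁ (free# σ) _ k ⟩
    D (dualₛ σ) + free# σ + k     ≡⟨ cong (_+ k) (sym (D-duality σ)) ⟩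
    D σ + free# (dualₛ σ) + k     ≡⟨ e₂ (D σ) _ k ⟩
    D σ + k + free# (dualₛ σ)     ≤⟨ +-monoˡ-≤ _ c ⟩
    free# σ + free# (dualₛ σ)     ∎))
    where
    open ≤-Reasoning
    e₁ : ∀ a b c → a + (b + c) ≡ b + a + c
    e₁ = solve-∀
    e₂ : ∀ a b c → a + b + c ≡ a + c + b
    e₂ = solve-∀

  -- Turning `free` into a line lowers `free#` by one and `D` by at most one; turning `null` into a
  -- line keeps `free#` and cannot lower `D`.
  D-relax : ∀ {σ τ} → (∀ i → Relax (σ i) (τ i)) → D σ + free# τ ≤ D τ + free# σ
  D-relax {σ} {τ} r = change-pointwise Φ Φ-resp (λ _ → Relax) (λ _ → same) step σ τ r ≤-refl
    where
    Φ : State n → Set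
    Φ ρ = D σ + free# ρ ≤ D ρ + free# σ
    Φ-resp : ∀ {ρ ρ′} → ρ ≗ ρ′ → Φ ρ → Φ ρ′
    Φ-resp e = subst₂ _≤_ (cong (D σ +_) (free#-cong e)) (cong (_+ free# σ) (D-cong e))
    step : ∀ ρ v s → Relax (ρ v) s → Φ ρ → Φ (ρ [ v ≔ s ])
    step ρ v s r p with ρ v in ρv
    step ρ v s same p | .s = Φ-resp (λ i → sym ([≔]-id ρ v ρv i)) p
    step ρ v .(line a) (fix-free {a}) p | free = +-cancelʳ-≤ 1 _ _ (begin
      D σ + free# ρ′ + 1           ≡⟨ +-assoc (D σ) _ 1 ⟩
      D σ + (free# ρ′ + 1)         ≡⟨ cong (D σ +_) (trans (cong (λ c → free# ρ′ + frees c) (sym ρv)) (trans (sym exch)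
                                       (cong (λ c → free# ρ + frees c) ([≔]-same ρ v)))) ⟩
      D σ + (free# ρ + 0)          ≡⟨ cong (D σ +_) (+-identityʳ _) ⟩
      D σ + free# ρ                ≤⟨ p ⟩
      D ρ + free# σ                ≤⟨ +-monoˡ-≤ _ (D-tighten off (subst₂ Tighten (sym ρv) (sym ([≔]-same ρ v)) to-line)) ⟩
      suc (D ρ′) + free# σ         ≡⟨ +-comm 1 _ ⟩
      D ρ′ + free# σ + 1           ∎)
      where
      open ≤-Reasoning
      ρ′ = ρ [ v ≔ line a ]
      off : AgreeOff v ρ ρ′
      off i i≢v = sym ([≔]-other ρ v i≢v)
      exch : free# ρ + frees (ρ′ v) ≡ free# ρ′ + frees (ρ v)
      exch = sumℕ-exchange (frees ∘ ρ) (frees ∘ ρ′) v (λ i i≢v → cong frees (off i i≢v))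
    step ρ v .(line a) (fix-null {a}) p | null = begin
      D σ + free# ρ′   ≡⟨ cong (D σ +_) (free#-≡) ⟩
      D σ + free# ρ    ≤⟨ p ⟩
      D ρ + free# σ    ≤⟨ +-monoˡ-≤ _ (dim-mono (space ρ) (space ρ′) λ {z} z∈ → mem-transfer off z∈
                            (subst (λ s → SatAt s z v) (sym ([≔]-same ρ v)) ⟪ Sat-null⇒Sat (line a)
                              (sat (subst (λ s → SatAt s z v) ρv (z∈ v))) ⟫)) ⟩
      D ρ′ + free# σ   ∎
      where
      open ≤-Reasoning
      ρ′ = ρ [ v ≔ line a ]
      off : AgreeOff v ρ ρ′
      off i i≢v = sym ([≔]-other ρ v i≢v)
      free#-≡ : free# ρ′ ≡ free# ρ
      free#-≡ = sumℕ-cong {n} λ i → frees-≡ i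
        where
        frees-≡ : ∀ i → frees (ρ′ i) ≡ frees (ρ i)
        frees-≡ i with i ≟ v
        ... | yes refl = sym (cong frees ρv)
        ... | no _ = refl

  Conn-relax : ∀ {k σ τ} → (∀ i → Relax (σ i) (τ i)) → Conn k τ → Conn k σ
  Conn-relax {k} {σ} {τ} r (conn-bound c) = conn-bound (+-cancelʳ-≤ (free# τ) _ _ (begin
    D σ + k + free# τ     ≡⟨ e₁ (D σ) k _ ⟩
    D σ + free# τ + k     ≤⟨ +-monoˡ-≤ k (D-relax r) ⟩
    D τ + free# σ + k     ≡⟨ e₁ (D τ) _ k ⟩
    D τ + k + free# σ     ≤⟨ +-monoˡ-≤ _ c ⟩
    free# τ + free# σ     ≡⟨ +-comm (free# τ) _ ⟩
    free# σ + free# τ     ∎))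
    where
    open ≤-Reasoning
    e₁ : ∀ a b c → a + b + c ≡ a + c + b
    e₁ = solve-∀

  -- Submodularity of cut-rank with one defect. If both states failed, the two values of `free# − D`
  -- would add up to at most 2k - 2; meet and join give at least 2k, and a clash at the single
  -- vertex `v` accounts for a difference of only one.
  Conn-lattice : ∀ {k σ τ} v → (∀ i → i ≢ v → ¬ Clash (σ i) (τ i)) →
    Conn k (λ i → meet (σ i) (τ i)) → Conn k (λ i → join (σ i) (τ i)) → Conn k σ ⊎ Conn k τ
  Conn-lattice {k} {σ} {τ} v ¬clash c∧ c∨ with Conn? k σ | Conn? k τ
  ... | yes c | _     = inj₁ c
  ... | no _  | yes c = inj₂ c
  ... | no ¬c | no ¬c′ = contradiction (begin
    suc (suc (free# σ + free# τ))                 ≡⟨ cong suc (sym (+-suc (free# σ) _)) ⟩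
    suc (free# σ) + suc (free# τ)                 ≤⟨ +-mono-≤ (≰⇒> (¬c ∘ conn-bound)) (≰⇒> (¬c′ ∘ conn-bound)) ⟩
    (D σ + k) + (D τ + k)                         ≡⟨ e₁ (D σ) (D τ) k ⟩
    (D σ + D τ) + (k + k)                         ≤⟨ +-monoˡ-≤ _ (modular (space σ) (space τ) (space ∧ₛ) (space ∨ₛ)
                                                       (λ z∈ z∈′ i → ⟪ Sat-meet (σ i) (τ i) (sat (z∈ i)) (sat (z∈′ i)) ⟫)
                                                       (λ {z} {w} z∈ w∈ i → ⟪ subst₂ (Sat (∨ₛ i)) (sym (!-⊕ z w i)) (sym (nb-⊕ z w i))
                                                         (Sat-join (σ i) (τ i) (sat (z∈ i)) (sat (w∈ i))) ⟫)) ⟩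
    (D ∧ₛ + D ∨ₛ) + (k + k)                       ≡⟨ sym (e₁ (D ∧ₛ) _ k) ⟩
    (D ∧ₛ + k) + (D ∨ₛ + k)                       ≤⟨ +-mono-≤ (bound c∧) (bound c∨) ⟩
    free# ∧ₛ + free# ∨ₛ                           ≡⟨ sym (sumℕ-distrib-+ {n} _ _) ⟩
    sumℕ (λ i → frees (∧ₛ i) + frees (∨ₛ i))      ≤⟨ counts ⟩
    suc (sumℕ (λ i → frees (σ i) + frees (τ i)))  ≡⟨ cong suc (sumℕ-distrib-+ {n} _ _) ⟩
    suc (free# σ + free# τ)                       ∎) 1+n≰n
    where
    open ≤-Reasoning
    ∧ₛ ∨ₛ : State n
    ∧ₛ i = meet (σ i) (τ i)
    ∨ₛ i = join (σ i) (τ i)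
    e₁ : ∀ a b c → (a + c) + (b + c) ≡ (a + b) + (c + c)
    e₁ = solve-∀
    fs gs : Fin n → ℕ
    fs i = frees (∧ₛ i) + frees (∨ₛ i)
    gs i = frees (σ i) + frees (τ i)
    counts : sumℕ fs ≤ suc (sumℕ gs)
    counts = +-cancelʳ-≤ (gs v) _ _ (begin
      sumℕ fs + gs v        ≡⟨ sumℕ-exchange fs gs v (λ i i≢v → frees-meet-join (σ i) (τ i) (¬clash i i≢v)) ⟩
      sumℕ gs + fs v        ≤⟨ +-monoʳ-≤ (sumℕ gs) (frees-meet-join-≤ (σ v) (τ v)) ⟩
      sumℕ gs + suc (gs v)  ≡⟨ +-suc (sumℕ gs) _ ⟩
      suc (sumℕ gs + gs v)  ∎)

-- Linkages

data Pole : Set where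
  src snk mid : Pole

opposite : Pole → Pole
opposite src = snk
opposite snk = src
opposite mid = mid

-- Constraints met by the states whose free vertices form a set containing the sources and no sink, some of
-- the other vertices having been removed along a prescribed direction.
data Fits : Pole → Maybe Direction → Constraint → Set where
  fits-src  : ∀ {x} → Fits src x free
  fits-snk  : ∀ {x} → Fits snk x null
  fits-free : Fits mid nothing free
  fits-null : Fits mid nothing null
  fits-line : ∀ {a} → Fits mid (just a) (line a)

Fits-dual : ∀ {p x s} → Fits (opposite p) x s → Fits p x (dual s)
Fits-dual {src} fits-snk  = fits-src
Fits-dual {snk} fits-src  = fits-snk
Fits-dual {mid} fits-free = fits-null
Fits-dual {mid} fits-null = fits-free
Fits-dual {mid} fits-line = fits-line

Fits-dual′ : ∀ {p x s} → Fits p x s → Fits (opposite p) x (dual s)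
Fits-dual′ fits-src  = fits-snk
Fits-dual′ fits-snk  = fits-src
Fits-dual′ fits-free = fits-null
Fits-dual′ fits-null = fits-free
Fits-dual′ fits-line = fits-line

meet-idem : ∀ s → meet s s ≡ s
meet-idem free = refl
meet-idem null = refl
meet-idem (line a) with a ≟ᵈ a
... | yes _ = refl
... | no a≢a = contradiction refl a≢a

join-idem : ∀ s → join s s ≡ s
join-idem free = refl
join-idem null = refl
join-idem (line a) with a ≟ᵈ a
... | yes _ = refl
... | no a≢a = contradiction refl a≢a

meet-lines : ∀ {a b} → a ≢ b → meet (line a) (line b) ≡ null
meet-lines {a} {b} a≢b with a ≟ᵈ b
... | yes a≡b = contradiction a≡b a≢b
... | no _ = refl

join-lines : ∀ {a b} → a ≢ b → join (line a) (line b) ≡ free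
join-lines {a} {b} a≢b with a ≟ᵈ b
... | yes a≡b = contradiction a≡b a≢b
... | no _ = refl

¬Clash-refl : ∀ {s} → ¬ Clash s s
¬Clash-refl (clash a≢a) = a≢a refl

Fits-meet : ∀ {p x s t} → Fits p x s → Fits p x t → Fits p x (meet s t)
Fits-meet fits-src  fits-src  = fits-src
Fits-meet fits-snk  fits-snk  = fits-snk
Fits-meet fits-free fits-free = fits-free
Fits-meet fits-free fits-null = fits-null
Fits-meet fits-null _         = fits-null
Fits-meet (fits-line {a}) fits-line rewrite meet-idem (line a) = fits-line

Fits-join : ∀ {p x s t} → Fits p x s → Fits p x t → Fits p x (join s t)
Fits-join fits-src  fits-src  = fits-src
Fits-join fits-snk  fits-snk  = fits-snk
Fits-join fits-free _         = fits-free
Fits-join fits-null f         = f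
Fits-join (fits-line {a}) fits-line rewrite join-idem (line a) = fits-line

Fits-¬Clash : ∀ {p x s t} → Fits p x s → Fits p x t → ¬ Clash s t
Fits-¬Clash fits-line fits-line (clash a≢a) = a≢a refl

-- Distinct lines meet in `null` and join to `free`. States with a vertex removed along two
-- directions thus have as meet and join states in which that vertex is still present.
Fits-meet-split : ∀ {p a b s t} → a ≢ b → Fits p (just a) s → Fits p (just b) t → Fits p nothing (meet s t)
Fits-meet-split _   fits-src  fits-src  = fits-src
Fits-meet-split _   fits-snk  fits-snk  = fits-snk
Fits-meet-split a≢b fits-line fits-line rewrite meet-lines a≢b = fits-null

Fits-join-split : ∀ {p a b s t} → a ≢ b → Fits p (just a) s → Fits p (just b) t → Fits p nothing (join s t)
Fits-join-split _   fits-src  fits-src  = fits-src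
Fits-join-split _   fits-snk  fits-snk  = fits-snk
Fits-join-split a≢b fits-line fits-line rewrite join-lines a≢b = fits-free

module _ {n} (pole : Fin n → Pole) (m : Fin n → Maybe Direction) (v : Fin n) (mv : m v ≡ nothing)
  {a b : Direction} (a≢b : a ≢ b) {σ τ : State n}
  (fσ : ∀ i → Fits (pole i) ((m [ v ≔ just a ]) i) (σ i))
  (fτ : ∀ i → Fits (pole i) ((m [ v ≔ just b ]) i) (τ i)) where

  split-¬Clash : ∀ i → i ≢ v → ¬ Clash (σ i) (τ i)
  split-¬Clash i i≢v with i ≟ v | fσ i | fτ i
  ... | yes i≡v | _ | _  = contradiction i≡v i≢v
  ... | no _    | f | f′ = Fits-¬Clash f f′

  split-meet : ∀ i → Fits (pole i) (m i) (meet (σ i) (τ i))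
  split-meet i with i ≟ v | fσ i | fτ i
  ... | yes refl | f | f′ = subst (λ x → Fits (pole v) x (meet (σ v) (τ v))) (sym mv) (Fits-meet-split a≢b f f′)
  ... | no _     | f | f′ = Fits-meet f f′

  split-join : ∀ i → Fits (pole i) (m i) (join (σ i) (τ i))
  split-join i with i ≟ v | fσ i | fτ i
  ... | yes refl | f | f′ = subst (λ x → Fits (pole v) x (join (σ v) (τ v))) (sym mv) (Fits-join-split a≢b f f′)
  ... | no _     | f | f′ = Fits-join f f′

-- The extreme case, where every `mid` vertex has been removed and only the poles are left.
baseAt : Pole → Direction → Constraint
baseAt src a = free
baseAt snk a = null
baseAt mid a = line a

baseAt-opposite : ∀ p a → baseAt (opposite p) a ≡ dual (baseAt p a)
baseAt-opposite src a = refl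
baseAt-opposite snk a = refl
baseAt-opposite mid a = refl

base : ∀ {n} → (Fin n → Pole) → (Fin n → Direction) → State n
base pole m i = baseAt (pole i) (m i)

Fits-base : ∀ p a → Fits p (just a) (baseAt p a)
Fits-base src a = fits-src
Fits-base snk a = fits-snk
Fits-base mid a = fits-line

Relax-Fits : ∀ {p x s b} → Fits p x s → (∀ a → x ≡ just a → a ≡ b) → Relax s (baseAt p b)
Relax-Fits fits-src  _ = same
Relax-Fits fits-snk  _ = same
Relax-Fits fits-free _ = fix-free
Relax-Fits fits-null _ = fix-null
Relax-Fits (fits-line {a}) eq rewrite eq a refl = same

frees-baseAt : ∀ p a b → frees (baseAt p a) ≡ frees (baseAt p b)
frees-baseAt src a b = refl
frees-baseAt snk a b = refl
frees-baseAt mid a b = refl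

-- Only the free `mid` vertices of a cut become lines. The failure of the cut is inherited through
-- `Relax`, while the vectors of the new space still vanish on the null side.
keepNull : Constraint → Constraint → Constraint
keepNull null     t = null
keepNull free     t = t
keepNull (line _) t = t

Relax-keepNull : ∀ {p x s b} → Fits p x s → (∀ a → x ≡ just a → a ≡ b) → Relax s (keepNull s (baseAt p b))
Relax-keepNull fits-src  _ = same
Relax-keepNull fits-snk  _ = same
Relax-keepNull fits-free _ = fix-free
Relax-keepNull fits-null _ = same
Relax-keepNull (fits-line {a}) eq rewrite eq a refl = same

frees-keepNull : ∀ {p x s b} → Fits p x s → frees (keepNull s (baseAt p b)) ≡ frees (baseAt p b)
frees-keepNull fits-src  = refl
frees-keepNull fits-snk  = refl
frees-keepNull fits-free = refl
frees-keepNull fits-null = refl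
frees-keepNull fits-line = refl

Sat-keepNull : ∀ s t {c d} → Sat (keepNull s t) c d → Sat t c d
Sat-keepNull free     t e = e
Sat-keepNull null     t e = Sat-null⇒Sat t e
Sat-keepNull (line _) t e = e

-- A line over GF(2) has a single nonzero vector; this is what makes two spikes along the same
-- direction cancel.
line-unique : ∀ a {c d c′ d′} → ¬ Sat null c d → ¬ Sat null c′ d′ → Sat (line a) c d → Sat (line a) c′ d′ →
  c ≡ c′ × d ≡ d′
line-unique a    {false} {false} ¬n _ _ _ = contradiction (refl , refl) ¬n
line-unique a    {true}  {c′ = false} {false} _ ¬n _ _ = contradiction (refl , refl) ¬n
line-unique a    {false} {true} {false} {false} _ ¬n _ _ = contradiction (refl , refl) ¬n
line-unique del  {true} {d} {true} {d′} _ _ () _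
line-unique star {false} {true} {d′ = d′} _ _ () _
line-unique star {true} {false} {d′ = d′} _ _ () _
line-unique star {true} {true} {true} {false} _ _ _ ()
line-unique star {true} {true} {false} {true} _ _ _ ()
line-unique piv {c} {true} _ _ () _
line-unique del  {false} {true} {false} {true} _ _ _ _ = refl , refl
line-unique star {true} {true} {true} {true} _ _ _ _ = refl , refl
line-unique piv  {true} {false} {true} {false} _ _ _ _ = refl , refl

-- On the diagonal an arbitrary other direction, so that both inequalities below hold for all
-- arguments.
third : Direction → Direction → Direction
third del  del  = star
third del  star = piv
third del  piv  = star
third star del  = piv
third star star = del
third star piv  = del
third piv  del  = star
third piv  star = del
third piv  piv  = del

third-≢ˡ : ∀ a b → third a b ≢ a
third-≢ˡ del  del  ()
third-≢ˡ del  star ()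
third-≢ˡ del  piv  ()
third-≢ˡ star del  ()
third-≢ˡ star star ()
third-≢ˡ star piv  ()
third-≢ˡ piv  del  ()
third-≢ˡ piv  star ()
third-≢ˡ piv  piv  ()

third-≢ʳ : ∀ a b → third a b ≢ b
third-≢ʳ del  del  ()
third-≢ʳ del  star ()
third-≢ʳ del  piv  ()
third-≢ʳ star del  ()
third-≢ʳ star star ()
third-≢ʳ star piv  ()
third-≢ʳ piv  del  ()
third-≢ʳ piv  star ()
third-≢ʳ piv  piv  ()

isFree : Constraint → Bool
isFree free     = true
isFree null     = false
isFree (line _) = false

freeSet : ∀ {n} → State n → Subset n
freeSet σ = tabulate (isFree ∘ σ)

∣freeSet∣ : ∀ {n} (σ : State n) → ∣ freeSet σ ∣ ≡ free# σ
∣freeSet∣ {zero}  σ = refl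
∣freeSet∣ {suc n} σ with σ zero
... | free   = cong suc (∣freeSet∣ (σ ∘ suc))
... | null   = ∣freeSet∣ (σ ∘ suc)
... | line _ = ∣freeSet∣ (σ ∘ suc)

restrict : ∀ {n} → Subset n → State n → Subset n
restrict z σ = zipWith _∧_ z (freeSet σ)

restrict-! : ∀ {n} (z : Subset n) σ i → restrict z σ ! i ≡ z ! i ∧ isFree (σ i)
restrict-! z σ i = trans (lookup-zipWith _∧_ i z (freeSet σ)) (cong (z ! i ∧_) (lookup∘tabulate (isFree ∘ σ) i))

restrict-⊕ : ∀ {n} (z w : Subset n) σ → restrict z σ ⊕ restrict w σ ≡ restrict (z ⊕ w) σ
restrict-⊕ z w σ = !-ext λ i → begin
  (restrict z σ ⊕ restrict w σ) ! i                     ≡⟨ !-⊕ (restrict z σ) (restrict w σ) i ⟩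
  (restrict z σ ! i) xor (restrict w σ ! i)             ≡⟨ cong₂ _xor_ (restrict-! z σ i) (restrict-! w σ i) ⟩
  (z ! i ∧ isFree (σ i)) xor (w ! i ∧ isFree (σ i))     ≡⟨ distrib (z ! i) (w ! i) (isFree (σ i)) ⟩
  ((z ! i) xor (w ! i)) ∧ isFree (σ i)                  ≡⟨ cong (_∧ isFree (σ i)) (sym (!-⊕ z w i)) ⟩
  (z ⊕ w) ! i ∧ isFree (σ i)                            ≡⟨ restrict-! (z ⊕ w) σ i ⟨
  restrict (z ⊕ w) σ ! i                                ∎
  where
  open ≡-Reasoning
  distrib : ∀ a b c → (a ∧ c) xor (b ∧ c) ≡ (a xor b) ∧ c
  distrib false b     c = refl
  distrib true  false c = xor-identityʳ c
  distrib true  true  c = xor-same c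

restrict-⊑ : ∀ {n} (z : Subset n) σ → restrict z σ ⊑ freeSet σ
restrict-⊑ z σ i e = trans (restrict-! z σ i) (trans (cong (z ! i ∧_) (trans (sym (lookup∘tabulate (isFree ∘ σ) i)) e)) (∧-zeroʳ (z ! i)))

module _ {n} (G : Graph n) where
  open Vectors G

  -- The connectivity between the poles is k, attained by `cut`; removing v ∈ F along `type v` lowers it, as
  -- the state `bad v` shows.
  record Linkage (k : ℕ) (F : Subset n) : Set where
    field
      pole      : Fin n → Pole
      F-mid     : ∀ v → F ! v ≡ true → pole v ≡ mid
      conn      : ∀ σ → (∀ i → Fits (pole i) nothing (σ i)) → Conn k σ
      cut       : State n
      cut-fits  : ∀ i → Fits (pole i) nothing (cut i)
      cut-tight : free# cut ≡ D cut + k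
      type      : Fin n → Direction
      bad       : Fin n → State n
      bad-fits  : ∀ v → F ! v ≡ true → ∀ i → Fits (pole i) (((λ _ → nothing) [ v ≔ just (type v) ]) i) (bad v i)
      bad-¬conn : ∀ v → F ! v ≡ true → ¬ Conn k (bad v)

  Conn-dual⁻ : ∀ {k σ} → Conn k (dualₛ σ) → Conn k σ
  Conn-dual⁻ {σ = σ} c = Conn-cong (λ i → dual-involutive (σ i)) (Conn-dual c)

  -- Interchanges the poles by passing to complements of cuts. Every fact about vectors that vanish
  -- at the sinks thereby yields one about vectors that vanish at the sources.
  dualLinkage : ∀ {k F} → Linkage k F → Linkage k F
  dualLinkage {k} Lk = record
    { pole      = opposite ∘ pole
    ; F-mid     = λ v v∈F → cong opposite (F-mid v v∈F)
    ; conn      = λ σ f → Conn-dual⁻ (conn (dualₛ σ) λ i → Fits-dual (f i))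
    ; cut       = dualₛ cut
    ; cut-fits  = λ i → Fits-dual′ (cut-fits i)
    ; cut-tight = +-cancelˡ-≡ (D cut) _ _ (begin
        D cut + free# (dualₛ cut)    ≡⟨ D-duality cut ⟩
        D (dualₛ cut) + free# cut    ≡⟨ cong (D (dualₛ cut) +_) cut-tight ⟩
        D (dualₛ cut) + (D cut + k)  ≡⟨ comm (D (dualₛ cut)) (D cut) k ⟩
        D cut + (D (dualₛ cut) + k)  ∎)
    ; type      = type
    ; bad       = λ v → dualₛ (bad v)
    ; bad-fits  = λ v v∈F i → Fits-dual′ (bad-fits v v∈F i)
    ; bad-¬conn = λ v v∈F c → bad-¬conn v v∈F (Conn-dual⁻ c)
    }
    where
    open Linkage Lk
    open ≡-Reasoning
    comm : ∀ a b c → a + (b + c) ≡ b + (a + c)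
    comm = solve-∀

  base-opposite : ∀ (pole : Fin n → Pole) m → base (opposite ∘ pole) m ≗ dualₛ (base pole m)
  base-opposite pole m i = baseAt-opposite (pole i) (m i)

  -- Tutte's linking theorem; the double negation saves a search and suffices for a refutation.
  linking : ∀ {k} (pole : Fin n → Pole) → (∀ σ → (∀ i → Fits (pole i) nothing (σ i)) → Conn k σ) →
    ¬ ¬ ∃ λ m → Conn k (base pole m)
  linking {k} pole conn none = run (allFin n) λ (m , linked , fixed) →
    none ((λ i → proj₁ (fixed i (∈-allFin i))) , linked (base pole λ i → proj₁ (fixed i (∈-allFin i))) λ i →
      subst (λ x → Fits (pole i) x (baseAt (pole i) (proj₁ (fixed i (∈-allFin i))))) (sym (proj₂ (fixed i (∈-allFin i)))) (Fits-base (pole i) _))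
    where
    Linked : (Fin n → Maybe Direction) → Set
    Linked m = ∀ σ → (∀ i → Fits (pole i) (m i) (σ i)) → Conn k σ
    -- Two of the three directions suffice: failures along both `del` and `star` would contradict
    -- `Conn-lattice`, since their meet and join are cuts with `v` still present.
    fix-open : ∀ m → Linked m → ∀ v → m v ≡ nothing → ¬ ¬ ∃ λ a → Linked (m [ v ≔ just a ])
    fix-open m linked v mv none = none (star , onto-star)
      where
      ¬fixed : ∀ a → ¬ Linked (m [ v ≔ just a ])
      ¬fixed a linked′ = none (a , linked′)
      either : ∀ σ τ → (∀ i → Fits (pole i) ((m [ v ≔ just del ]) i) (σ i)) →
        (∀ i → Fits (pole i) ((m [ v ≔ just star ]) i) (τ i)) → Conn k σ ⊎ Conn k τ
      either σ τ fσ fτ = Conn-lattice v (split-¬Clash pole m v mv (λ ()) fσ fτ)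
        (linked _ (split-meet pole m v mv (λ ()) fσ fτ)) (linked _ (split-join pole m v mv (λ ()) fσ fτ))
      onto-star : Linked (m [ v ≔ just star ])
      onto-star τ fτ with Conn? k τ
      ... | yes c = c
      ... | no ¬c = contradiction (λ σ fσ → [ (λ c → c) , (λ c → contradiction c ¬c) ]′ (either σ τ fσ fτ)) (¬fixed del)
    fix-one : ∀ m → Linked m → ∀ v → ¬ ¬ ∃ λ m′ → Linked m′ × (∃ λ a → m′ v ≡ just a) ×
      (∀ i a → m i ≡ just a → m′ i ≡ just a)
    fix-one m linked v none = by-cases (m v) refl
      where
      by-cases : ∀ x → m v ≡ x → Empty.⊥
      by-cases (just a) mv = none (m , linked , (a , mv) , λ _ _ e → e)
      by-cases nothing  mv = fix-open m linked v mv λ (a , linked′) →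
        none (m [ v ≔ just a ] , linked′ , (a , [≔]-same m v) , λ i b mi →
          trans ([≔]-other m v λ { refl → contradiction (trans (sym mv) mi) λ () }) mi)
    run : ∀ vs → ¬ ¬ ∃ λ m → Linked m × (∀ i → i ∈ₗ vs → ∃ λ a → m i ≡ just a)
    run []       none = none ((λ _ → nothing) , conn , λ _ ())
    run (v ∷ vs) none = run vs λ (m , linked , fixed) → fix-one m linked v λ (m′ , linked′ , fixed-v , keep) →
      none (m′ , linked′ , λ where
        .v (here refl) → fixed-v
        i (there i∈)   → let a , mi = fixed i i∈ in a , keep i a mi)

  module LinkageProperties {k F} (Lk : Linkage k F) where
    open Linkage Lk public

    Good : (Fin n → Direction) → Set
    Good m = Conn k (base pole m)

    Good-cong : ∀ {m m′} → m ≗ m′ → Good m → Good m′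
    Good-cong e = Conn-cong λ i → cong (baseAt (pole i)) (e i)

    bad-direction : ∀ v → F ! v ≡ true → ∀ {m : Fin n → Direction} → m v ≡ type v →
      ∀ i a → ((λ _ → nothing) [ v ≔ just (type v) ]) i ≡ just a → a ≡ m i
    bad-direction v v∈F mv i a e with i ≟ v
    bad-direction v v∈F mv i a refl | yes refl = sym mv

    -- Removing further vertices cannot repair the connectivity that is already lost at `v`.
    ¬Good : ∀ v → F ! v ≡ true → ∀ {m} → m v ≡ type v → ¬ Good m
    ¬Good v v∈F {m} mv good = bad-¬conn v v∈F (Conn-relax (λ i → Relax-Fits (bad-fits v v∈F i) (bad-direction v v∈F mv i)) good)

    base-at : ∀ v → F ! v ≡ true → ∀ m → base pole m v ≡ line (m v)
    base-at v v∈F m = cong (λ p → baseAt p (m v)) (F-mid v v∈F)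

    free#-base : ∀ m m′ → free# (base pole m) ≡ free# (base pole m′)
    free#-base m m′ = sumℕ-cong {n} λ i → frees-baseAt (pole i) (m i) (m′ i)

    -- By submodularity the new direction or the critical one keeps the connectivity, and `¬Good`
    -- rules out the critical one.
    Good-change : ∀ {m m′} → (∀ i → m i ≡ m′ i ⊎ (F ! i ≡ true × m′ i ≢ type i)) → Good m → Good m′
    Good-change {m} {m′} = change-pointwise Good Good-cong R (λ _ → inj₁ refl) step m m′
      where
      R : Fin n → Direction → Direction → Set
      R i a b = a ≡ b ⊎ (F ! i ≡ true × b ≢ type i)
      step : ∀ m v a → R v (m v) a → Good m → Good (m [ v ≔ a ])
      step m v a (inj₁ e) = Good-cong λ i → sym ([≔]-id m v e i)
      step m v a (inj₂ (v∈F , a≢t)) good = [ (λ c → c) , (λ c → contradiction c (¬Good v v∈F ([≔]-same m v))) ]′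
        (Conn-lattice {k} {base pole (m [ v ≔ a ])} {base pole (m [ v ≔ type v ])} v
            (λ i i≢v → subst₂ (λ x y → ¬ Clash (baseAt (pole i) x) (baseAt (pole i) y)) (sym ([≔]-other m v i≢v)) (sym ([≔]-other m v i≢v)) ¬Clash-refl)
            (Conn-relax relax∧ good) (Conn-relax relax∨ good))
        where
        -- At `v` the two lines meet in `null` and join to `free`; both relax to the line of the
        -- good choice `m`.
        relax∧ : ∀ i → Relax (meet (baseAt (pole i) ((m [ v ≔ a ]) i)) (baseAt (pole i) ((m [ v ≔ type v ]) i))) (baseAt (pole i) (m i))
        relax∧ i with i ≟ v
        ... | no _ rewrite meet-idem (baseAt (pole i) (m i)) = same
        ... | yes refl rewrite F-mid v v∈F | meet-lines a≢t = fix-null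
        relax∨ : ∀ i → Relax (join (baseAt (pole i) ((m [ v ≔ a ]) i)) (baseAt (pole i) ((m [ v ≔ type v ]) i))) (baseAt (pole i) (m i))
        relax∨ i with i ≟ v
        ... | no _ rewrite join-idem (baseAt (pole i) (m i)) = same
        ... | yes refl rewrite F-mid v v∈F | join-lines a≢t = fix-free

    -- If `z` were nonzero at `v`, making `v` null would lower the dimension. Redirecting `v` to
    -- `type v` raises it again by at most one, so the critical direction would be good.
    vanish : ∀ {m} → Good m → ∀ v → F ! v ≡ true → ∀ {z} → Mem (space (base pole m)) z → SatAt null z v
    vanish {m} good v v∈F {z} z∈ with SatAt? null z v
    ... | yes zv = zv
    ... | no ¬zv = contradiction (conn-bound (begin
      D (base pole m′) + k          ≤⟨ +-monoˡ-≤ k (≤-trans (D-tighten offσ tightσ) Dρ<D) ⟩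
      D (base pole m) + k           ≤⟨ bound good ⟩
      free# (base pole m)           ≡⟨ free#-base m m′ ⟩
      free# (base pole m′)          ∎)) (¬Good v v∈F ([≔]-same m v))
      where
      open ≤-Reasoning
      m′ = m [ v ≔ type v ]
      ρ : State n
      ρ = base pole m [ v ≔ null ]
      offρ : AgreeOff v (base pole m) ρ
      offρ i i≢v = sym ([≔]-other (base pole m) v i≢v)
      offσ : AgreeOff v (base pole m′) ρ
      offσ i i≢v = trans (cong (baseAt (pole i)) ([≔]-other m v i≢v)) (offρ i i≢v)
      tightσ : Tighten (base pole m′ v) (ρ v)
      tightσ = subst₂ Tighten (sym (base-at v v∈F m′)) (sym ([≔]-same (base pole m) v)) to-null
      tight : Tighten (base pole m v) (ρ v)
      tight = subst₂ Tighten (sym (base-at v v∈F m)) (sym ([≔]-same (base pole m) v)) to-null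
      Dρ<D : D ρ < D (base pole m)
      Dρ<D = ≰⇒> λ D≤ → ¬zv (subst (λ s → SatAt s z v) ([≔]-same (base pole m) v)
        (dim-≤⇒≽ (space ρ) (space (base pole m)) (tighten-≼ offρ tight) D≤ z∈ v))

    record Spike (m : Fin n → Direction) (v : Fin n) (x : Subset n) : Set where
      field
        spike-mem  : Mem (space (base pole (m [ v ≔ type v ]))) x
        spike-at   : ¬ SatAt null x v
        spike-null : ∀ i → bad v i ≡ null → SatAt null x i

    -- The state `ψ` and `base pole m` have equally many free vertices, but `ψ` fails `k` and so has
    -- the larger space. A vector gained is nonzero at `v`, because elsewhere the constraints of `ψ`
    -- imply those of `base pole m`.
    spike : ∀ {m} → Good m → ∀ v → F ! v ≡ true → Σ (Subset n) (Spike m v)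
    spike {m} good v v∈F = x , record
      { spike-mem  = x∈
      ; spike-at   = λ xv → x∉base (mem-transfer (λ i i≢v → cong (baseAt (pole i)) ([≔]-other m v i≢v)) x∈
                       ⟪ Sat-null⇒Sat (base pole m v) (sat xv) ⟫)
      ; spike-null = λ i e → subst (λ s → SatAt (keepNull s (base pole (m [ v ≔ type v ]) i)) x i) e (x∈ψ i)
      }
      where
      m′ = m [ v ≔ type v ]
      ψ : State n
      ψ i = keepNull (bad v i) (base pole m′ i)
      ¬Connψ : ¬ Conn k ψ
      ¬Connψ c = bad-¬conn v v∈F (Conn-relax (λ i → Relax-keepNull (bad-fits v v∈F i)
        (bad-direction v v∈F {m′} ([≔]-same m v) i)) c)
      free#≡ : free# ψ ≡ free# (base pole m)
      free#≡ = trans (sumℕ-cong {n} λ i → frees-keepNull {b = m′ i} (bad-fits v v∈F i)) (free#-base m′ m)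
      Dbase<Dψ : D (base pole m) < D ψ
      Dbase<Dψ = +-cancelʳ-< k _ _ (≤-<-trans (≤-trans (bound good) (≤-reflexive (sym free#≡))) (≰⇒> (¬Connψ ∘ conn-bound)))
      found : ∃ λ z → Mem (space ψ) z × ¬ Mem (space (base pole m)) z
      found = dim-<⇒∃ (space (base pole m)) (space ψ) Dbase<Dψ
      x = proj₁ found
      x∈ψ = proj₁ (proj₂ found)
      x∉base = proj₂ (proj₂ found)
      x∈ : Mem (space (base pole (m [ v ≔ type v ]))) x
      x∈ i = ⟪ Sat-keepNull (bad v i) _ (sat (x∈ψ i)) ⟫

    -- Tightness of the cut says that the subsets of its free side, modulo the vectors supported
    -- there, have dimension exactly `k`.
    cut-class : Σ (Subset n → Vec Bool k) λ c → ∀ {z w} → c z ≡ c w → Mem (space cut) (restrict (z ⊕ w) cut)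
    cut-class = (λ z → proj₁ quotient (restrict z cut)) , λ {z} {w} e →
      subst (Mem (space cut)) (restrict-⊕ z w cut) (proj₂ quotient (restrict-⊑ z cut) (restrict-⊑ w cut) e)
      where
      ¬line : ∀ {p a} → ¬ Fits p nothing (line a)
      ¬line ()
      space⊑ : ∀ {z} → Mem (space cut) z → z ⊑ freeSet cut
      space⊑ z∈ i e with cut i | cut-fits i | z∈ i | trans (sym (lookup∘tabulate (isFree ∘ cut) i)) e
      ... | null   | _ | ⟪ zi ⟫ | _ = proj₁ zi
      ... | line _ | f | _      | _ = contradiction f ¬line
      quotient = quotient-map (space cut) (freeSet cut) space⊑ (trans (∣freeSet∣ cut) cut-tight)

-- Two linkages with different critical directions

at-or-off : ∀ {n} {P : Set} (i v : Fin n) → (i ≡ v → P) → (i ≢ v → P) → P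
at-or-off i v at off with i ≟ v
... | yes i≡v = at i≡v
... | no  i≢v = off i≢v

if-elim : ∀ {A : Set} (P : A → Set) b {x y} → (b ≡ true → P x) → (b ≡ false → P y) → P (if b then x else y)
if-elim P true  t f = t refl
if-elim P false t f = f refl

module _ {n} (G : Graph n) where
  open Vectors G

  SatAt-weaken : ∀ s {z v} → SatAt null z v → SatAt s z v
  SatAt-weaken s ⟪ e ⟫ = ⟪ Sat-null⇒Sat s e ⟫

  SatAt-cancel : ∀ s {z w v} → SatAt null w v → SatAt s (z ⊕ w) v → SatAt s z v
  SatAt-cancel s {z} {w} {v} w0 zw = subst (λ z → SatAt s z v) (⊕-cancel z w) (SatAt-⊕ s v zw (SatAt-weaken s w0))

  spikes-cancel : ∀ a {z w v} → ¬ SatAt null z v → ¬ SatAt null w v → SatAt (line a) z v → SatAt (line a) w v →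
    SatAt null (z ⊕ w) v
  spikes-cancel a {z} {w} {v} ¬z ¬w ⟪ az ⟫ ⟪ aw ⟫ with line-unique a (¬z ∘ ⟪_⟫) (¬w ∘ ⟪_⟫) az aw
  ... | e , e′ = ⟪ trans (!-⊕ z w v) (≡⇒xor-false e) , trans (nb-⊕ z w v) (≡⇒xor-false e′) ⟫

  -- What is subtracted from the spikes of a class: zero, or the two spikes at one of its vertices.
  -- The set `J` holds the vertices left over, and `anchor-J` keeps the values of their spikes on
  -- `J` intact.
  record Anchor (pole : Fin n → Pole) (F J : Subset n) (m mJ : Fin n → Direction) (z z′ : Subset n) : Set where
    field
      anchor-snk  : ∀ i → pole i ≡ snk → SatAt null z i
      anchor-src  : ∀ i → pole i ≡ src → SatAt null z′ i
      anchor-mid  : ∀ i → pole i ≡ mid → SatAt (line (m i)) (z ⊕ z′) i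
      anchor-J    : ∀ i → J ! i ≡ true → SatAt null z i
      anchor-line : ∀ i → F ! i ≡ true → SatAt (line (mJ i)) z i

  -- Here `z` is an anchored spike and `w` the resulting w_j. The two differ by a vector that
  -- vanishes on `F`, so they satisfy the same constraints there.
  record Rung (pole : Fin n → Pole) (F : Subset n) (mJ : Fin n → Direction) (z w : Subset n) : Set where
    field
      rung-mid : ∀ u → pole u ≡ mid → SatAt (line (mJ u)) w u
      rung-F   : ∀ i → F ! i ≡ true → ∀ s → SatAt s w i → SatAt s z i
      rung-F′  : ∀ i → F ! i ≡ true → ∀ s → SatAt s z i → SatAt s w i

  module Split {k F} (Lk : Linkage G k F) where
    private
      module L  = LinkageProperties G Lk
      module L* = LinkageProperties G (dualLinkage G Lk)
    open L using (pole; cut; cut-fits)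

    -- One part for each side of the cut, whence the exponent 2k of the theorem.
    class : Subset n → Vec Bool (k + k)
    class z = proj₁ L.cut-class z ++ proj₁ L*.cut-class z

    parts : ∀ D → restrict D cut ⊕ restrict D (dualₛ cut) ≡ D
    parts D = !-ext λ i → trans (!-⊕ (restrict D cut) _ i)
      (trans (cong₂ _xor_ (restrict-! D cut i) (restrict-! D (dualₛ cut) i)) (part (D ! i) (cut-fits i)))
      where
      part : ∀ d {p s} → Fits p nothing s → (d ∧ isFree s) xor (d ∧ isFree (dual s)) ≡ d
      part true  fits-src  = refl
      part true  fits-snk  = refl
      part true  fits-free = refl
      part true  fits-null = refl
      part false fits-src  = refl
      part false fits-snk  = refl
      part false fits-free = refl
      part false fits-null = refl

    part-mem : ∀ {p s a b z w i} → Fits p nothing s → SatAt s z i → SatAt (dual s) w i →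
      z ⊕ w ≡ b → (p ≡ mid → SatAt (line a) b i) → SatAt (baseAt p a) z i
    part-mem fits-src  _ _ _ _ = ⟪ tt ⟫
    part-mem fits-snk  z∈ _ _ _ = z∈
    part-mem {a = a} fits-free _ w∈ refl zw = SatAt-cancel (line a) w∈ (zw refl)
    part-mem {a = a} fits-null z∈ _ _ _ = SatAt-weaken (line a) z∈

    -- Equal classes make the restrictions of `z ⊕ w` to the two sides of the cut into vectors
    -- supported on opposite sides. At each vertex one of them is zero and the other agrees with
    -- `z ⊕ w`, so both inherit its lines.
    split : ∀ {m z w} → class z ≡ class w → (∀ i → pole i ≡ mid → SatAt (line (m i)) (z ⊕ w) i) →
      ∃₂ λ a a′ → Mem (space (base pole m)) a × Mem (space (base (opposite ∘ pole) m)) a′ × a ⊕ a′ ≡ z ⊕ w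
    split {m} {z} {w} e mids = a , a′ ,
      (λ i → part-mem (cut-fits i) (a∈ i) (a′∈ i) (parts (z ⊕ w)) (mids i)) ,
      (λ i → part-mem (Fits-dual′ (cut-fits i)) (a′∈ i)
               (subst (λ s → SatAt s a i) (sym (dual-involutive (cut i))) (a∈ i))
               (trans (⊕-comm a′ a) (parts (z ⊕ w))) (mids i ∘ opposite-mid)) ,
      parts (z ⊕ w)
      where
      a  = restrict (z ⊕ w) cut
      a′ = restrict (z ⊕ w) (dualₛ cut)
      e₁₂ = ++-injective (proj₁ L.cut-class z) (proj₁ L.cut-class w) e
      a∈ : Mem (space cut) a
      a∈ = proj₂ L.cut-class (proj₁ e₁₂)
      a′∈ : Mem (space (dualₛ cut)) a′
      a′∈ = proj₂ L*.cut-class (proj₂ e₁₂)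
      opposite-mid : ∀ {p} → opposite p ≡ mid → p ≡ mid
      opposite-mid {mid} _ = refl

    Good-dual : ∀ {m} → L.Good m → L*.Good m
    Good-dual {m} good = Conn-cong (λ i → sym (base-opposite G pole m i)) (Conn-dual good)

    split-vanish : ∀ {m z w} → L.Good m → class z ≡ class w →
      (∀ i → pole i ≡ mid → SatAt (line (m i)) (z ⊕ w) i) → ∀ v → F ! v ≡ true → SatAt null (z ⊕ w) v
    split-vanish {m} {z} {w} good e mids v v∈F = conclude (split {m} e mids)
      where
      conclude : _ → SatAt null (z ⊕ w) v
      conclude (a , a′ , a∈ , a′∈ , sum≡) = subst (λ z → SatAt null z v) sum≡
        (SatAt-⊕ null v (L.vanish good v v∈F a∈) (L*.vanish (Good-dual good) v v∈F a′∈))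

  module Intertwining {k ℓ F} (A : Linkage G k F) (B : Linkage G ℓ F)
    (types-≢ : ∀ v → F ! v ≡ true → Linkage.type A v ≢ Linkage.type B v)
    (covered : ∀ u → Linkage.pole B u ≡ mid → F ! u ≡ true ⊎ Linkage.pole A u ≢ mid) where

    private
      module A  = LinkageProperties G A
      module A* = LinkageProperties G (dualLinkage G A)
      module B  = LinkageProperties G B
      module AS = Split A
      module BS = Split B

    avoiding : (Fin n → Direction) → Fin n → Direction
    avoiding m i = if F ! i then third (A.type i) (B.type i) else m i

    avoiding-F : ∀ m i → F ! i ≡ true → avoiding m i ≡ third (A.type i) (B.type i)
    avoiding-F m i i∈F = cong (if_then third (A.type i) (B.type i) else m i) i∈F

    module _ (m₀ mB : Fin n → Direction) (goodA₀ : A.Good m₀) (goodB : B.Good mB) where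

      m : Fin n → Direction
      m = avoiding m₀

      good : A.Good m
      good = A.Good-change change goodA₀
        where
        Change : Fin n → Direction → Set
        Change i a = m₀ i ≡ a ⊎ (F ! i ≡ true × a ≢ A.type i)
        change : ∀ i → Change i (m i)
        change i = if-elim (Change i) (F ! i)
          (λ i∈F → inj₂ (i∈F , third-≢ˡ (A.type i) (B.type i))) (λ _ → inj₁ refl)

      good* : A*.Good m
      good* = AS.Good-dual good

      xs : Σ (Fin n → Subset n) λ x → ∀ v → F ! v ≡ true → A.Spike m v (x v)
      xs = choice F ⊥ λ v v∈F → A.spike good v v∈F

      xs′ : Σ (Fin n → Subset n) λ x → ∀ v → F ! v ≡ true → A*.Spike m v (x v)
      xs′ = choice F ⊥ λ v v∈F → A*.spike good* v v∈F

      x x′ e : Fin n → Subset n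
      x  = proj₁ xs
      x′ = proj₁ xs′
      e v = x v ⊕ x′ v

      module _ {v} (v∈F : F ! v ≡ true) where

        x-spike : A.Spike m v (x v)
        x-spike = proj₂ xs v v∈F

        x′-spike : A*.Spike m v (x′ v)
        x′-spike = proj₂ xs′ v v∈F

        open A.Spike x-spike public
        open A*.Spike x′-spike public
          renaming (spike-mem to spike′-mem; spike-at to spike′-at; spike-null to spike′-null)

        x-at : SatAt (line (A.type v)) (x v) v
        x-at = subst (λ s → SatAt s (x v) v) (trans (A.base-at v v∈F (m [ v ≔ A.type v ])) (cong line ([≔]-same m v))) (spike-mem v)

        x′-at : SatAt (line (A.type v)) (x′ v) v
        x′-at = subst (λ s → SatAt s (x′ v) v) (trans (A*.base-at v v∈F (m [ v ≔ A.type v ])) (cong line ([≔]-same m v))) (spike′-mem v)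

        x-mid : ∀ i → i ≢ v → A.pole i ≡ mid → SatAt (line (m i)) (x v) i
        x-mid i i≢v p = subst (λ s → SatAt s (x v) i) (cong₂ baseAt p ([≔]-other m v {A.type v} i≢v)) (spike-mem i)

        x′-mid : ∀ i → i ≢ v → A.pole i ≡ mid → SatAt (line (m i)) (x′ v) i
        x′-mid i i≢v p = subst (λ s → SatAt s (x′ v) i)
          (cong₂ baseAt (cong opposite p) ([≔]-other m v {A.type v} i≢v)) (spike′-mem i)

        x-snk : ∀ i → A.pole i ≡ snk → SatAt null (x v) i
        x-snk i p = subst (λ q → SatAt (baseAt q ((m [ v ≔ A.type v ]) i)) (x v) i) p (spike-mem i)

        x′-src : ∀ i → A.pole i ≡ src → SatAt null (x′ v) i
        x′-src i p = subst (λ q → SatAt (baseAt (opposite q) ((m [ v ≔ A.type v ]) i)) (x′ v) i) p (spike′-mem i)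

        e-at : SatAt null (e v) v
        e-at = spikes-cancel (A.type v) spike-at spike′-at x-at x′-at

        e-mid : ∀ i → A.pole i ≡ mid → SatAt (line (m i)) (e v) i
        e-mid i p = at-or-off i v
          (λ i≡v → SatAt-weaken (line (m i)) (subst (SatAt null (e v)) (sym i≡v) e-at))
          (λ i≢v → SatAt-⊕ (line (m i)) i (x-mid i i≢v p) (x′-mid i i≢v p))

        -- The side of the cut `bad v` on which i lies decides which of x v and x′ v vanishes at i.
        one-vanishes : ∀ i → F ! i ≡ true → i ≢ v → SatAt null (x v) i ⊎ SatAt null (x′ v) i
        one-vanishes i i∈F i≢v = by-cases (A.bad v i) refl
          (subst₂ (λ p y → Fits p y (A.bad v i)) (A.F-mid i i∈F) ([≔]-other _ v i≢v) (A.bad-fits v v∈F i))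
          where
          by-cases : ∀ s → A.bad v i ≡ s → Fits mid nothing s → SatAt null (x v) i ⊎ SatAt null (x′ v) i
          by-cases null eq fits-null = inj₁ (spike-null i eq)
          -- The dual linkage uses the complementary cut, on which `i` is null.
          by-cases free eq fits-free = inj₂ (spike′-null i (cong dual eq))

      e-difference : ∀ {u v} → F ! u ≡ true → F ! v ≡ true → AS.class (e u) ≡ AS.class (e v) →
        ∀ i → F ! i ≡ true → SatAt null (e u ⊕ e v) i
      e-difference u∈F v∈F same-class = AS.split-vanish {m} good same-class
        λ i p → SatAt-⊕ (line (m i)) i (e-mid u∈F i p) (e-mid v∈F i p)

      -- On `F` the sums `e v` and `e i` agree, and `e i` vanishes at `i`; hence `x v` and `x′ v`
      -- agree at `i`, where one of them is zero.
      x-off : ∀ {v i} → F ! v ≡ true → F ! i ≡ true → i ≢ v → AS.class (e v) ≡ AS.class (e i) → SatAt null (x v) i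
      x-off {v} {i} v∈F i∈F i≢v same-class =
        [ (λ x0 → x0)
        , (λ x′0 → SatAt-cancel null x′0 (SatAt-cancel null (e-at i∈F) (e-difference v∈F i∈F same-class i i∈F))) ]′
        (one-vanishes v∈F i i∈F i≢v)

      module _ (J₀ : Subset n) (J₀⊆F : ∀ i → J₀ ! i ≡ true → F ! i ≡ true)
        (same-class : ∀ i j → J₀ ! i ≡ true → J₀ ! j ≡ true → AS.class (e i) ≡ AS.class (e j)) where

        -- The directions in which the vectors w_j may be nonzero on `F`: t_i on the chosen vertices
        -- and n_i on the others. Neither is critical for `B`, so they may replace those of `mB`.
        mJ : Fin n → Direction
        mJ i = if J₀ ! i then A.type i else avoiding mB i

        goodJ : B.Good mJ
        goodJ = B.Good-change change goodB
          where
          Change : Fin n → Direction → Set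
          Change i a = mB i ≡ a ⊎ (F ! i ≡ true × a ≢ B.type i)
          change : ∀ i → Change i (mJ i)
          change i = if-elim (Change i) (J₀ ! i)
            (λ i∈J → inj₂ (J₀⊆F i i∈J , types-≢ i (J₀⊆F i i∈J)))
            (λ _ → if-elim (Change i) (F ! i) (λ i∈F → inj₂ (i∈F , third-≢ʳ (A.type i) (B.type i))) (λ _ → inj₁ refl))

        mJ-in : ∀ i → J₀ ! i ≡ true → mJ i ≡ A.type i
        mJ-in i i∈J = cong (if_then A.type i else avoiding mB i) i∈J

        mJ-out : ∀ i → J₀ ! i ≡ false → F ! i ≡ true → mJ i ≡ m i
        mJ-out i i∉J i∈F = trans (cong (if_then A.type i else avoiding mB i) i∉J)
          (trans (avoiding-F mB i i∈F) (sym (avoiding-F m₀ i i∈F)))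

        x-line : ∀ {v} → J₀ ! v ≡ true → ∀ i → F ! i ≡ true → SatAt (line (mJ i)) (x v) i
        x-line {v} v∈J i i∈F = at-or-off i v
          (λ i≡v → subst₂ (λ a i → SatAt (line a) (x v) i)
            (trans (sym (mJ-in v v∈J)) (cong mJ (sym i≡v))) (sym i≡v) (x-at (J₀⊆F v v∈J)))
          (by-cases (J₀ ! i) refl)
          where
          by-cases : ∀ b → J₀ ! i ≡ b → i ≢ v → SatAt (line (mJ i)) (x v) i
          by-cases true  i∈J i≢v = SatAt-weaken (line (mJ i)) (x-off (J₀⊆F v v∈J) i∈F i≢v (same-class v i v∈J i∈J))
          by-cases false i∉J i≢v = subst (λ a → SatAt (line a) (x v) i) (sym (mJ-out i i∉J i∈F))
            (x-mid (J₀⊆F v v∈J) i i≢v (A.F-mid i i∈F))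

        module _ {J xb xb′ : Subset n} (J⊆J₀ : ∀ i → J ! i ≡ true → J₀ ! i ≡ true)
          (anchor : Anchor A.pole F J m mJ xb xb′)
          (anchor-class : ∀ j → J ! j ≡ true → AS.class (e j) ≡ AS.class (xb ⊕ xb′)) where
          open Anchor anchor

          J⊆F : ∀ i → J ! i ≡ true → F ! i ≡ true
          J⊆F i i∈J = J₀⊆F i (J⊆J₀ i i∈J)

          -- Adding `a` on the side of `x` and `a′` on the side of `x′` gives the same vector. The
          -- first expression shows that it vanishes at the sinks of `A`, the second that it
          -- vanishes at the sources.
          rung : ∀ j → J ! j ≡ true → Σ (Subset n) (Rung B.pole F mJ (x j ⊕ xb))
          rung j j∈J = build (AS.split {m} (anchor-class j j∈J)
              λ i p → SatAt-⊕ (line (m i)) i (e-mid j∈F i p) (anchor-mid i p))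
            where
            j∈F = J⊆F j j∈J
            build : _ → Σ (Subset n) (Rung B.pole F mJ (x j ⊕ xb))
            build (a , a′ , a∈ , a′∈ , sum≡) = (x j ⊕ xb) ⊕ a , record
              { rung-mid = λ u p → mids u (covered u p)
              ; rung-F   = λ i i∈F s → SatAt-cancel s (A.vanish good i i∈F a∈)
              ; rung-F′  = λ i i∈F s w∈ → SatAt-⊕ s i w∈ (SatAt-weaken s (A.vanish good i i∈F a∈))
              }
              where
              reflected : (x j ⊕ xb) ⊕ a ≡ (x′ j ⊕ xb′) ⊕ a′
              reflected = !-ext λ i → begin
                ((x j ⊕ xb) ⊕ a) ! i
                  ≡⟨ trans (!-⊕ (x j ⊕ xb) a i) (cong (_xor (a ! i)) (!-⊕ (x j) xb i)) ⟩
                ((x j ! i) xor (xb ! i)) xor (a ! i)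
                  ≡⟨ xor-exchange ((x j ! i) xor (xb ! i)) ((x′ j ! i) xor (xb′ ! i)) (a ! i) (a′ ! i)
                       (trans (xor-interchange (x j ! i) (xb ! i) (x′ j ! i) (xb′ ! i)) (pointwise i)) ⟩
                ((x′ j ! i) xor (xb′ ! i)) xor (a′ ! i)
                  ≡⟨ trans (!-⊕ (x′ j ⊕ xb′) a′ i) (cong (_xor (a′ ! i)) (!-⊕ (x′ j) xb′ i)) ⟨
                ((x′ j ⊕ xb′) ⊕ a′) ! i ∎
                where
                open ≡-Reasoning
                pointwise : ∀ i → ((x j ! i) xor (x′ j ! i)) xor ((xb ! i) xor (xb′ ! i)) ≡ (a ! i) xor (a′ ! i)
                pointwise i = begin
                  ((x j ! i) xor (x′ j ! i)) xor ((xb ! i) xor (xb′ ! i))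
                    ≡⟨ cong₂ _xor_ (!-⊕ (x j) (x′ j) i) (!-⊕ xb xb′ i) ⟨
                  (e j ! i) xor ((xb ⊕ xb′) ! i)  ≡⟨ !-⊕ (e j) (xb ⊕ xb′) i ⟨
                  (e j ⊕ (xb ⊕ xb′)) ! i          ≡⟨ cong (_! i) sum≡ ⟨
                  (a ⊕ a′) ! i                    ≡⟨ !-⊕ a a′ i ⟩
                  (a ! i) xor (a′ ! i)            ∎
              outside-mid : ∀ u p → A.pole u ≡ p → p ≢ mid → SatAt null ((x j ⊕ xb) ⊕ a) u
              outside-mid u mid _ mid≢mid = contradiction refl mid≢mid
              outside-mid u snk p _ = SatAt-⊕ null u (SatAt-⊕ null u (x-snk j∈F u p) (anchor-snk u p))
                (subst (λ q → SatAt (baseAt q _) a u) p (a∈ u))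
              outside-mid u src p _ = subst (λ z → SatAt null z u) (sym reflected)
                (SatAt-⊕ null u (SatAt-⊕ null u (x′-src j∈F u p) (anchor-src u p))
                  (subst (λ q → SatAt (baseAt (opposite q) _) a′ u) p (a′∈ u)))
              mids : ∀ u → F ! u ≡ true ⊎ A.pole u ≢ mid → SatAt (line (mJ u)) ((x j ⊕ xb) ⊕ a) u
              mids u (inj₁ u∈F) = SatAt-⊕ (line (mJ u)) u
                (SatAt-⊕ (line (mJ u)) u (x-line (J⊆J₀ j j∈J) u u∈F) (anchor-line u u∈F))
                (SatAt-weaken (line (mJ u)) (A.vanish good u u∈F a∈))
              mids u (inj₂ ¬mid) = SatAt-weaken (line (mJ u)) (outside-mid u (A.pole u) refl ¬mid)

          rungs : Σ (Fin n → Subset n) λ w → ∀ j → J ! j ≡ true → Rung B.pole F mJ (x j ⊕ xb) (w j)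
          rungs = choice J ⊥ rung

          w : Fin n → Subset n
          w = proj₁ rungs

          -- Any direction other than `A.type j` detects the nonzero value of `w j` at `j`, which
          -- lies on the line `A.type j`.
          probe : Fin n → Direction
          probe j = third (A.type j) (B.type j)

          coordinate : Fin n → Subset n → Bool
          coordinate j z = along (probe j) (z ! j) (nb z j)

          coordinate-off : ∀ j → J ! j ≡ true → ∀ i → J ! i ≡ true → i ≢ j → coordinate j (w i) ≡ false
          coordinate-off j j∈J i i∈J i≢j = sat {s = line (probe j)} (Rung.rung-F′ (proj₂ rungs i i∈J) j (J⊆F j j∈J) (line (probe j))
            (SatAt-weaken (line (probe j)) (SatAt-⊕ null j
              (x-off (J⊆F i i∈J) (J⊆F j j∈J) (i≢j ∘ sym) (same-class i j (J⊆J₀ i i∈J) (J⊆J₀ j j∈J)))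
              (anchor-J j j∈J))))

          coordinate-at : ∀ j → J ! j ≡ true → coordinate j (w j) ≡ true
          coordinate-at j j∈J = ¬-not λ off → spike-at j∈F (SatAt-cancel null (anchor-J j j∈J)
            ⟪ two-lines⇒null (A.type j) (probe j) (third-≢ˡ (A.type j) (B.type j) ∘ sym)
                (sat (SatAt-⊕ (line (A.type j)) j (x-at j∈F) (SatAt-weaken (line (A.type j)) (anchor-J j j∈J))))
                (sat (Rung.rung-F (proj₂ rungs j j∈J) j j∈F (line (probe j)) ⟪ off ⟫)) ⟫)
            where
            j∈F = J⊆F j j∈J

          -- The subset sums of the `w j` have 2ℓ bits of class. Two sums of one class differ by a
          -- vector that vanishes on `F`, so they have the same coordinates and come from the same
          -- subset.
          ∣J∣≤ : ∣ J ∣ ≤ ℓ + ℓ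
          ∣J∣≤ = ≤-trans (≤-reflexive (sym (+-identityʳ ∣ J ∣)))
            (subsetInjection⇒≤ J [] (λ I _ → BS.class (⨁ I w)) injective)
            where
            sum-mid : ∀ {I} → I ⊑ J → ∀ u → B.pole u ≡ mid → SatAt (line (mJ u)) (⨁ I w) u
            sum-mid {I} I⊑J u p = ⨁-preserves (λ z → SatAt (line (mJ u)) z u) (SatAt-⊥ (line (mJ u)) u)
              (SatAt-⊕ (line (mJ u)) u) I w λ j j∈I → Rung.rung-mid (proj₂ rungs j (mem {I} I⊑J j j∈I)) u p
              where
              mem : ∀ {I} → I ⊑ J → ∀ j → I ! j ≡ true → J ! j ≡ true
              mem I⊑J j j∈I = ¬-not λ j∉J → contradiction (trans (sym j∈I) (I⊑J j j∉J)) λ ()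
            coordinate-sum : ∀ {I} → I ⊑ J → ∀ j → J ! j ≡ true → coordinate j (⨁ I w) ≡ I ! j
            coordinate-sum {I} I⊑J j j∈J = ⨁-coordinate (coordinate j)
              (sat (SatAt-⊥ (line (probe j)) j)) (along-⊕ (probe j) j) I w j (coordinate-at j j∈J)
              λ i i∈I i≢j → coordinate-off j j∈J i (¬-not λ i∉J → contradiction (trans (sym i∈I) (I⊑J i i∉J)) λ ()) i≢j
            injective : ∀ {C C′ : Subset n} {E E′ : Subset 0} → C ⊑ J → C′ ⊑ J → E ⊑ [] → E′ ⊑ [] →
              BS.class (⨁ C w) ≡ BS.class (⨁ C′ w) → C ≡ C′ × E ≡ E′
            injective {C} {C′} {[]} {[]} C⊑J C′⊑J _ _ e = !-ext (λ j → agree j (J ! j) refl) , refl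
              where
              agree : ∀ j b → J ! j ≡ b → C ! j ≡ C′ ! j
              agree j false j∉J = trans (C⊑J j j∉J) (sym (C′⊑J j j∉J))
              agree j true  j∈J = trans (sym (coordinate-sum {C} C⊑J j j∈J)) (trans
                (xor-false⇒≡ (trans (sym (along-⊕ a j (⨁ C w) (⨁ C′ w)))
                  (sat {s = line a} (SatAt-weaken (line a) (BS.split-vanish goodJ e
                    (λ u p → SatAt-⊕ (line (mJ u)) u (sum-mid {C} C⊑J u p) (sum-mid {C′} C′⊑J u p)) j (J⊆F j j∈J))))))
                (coordinate-sum {C′} C′⊑J j j∈J))
                where a = probe j

      e-color : Fin (suc n) → Vec Bool (k + k)
      -- Written as a sum in order to match `xb ⊕ xb′` for the trivial anchor.
      e-color zero    = AS.class (⊥ ⊕ ⊥)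
      e-color (suc j) = AS.class (e j)

      trivial-anchor : ∀ J₀ J⊆F same-class →
        Anchor A.pole F J₀ m (mJ J₀ J⊆F same-class) ⊥ ⊥
      trivial-anchor J₀ J⊆F same-class = record
        { anchor-snk  = λ i _ → SatAt-⊥ null i
        ; anchor-src  = λ i _ → SatAt-⊥ null i
        ; anchor-mid  = λ i _ → SatAt-⊕ (line (m i)) i (SatAt-⊥ (line (m i)) i) (SatAt-⊥ (line (m i)) i)
        ; anchor-J    = λ i _ → SatAt-⊥ null i
        ; anchor-line = λ i _ → SatAt-⊥ (line (mJ J₀ J⊆F same-class i)) i
        }

      -- The vertex `b` has to leave the set, since its own spike is nonzero at `b`; this costs one
      -- element of the class.
      spike-anchor : ∀ J₀ J⊆F same-class b → J₀ ! b ≡ true → ∀ J → (∀ i → J ! i ≡ true → J₀ ! i ≡ true × i ≢ b) →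
        Anchor A.pole F J m (mJ J₀ J⊆F same-class) (x b) (x′ b)
      spike-anchor J₀ J⊆F same-class b b∈J J J⊆ = record
        { anchor-snk  = x-snk (J⊆F b b∈J)
        ; anchor-src  = x′-src (J⊆F b b∈J)
        ; anchor-mid  = e-mid (J⊆F b b∈J)
        ; anchor-J    = λ i i∈J → x-off (J⊆F b b∈J) (J⊆F i (proj₁ (J⊆ i i∈J))) (proj₂ (J⊆ i i∈J))
                          (same-class b i b∈J (proj₁ (J⊆ i i∈J)))
        ; anchor-line = x-line J₀ J⊆F same-class b∈J
        }

      -- The first entry of the Boolean vector stands for a dummy vertex with the zero vector as its spike.
      no-large-class : ∀ J⁺ → (∀ i → J⁺ ! i ≡ true → (true ∷ F) ! i ≡ true) → suc (ℓ + ℓ) < ∣ J⁺ ∣ →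
        (∀ i j → J⁺ ! i ≡ true → J⁺ ! j ≡ true → e-color i ≡ e-color j) → Empty.⊥
      -- The dummy serves as the anchor, so all real vertices of the class remain.
      no-large-class (true ∷ J) J⊆F large mono = ≤⇒≯
        (∣J∣≤ J (J⊆F ∘ suc) (λ i j → mono (suc i) (suc j)) (λ _ i∈J → i∈J)
          (trivial-anchor J (J⊆F ∘ suc) (λ i j → mono (suc i) (suc j)))
          λ j j∈J → mono (suc j) zero j∈J refl)
        (≤-pred large)
      no-large-class (false ∷ J₀) J⊆F large mono = based (nonempty? J₀)
        where
        same-class : ∀ i j → J₀ ! i ≡ true → J₀ ! j ≡ true → AS.class (e i) ≡ AS.class (e j)
        same-class i j = mono (suc i) (suc j)
        based : Dec (Nonempty J₀) → Empty.⊥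
        based (no empty) = contradiction
          (subst (suc (ℓ + ℓ) <_) (trans (cong ∣_∣ (Empty-unique empty)) (∣⊥∣≡0 n)) large) λ ()
        based (yes (b , b∈)) = ≤⇒≯
          (∣J∣≤ J₀ (J⊆F ∘ suc) same-class (λ i i∈J → proj₁ (J⊆ i i∈J))
            (spike-anchor J₀ (J⊆F ∘ suc) same-class b b∈J J J⊆)
            λ j j∈J → same-class j b (proj₁ (J⊆ j j∈J)) b∈J)
          (≤-pred (≤-trans large (≤-reflexive (trans (sym (∣─∣ J₀ ⁅ b ⁆ ⁅b⁆⊑J₀))
            (trans (cong (∣ J ∣ +_) (∣⁅x⁆∣≡1 b)) (+-comm ∣ J ∣ 1))))))
          where
          b∈J : J₀ ! b ≡ true
          b∈J = []=⇒lookup b∈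
          J : Subset n
          J = zipWith (λ a l → a ∧ not l) J₀ ⁅ b ⁆
          ⁅b⁆⊑J₀ : ⁅ b ⁆ ⊑ J₀
          ⁅b⁆⊑J₀ i i∉J = ¬-not λ i∈b → contradiction
            (trans (sym (trans (cong (J₀ !_) (x∈⁅y⁆⇒x≡y b (lookup⇒[]= i ⁅ b ⁆ i∈b))) b∈J)) i∉J) λ ()
          J⊆ : ∀ i → J ! i ≡ true → J₀ ! i ≡ true × i ≢ b
          J⊆ i i∈J = split-∧ (J₀ ! i) (⁅ b ⁆ ! i) refl (trans (sym (lookup-zipWith _ i J₀ ⁅ b ⁆)) i∈J)
            where
            split-∧ : ∀ a l → ⁅ b ⁆ ! i ≡ l → a ∧ not l ≡ true → a ≡ true × i ≢ b
            split-∧ true false i∉b _ = refl , λ { refl → contradiction (trans (sym ([]=⇒lookup (x∈⁅x⁆ i))) i∉b) λ () }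

      no-large-F : (2 * ℓ + 1) * 2 ^ (2 * k) ≤ ∣ F ∣ → Empty.⊥
      no-large-F large = found (pigeonhole (k + k) (true ∷ F) e-color (suc (ℓ + ℓ))
        -- The successor is the dummy candidate; it gives the strict inequality that the pigeonhole
        -- principle asks for.
        (s≤s (subst (_≤ ∣ F ∣) (cong₂ (λ a b → a * 2 ^ b) (double+1 ℓ) (double k)) large)))
        where
        double : ∀ a → 2 * a ≡ a + a
        double = solve-∀
        double+1 : ∀ a → 2 * a + 1 ≡ suc (a + a)
        double+1 = solve-∀
        found : _ → Empty.⊥
        found (J⁺ , J⁺⊆F , J⁺-large , mono) = no-large-class J⁺ J⁺⊆F J⁺-large mono

    few-incompatible-vertices : ¬ (2 * ℓ + 1) * 2 ^ (2 * k) ≤ ∣ F ∣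
    few-incompatible-vertices large = linking G A.pole A.conn λ (m₀ , goodA) →
      linking G B.pole B.conn λ (mB , goodB) → no-large-F m₀ mB goodA goodB large

-- Cut-rank and vertex removal

true≢false : ∀ {b} → b ≡ true → b ≡ false → Empty.⊥
true≢false refl ()

⊆⇒! : ∀ {n} {p q : Subset n} → p ⊆ q → ∀ i → p ! i ≡ true → q ! i ≡ true
⊆⇒! {p = p} {q} p⊆q i e = []=⇒lookup (p⊆q (lookup⇒[]= i p e))

!⇒⊆ : ∀ {n} {p q : Subset n} → (∀ i → p ! i ≡ true → q ! i ≡ true) → p ⊆ q
!⇒⊆ {p = p} {q} h {i} i∈p = lookup⇒[]= i q (h i ([]=⇒lookup i∈p))

⊆⇒⊑ : ∀ {n} {p q : Subset n} → p ⊆ q → p ⊑ q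
⊆⇒⊑ p⊆q i i∉q = ¬-not λ i∈p → true≢false (⊆⇒! p⊆q i i∈p) i∉q

⊑⇒⊆ : ∀ {n} (p q : Subset n) → p ⊑ q → p ⊆ q
⊑⇒⊆ p q p⊑q = !⇒⊆ λ i i∈p → ¬-not λ i∉q → true≢false i∈p (p⊑q i i∉q)

!-─ : ∀ {n} (p q : Subset n) i → (p ─ q) ! i ≡ p ! i ∧ not (q ! i)
!-─ (x ∷ p) (true ∷ q)  zero    = sym (∧-zeroʳ x)
!-─ (x ∷ p) (false ∷ q) zero    = sym (∧-identityʳ x)
!-─ (x ∷ p) (_ ∷ q)     (suc i) = !-─ p q i

∈-─⁺ : ∀ {n} (p q : Subset n) i → p ! i ≡ true → q ! i ≡ false → (p ─ q) ! i ≡ true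
∈-─⁺ p q i i∈p i∉q = trans (!-─ p q i) (cong₂ (λ a b → a ∧ not b) i∈p i∉q)

∈-─⁻ : ∀ {n} (p q : Subset n) i → (p ─ q) ! i ≡ true → p ! i ≡ true × q ! i ≡ false
∈-─⁻ p q i e with p ! i | q ! i | trans (sym (!-─ p q i)) e
... | true | false | _ = refl , refl

⁅⁆-other : ∀ {n} {v i : Fin n} → i ≢ v → ⁅ v ⁆ ! i ≡ false
⁅⁆-other {v = v} {i} i≢v = ¬-not λ i∈ → i≢v (x∈⁅y⁆⇒x≡y v (lookup⇒[]= i ⁅ v ⁆ i∈))

⁅⁆-self : ∀ {n} (v : Fin n) → ⁅ v ⁆ ! v ≡ true
⁅⁆-self v = []=⇒lookup (x∈⁅x⁆ v)

∈-subsets : ∀ {n} (p : Subset n) → p ∈ₗ subsets n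
∈-subsets []          = here refl
∈-subsets (false ∷ p) = ∈-++⁺ˡ (∈-map⁺ (false ∷_) (∈-subsets p))
∈-subsets {suc n} (true ∷ p) = ∈-++⁺ʳ (map (false ∷_) (subsets n)) (∈-map⁺ (true ∷_) (∈-subsets p))

-- The rows outside `lead S` are independent, because a kernel vector that avoids `lead S` is zero.
-- Conversely, distinct subsets of an independent set stay distinct modulo `S`, which bounds its
-- size by the number of quotient coordinates.
rank-nullity : ∀ {n} (M : Matrix₂ n) (X Y : Subset n) (S : Subspace n) →
  (∀ {z} → Mem S z → z ⊆ X × (∀ j → j ∈ Y → sum₂ (λ i → z ! i ∧ M i j) ≡ false)) →
  (∀ {z} → z ⊆ X → (∀ j → j ∈ Y → sum₂ (λ i → z ! i ∧ M i j) ≡ false) → Mem S z) →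
  rank M X Y + dim S ≡ ∣ X ∣
rank-nullity {n} M X Y S S⊆ker ker⊆S = trans (cong (_+ dim S) rank≡) (∣∖lead∣ S X S⊑X)
  where
  A = X ∖lead S
  S⊑X : ∀ {z} → Mem S z → z ⊑ X
  S⊑X z∈S = ⊆⇒⊑ (proj₁ (S⊆ker z∈S))
  quotient = quotient-map S X S⊑X (trans (sym (∣∖lead∣ S X S⊑X)) (+-comm ∣ A ∣ (dim S)))
  A-independent : Independent M A Y
  A-independent C C⊆A C∈ker (i , i∈C) = ∉⊥ (subst (i ∈_) C≡⊥ i∈C)
    where
    C≡⊥ : C ≡ ⊥
    C≡⊥ = avoids-lead⇒⊥ S (ker⊆S (⊑⇒⊆ A X (∖lead-⊑ S X) ∘ C⊆A) C∈ker)
      λ i i∈lead → ⊆⇒⊑ C⊆A i (∖lead-lead S X i i∈lead)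
  independent-small : ∀ B → B ⊆ X → Independent M B Y → ∣ B ∣ ≤ ∣ A ∣
  independent-small B B⊆X ind = ≤-trans (≤-reflexive (sym (+-identityʳ ∣ B ∣)))
    (subsetInjection⇒≤ B [] (λ C _ → proj₁ quotient C) injective)
    where
    injective : ∀ {C C′ : Subset n} {E E′ : Subset 0} → C ⊑ B → C′ ⊑ B → E ⊑ [] → E′ ⊑ [] →
      proj₁ quotient C ≡ proj₁ quotient C′ → C ≡ C′ × E ≡ E′
    injective {C} {C′} {[]} {[]} C⊑B C′⊑B _ _ e = ⊕≡⊥⇒≡ (Empty-unique
        (ind (C ⊕ C′) C⊕C′⊆B (proj₂ (S⊆ker (proj₂ quotient (within {C} C⊑B) (within {C′} C′⊑B) e))))) , refl
      where
      within : ∀ {C} → C ⊑ B → C ⊑ X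
      within {C} C⊑B i i∉X = C⊑B i (⊆⇒⊑ B⊆X i i∉X)
      C⊕C′⊆B : (C ⊕ C′) ⊆ B
      C⊕C′⊆B = !⇒⊆ λ i i∈ → ¬-not λ i∉B →
        true≢false i∈ (trans (!-⊕ C C′ i) (cong₂ _xor_ (C⊑B i i∉B) (C′⊑B i i∉B)))
  candidate? : ∀ B → Dec (B ⊆ X × Independent M B Y)
  candidate? B = (B ⊆? X) ×-dec independent? M B Y
  rank≡ : rank M X Y ≡ ∣ A ∣
  rank≡ = ≤-antisym
    (max≤v⁺ z≤n (All.tabulate bounded))
    (v≤max⁺ 0 _ (inj₂ (lose (∈-map⁺ ∣_∣ (∈-filter⁺ candidate? (∈-subsets A)
      (⊑⇒⊆ A X (∖lead-⊑ S X) , A-independent))) ≤-refl)))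
    where
    bounded : ∀ {m} → m ∈ₗ map ∣_∣ (filter candidate? (subsets n)) → m ≤ ∣ A ∣
    bounded m∈ with ∈-map⁻ ∣_∣ m∈
    ... | B , B∈ , refl with ∈-filter⁻ candidate? {xs = subsets n} B∈
    ... | _ , B⊆X , ind = independent-small B B⊆X ind

Separates : ∀ {n} → Graph n → Subset n → Subset n → Subset n → Set
Separates G S T X = S ⊆ X × X ⊆ (V G ─ T)

κ≤cutRank : ∀ {n} (G : Graph n) S T {X} → Separates G S T X → κ G S T ≤ cutRank G X
κ≤cutRank G S T {X} sep = min≤v⁺ (cutRank G S) _ (inj₂ (lose (∈-map⁺ (cutRank G)
  (∈-filter⁺ (λ X → (S ⊆? X) ×-dec (X ⊆? (V G ─ T))) (∈-subsets X) sep)) ≤-refl))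

κ-attained : ∀ {n} (G : Graph n) S T → S ⊆ (V G ─ T) → ∃ λ X → Separates G S T X × cutRank G X ≡ κ G S T
κ-attained {n} G S T S⊆ with argmin-sel id (cutRank G S)
    (map (cutRank G) (filter (λ X → (S ⊆? X) ×-dec (X ⊆? (V G ─ T))) (subsets n)))
... | inj₁ κ≡ = S , (id , S⊆) , sym κ≡
... | inj₂ κ∈ with ∈-map⁻ (cutRank G) κ∈
... | X , X∈ , κ≡ = X , proj₂ (∈-filter⁻ (λ X → (S ⊆? X) ×-dec (X ⊆? (V G ─ T))) {xs = subsets n} X∈) , sym κ≡

indicator : ∀ {n} → Subset n → State n
indicator X i = if X ! i then free else null

indicator-free : ∀ {n} (X : Subset n) i → X ! i ≡ true → indicator X i ≡ free
indicator-free X i e = cong (if_then free else null) e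

indicator-null : ∀ {n} (X : Subset n) i → X ! i ≡ false → indicator X i ≡ null
indicator-null X i e = cong (if_then free else null) e

free#-indicator : ∀ {n} (X : Subset n) → free# (indicator X) ≡ ∣ X ∣
free#-indicator []          = refl
free#-indicator (true ∷ X)  = cong suc (free#-indicator X)
free#-indicator (false ∷ X) = free#-indicator X

free#-off : ∀ {n} (X : Subset n) v {a} → X ! v ≡ false → free# (indicator X [ v ≔ line a ]) ≡ ∣ X ∣
free#-off {n} X v {a} v∉X = trans (sumℕ-cong {n} pointwise) (free#-indicator X)
  where
  pointwise : ∀ i → frees ((indicator X [ v ≔ line a ]) i) ≡ frees (indicator X i)
  pointwise i with i ≟ v
  ... | no _     = refl
  ... | yes refl = sym (cong frees (indicator-null X v v∉X))

-- Indices outside the vertex set behave like isolated vertices. States can therefore range over all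
-- of `Fin n` although cut-rank uses only the columns in `V G`.
nb-outside : ∀ {n} (G : Graph n) z j → V G ! j ≡ false → Vectors.nb G z j ≡ false
nb-outside G z j j∉V = sum-zero _ λ i → trans (cong (z ! i ∧_) (¬-not λ ij →
  true≢false ([]=⇒lookup (adj⇒∈V G j i (trans (adj-sym G j i) ij))) j∉V)) (∧-zeroʳ (z ! i))

cutRank-indicator : ∀ {n} (G : Graph n) X → cutRank G X + Vectors.D G (indicator X) ≡ ∣ X ∣
cutRank-indicator G X = rank-nullity (adj G) X (V G ─ X) (space (indicator X))
  (λ {z} z∈ → ⊑⇒⊆ z X (λ i i∉X → proj₁ (sat (null-at z z∈ i i∉X))) ,
    λ j j∈ → proj₂ (sat (null-at z z∈ j (proj₂ (∈-─⁻ (V G) X j ([]=⇒lookup j∈))))))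
  (λ {z} z⊆X ker i → member z z⊆X ker i (X ! i) refl)
  where
  open Vectors G
  null-at : ∀ z → Mem (space (indicator X)) z → ∀ i → X ! i ≡ false → SatAt null z i
  null-at z z∈ i i∉X = subst (λ s → SatAt s z i) (indicator-null X i i∉X) (z∈ i)
  member : ∀ z → z ⊆ X → (∀ j → j ∈ (V G ─ X) → nb z j ≡ false) →
    ∀ i b → X ! i ≡ b → SatAt (indicator X i) z i
  member z z⊆X ker i true  i∈X = subst (λ s → SatAt s z i) (sym (indicator-free X i i∈X)) ⟪ tt ⟫
  member z z⊆X ker i false i∉X = subst (λ s → SatAt s z i) (sym (indicator-null X i i∉X))
    ⟪ ⊆⇒⊑ z⊆X i i∉X , nb-null (V G ! i) refl ⟫
    where
    nb-null : ∀ b → V G ! i ≡ b → nb z i ≡ false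
    nb-null false i∉V = nb-outside G z i i∉V
    nb-null true  i∈V = ker i (lookup⇒[]= i _ (∈-─⁺ (V G) X i i∈V i∉X))

-- Deletion, local complementation and pivoting in terms of states

nb-delete : ∀ {n} (G : Graph n) v z j → z ! v ≡ false → j ≢ v → Vectors.nb (G ∖ v) z j ≡ Vectors.nb G z j
nb-delete {n} G v z j zv j≢v = sum-cong-≗ {n} pointwise
  where
  pointwise : ∀ i → z ! i ∧ (adj G i j ∧ (not (does (i ≟ v)) ∧ not (does (j ≟ v)))) ≡ z ! i ∧ adj G i j
  pointwise i rewrite dec-false (j ≟ v) j≢v with i ≟ v
  ... | no _     = cong (z ! i ∧_) (∧-identityʳ (adj G i j))
  ... | yes refl rewrite zv = refl

-- The constraint `line del` keeps `v` out of the subset and leaves the parity at `v` arbitrary,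
-- which amounts to dropping the column of `v`.
cutRank-delete : ∀ {n} (G : Graph n) v X → X ! v ≡ false →
  cutRank (G ∖ v) X + Vectors.D G (indicator X [ v ≔ line del ]) ≡ ∣ X ∣
cutRank-delete G v X v∉X = rank-nullity (adj (G ∖ v)) X (V G - v ─ X) (space σ)
  (λ {z} z∈ → inside-X z z∈ ,
    λ j j∈ → let j∈V-v , j∉X = ∈-─⁻ (V G - v) X j ([]=⇒lookup j∈) in
      trans (nb-delete G v z j (⊆⇒⊑ (inside-X z z∈) v v∉X) (≢v j j∈V-v)) (proj₂ (sat (null-at z z∈ j j∉X (≢v j j∈V-v)))))
  (λ {z} z⊆X ker i → member z z⊆X ker i)
  where
  open Vectors G
  σ = indicator X [ v ≔ line del ]
  ≢v : ∀ j → (V G - v) ! j ≡ true → j ≢ v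
  ≢v j j∈ refl = true≢false (⁅⁆-self j) (proj₂ (∈-─⁻ (V G) ⁅ j ⁆ j j∈))
  null-at : ∀ z → Mem (space σ) z → ∀ i → X ! i ≡ false → i ≢ v → SatAt null z i
  null-at z z∈ i i∉X i≢v = subst (λ s → SatAt s z i)
    (trans ([≔]-other (indicator X) v i≢v) (indicator-null X i i∉X)) (z∈ i)
  z-off : ∀ z → Mem (space σ) z → z ⊑ X
  z-off z z∈ i i∉X = at-or-off i v
    (λ { refl → sat (subst (λ s → SatAt s z i) ([≔]-same (indicator X) i) (z∈ i)) })
    (λ i≢v → proj₁ (sat (null-at z z∈ i i∉X i≢v)))
  inside-X : ∀ z → Mem (space σ) z → z ⊆ X
  inside-X z z∈ = ⊑⇒⊆ z X (z-off z z∈)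
  member : ∀ z → z ⊆ X → (∀ j → j ∈ (V G - v ─ X) → Vectors.nb (G ∖ v) z j ≡ false) →
    ∀ i → SatAt (σ i) z i
  member z z⊆X ker i = at-or-off i v
    (λ { refl → subst (λ s → SatAt s z i) (sym ([≔]-same (indicator X) i)) ⟪ ⊆⇒⊑ z⊆X i v∉X ⟫ })
    (λ i≢v → subst (λ s → SatAt s z i) (sym ([≔]-other (indicator X) v i≢v)) (elsewhere i≢v (X ! i) refl))
    where
    nb-null : i ≢ v → X ! i ≡ false → ∀ b → V G ! i ≡ b → nb z i ≡ false
    nb-null i≢v i∉X false i∉V = nb-outside G z i i∉V
    nb-null i≢v i∉X true  i∈V = trans (sym (nb-delete G v z i (⊆⇒⊑ z⊆X v v∉X) i≢v))
      (ker i (lookup⇒[]= i _ (∈-─⁺ (V G - v) X i (∈-─⁺ (V G) ⁅ v ⁆ i i∈V (⁅⁆-other i≢v)) i∉X)))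
    elsewhere : i ≢ v → ∀ b → X ! i ≡ b → SatAt (indicator X i) z i
    elsewhere i≢v true  i∈X = subst (λ s → SatAt s z i) (sym (indicator-free X i i∈X)) ⟪ tt ⟫
    elsewhere i≢v false i∉X = subst (λ s → SatAt s z i) (sym (indicator-null X i i∉X))
      ⟪ ⊆⇒⊑ z⊆X i i∉X , nb-null i≢v i∉X (V G ! i) refl ⟫

-- The linear map of GF(2)² by which complementing at `u` acts at a vertex; the flags tell whether
-- it is `u` itself and whether it is a neighbour. At `u` it swaps (0,1) and (1,1), at a neighbour
-- (1,1) and (1,0).
turn : Bool → Bool → Constraint → Constraint
turn true  _    (line del)  = line star
turn true  _    (line star) = line del
turn false true (line star) = line piv
turn false true (line piv)  = line star
turn _     _    s           = s

turn-self : ∀ b s {c N} →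
  (Sat s c N → Sat (turn true b s) (c xor N) N) × (Sat (turn true b s) (c xor N) N → Sat s c N)
turn-self b free        = id , id
turn-self b null {c}    = (λ { (refl , refl) → refl , refl }) , λ { (e , refl) → trans (sym (xor-identityʳ c)) e , refl }
turn-self b (line del) {c} {N} = trans e , trans (sym e)
  where
  e : (c xor N) xor N ≡ c
  e = trans (xor-assoc c N N) (trans (cong (c xor_) (xor-same N)) (xor-identityʳ c))
turn-self b (line star) = id , id
turn-self b (line piv)  = id , id

turn-neighbour : ∀ s {c d} →
  (Sat s c (d xor c) → Sat (turn false true s) c d) × (Sat (turn false true s) c d → Sat s c (d xor c))
turn-neighbour free = id , id
turn-neighbour null {d = d} = (λ { (refl , e) → refl , trans (sym (xor-identityʳ d)) e }) ,
  λ { (refl , refl) → refl , refl }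
turn-neighbour (line del) = id , id
turn-neighbour (line star) {c} {d} = trans (sym e) , trans e
  where
  e : c xor (d xor c) ≡ d
  e = trans (xor-comm c _) (trans (xor-assoc d c c) (trans (cong (d xor_) (xor-same c)) (xor-identityʳ d)))
turn-neighbour (line piv) {c} {d} = trans (xor-comm c d) , trans (xor-comm d c)

turn-other : ∀ s → turn false false s ≡ s
turn-other free        = refl
turn-other null        = refl
turn-other (line del)  = refl
turn-other (line star) = refl
turn-other (line piv)  = refl

turnₛ : ∀ {n} → Graph n → Fin n → State n → State n
turnₛ G u σ w = turn (does (w ≟ u)) (adj G u w) (σ w)

module LocalComplement {n} (G : Graph n) (u : Fin n) where
  open Vectors G

  -- The subset whose vector in `G` is that of `z` in `G ⋆ u` up to the maps behind `turn`: `u` is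
  -- toggled when `z` contains an odd number of its neighbours.
  counterpart : Subset n → Subset n
  counterpart z = z ⊕ (if nb z u then ⁅ u ⁆ else ⊥)

  nb-⁅⁆ : ∀ w → nb ⁅ u ⁆ w ≡ adj G u w
  nb-⁅⁆ w = trans (sum-single _ u λ i i≢u → cong (_∧ adj G i w) (⁅⁆-other i≢u)) (cong (_∧ adj G u w) (⁅⁆-self u))

  counterpart-! : ∀ z w → counterpart z ! w ≡ (z ! w) xor (nb z u ∧ ⁅ u ⁆ ! w)
  counterpart-! z w = trans (!-⊕ z _ w) (cong ((z ! w) xor_) (when (nb z u)))
    where
    when : ∀ b → (if b then ⁅ u ⁆ else ⊥) ! w ≡ b ∧ ⁅ u ⁆ ! w
    when true  = refl
    when false = !-⊥ w

  nb-counterpart : ∀ z w → nb (counterpart z) w ≡ nb z w xor (nb z u ∧ adj G u w)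
  nb-counterpart z w = trans (nb-⊕ z _ w) (cong (nb z w xor_) (when (nb z u)))
    where
    when : ∀ b → nb (if b then ⁅ u ⁆ else ⊥) w ≡ b ∧ adj G u w
    when true  = nb-⁅⁆ w
    when false = nb-⊥ w

  nb-⋆ : ∀ z w → Vectors.nb (G ⋆ u) z w ≡ nb z w xor ((nb z u ∧ adj G u w) xor (z ! w ∧ adj G u w))
  nb-⋆ z w = begin
    sum₂ (λ i → z ! i ∧ adj (G ⋆ u) i w)
      ≡⟨ sum-cong-≗ {n} (λ i → expand-term (z ! i) (adj G i w) (adj G u i) (adj G u w) (does (i ≟ w))) ⟩
    sum₂ (λ i → (z ! i ∧ adj G i w) xor ((z ! i ∧ adj G u i) ∧ b xor corr i))
      ≡⟨ ∑-distrib-+ {n} _ _ ⟩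
    nb z w xor sum₂ (λ i → (z ! i ∧ adj G u i) ∧ b xor corr i)
      ≡⟨ cong (nb z w xor_) (∑-distrib-+ {n} _ _) ⟩
    nb z w xor (sum₂ (λ i → (z ! i ∧ adj G u i) ∧ b) xor sum₂ corr)
      ≡⟨ cong (nb z w xor_) (cong₂ _xor_ (trans (sym (*-distribʳ-sum {n} b _)) (cong (_∧ b) (sum-cong-≗ {n} λ i → cong (z ! i ∧_) (adj-sym G u i))))
           (trans (sum-single corr w corr-off) corr-at)) ⟩
    nb z w xor ((nb z u ∧ b) xor (z ! w ∧ b)) ∎
    where
    open ≡-Reasoning
    b = adj G u w
    -- The term `i = w` has to be taken back, since local complementation creates no loops.
    corr : Fin n → Bool
    corr i = ((z ! i ∧ adj G u i) ∧ b) ∧ does (i ≟ w)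
    expand-term : ∀ c a a′ b δ → c ∧ (a xor ((a′ ∧ b) ∧ not δ)) ≡ (c ∧ a) xor (((c ∧ a′) ∧ b) xor (((c ∧ a′) ∧ b) ∧ δ))
    expand-term false a a′    b δ = refl
    expand-term true  a false b δ = refl
    expand-term true  a true  false δ = refl
    expand-term true  a true  true  true = refl
    expand-term true  a true  true  false = refl
    corr-off : ∀ i → i ≢ w → corr i ≡ false
    corr-off i i≢w = trans (cong (((z ! i ∧ adj G u i) ∧ b) ∧_) (dec-false (i ≟ w) i≢w)) (∧-zeroʳ ((z ! i ∧ adj G u i) ∧ b))
    corr-at : corr w ≡ z ! w ∧ b
    corr-at = trans (cong (((z ! w ∧ b) ∧ b) ∧_) (dec-true (w ≟ w) refl)) (trans (∧-identityʳ _)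
      (trans (∧-assoc (z ! w) b b) (cong (z ! w ∧_) (∧-idem b))))

  turn-SatAt : ∀ s z w →
    (Vectors.SatAt (G ⋆ u) s z w → SatAt (turn (does (w ≟ u)) (adj G u w) s) (counterpart z) w) ×
    (SatAt (turn (does (w ≟ u)) (adj G u w) s) (counterpart z) w → Vectors.SatAt (G ⋆ u) s z w)
  turn-SatAt s z w =
    (λ e → ⟪ subst₂ (Sat _) (sym (counterpart-! z w)) (sym (nb-counterpart z w))
              (proj₁ (equiv (w ≟ u)) (subst (Sat s (z ! w)) (nb-⋆ z w) (Vectors.sat e))) ⟫) ,
    (λ e → Vectors.⟪ subst (Sat s (z ! w)) (sym (nb-⋆ z w))
              (proj₂ (equiv (w ≟ u)) (subst₂ (Sat _) (counterpart-! z w) (nb-counterpart z w) (sat e))) ⟫)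
    where
    c = z ! w
    d = nb z w
    N = nb z u
    Equiv : Bool → Bool → Bool → Bool → Set
    Equiv δ b l d =
      (Sat s c (d xor ((N ∧ b) xor (c ∧ b))) → Sat (turn δ b s) (c xor (N ∧ l)) (d xor (N ∧ b))) ×
      (Sat (turn δ b s) (c xor (N ∧ l)) (d xor (N ∧ b)) → Sat s c (d xor ((N ∧ b) xor (c ∧ b))))
    at-u : Equiv true false true N
    at-u rewrite ∧-zeroʳ N | ∧-zeroʳ c | ∧-identityʳ N | xor-identityʳ N = turn-self false s
    neighbour : Equiv false true false d
    neighbour rewrite ∧-zeroʳ N | ∧-identityʳ N | ∧-identityʳ c | xor-identityʳ c | sym (xor-assoc d N c) = turn-neighbour s
    other : Equiv false false false d
    other rewrite ∧-zeroʳ N | ∧-zeroʳ c | xor-identityʳ c | turn-other s = id , id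
    off-u : ∀ b → Equiv false b false d
    off-u true  = neighbour
    off-u false = other
    equiv : (w≟u : Dec (w ≡ u)) → Equiv (does w≟u) (adj G u w) (⁅ u ⁆ ! w) d
    equiv (yes refl) rewrite adj-irrefl G u | ⁅⁆-self u = at-u
    equiv (no w≢u)   rewrite ⁅⁆-other w≢u = off-u (adj G u w)

  counterpart-involutive : ∀ z → counterpart (counterpart z) ≡ z
  counterpart-involutive z = trans (cong (λ b → counterpart z ⊕ (if b then ⁅ u ⁆ else ⊥)) nb-same) (⊕-cancel z _)
    where
    nb-same : nb (counterpart z) u ≡ nb z u
    nb-same = trans (nb-counterpart z u) (trans (cong (λ b → nb z u xor (nb z u ∧ b)) (adj-irrefl G u))
      (trans (cong (nb z u xor_) (∧-zeroʳ (nb z u))) (xor-identityʳ (nb z u))))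

  counterpart-injective : ∀ {z w} → counterpart z ≡ counterpart w → z ≡ w
  counterpart-injective {z} {w} e = trans (sym (counterpart-involutive z)) (trans (cong counterpart e) (counterpart-involutive w))

  D-⋆ : ∀ σ → Vectors.D (G ⋆ u) σ ≡ D (turnₛ G u σ)
  D-⋆ σ = ≤-antisym
    (injection⇒dim-≤-dim (Vectors.space (G ⋆ u) σ) (space (turnₛ G u σ)) counterpart
      (λ {z} z∈ w → proj₁ (turn-SatAt (σ w) z w) (z∈ w)) λ _ _ → counterpart-injective)
    (injection⇒dim-≤-dim (space (turnₛ G u σ)) (Vectors.space (G ⋆ u) σ) counterpart
      (λ {z} z∈ w → proj₂ (turn-SatAt (σ w) (counterpart z) w)
        (subst (λ z → SatAt (turnₛ G u σ w) z w) (sym (counterpart-involutive z)) (z∈ w))) λ _ _ → counterpart-injective)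

turn-unlined : ∀ δ b x → turn δ b (if x then free else null) ≡ (if x then free else null)
turn-unlined true  _     true  = refl
turn-unlined true  _     false = refl
turn-unlined false true  true  = refl
turn-unlined false true  false = refl
turn-unlined false false true  = refl
turn-unlined false false false = refl

D-⋆-line : ∀ {n} (G : Graph n) u v X {a b} → turn (does (v ≟ u)) (adj G u v) (line a) ≡ line b →
  Vectors.D (G ⋆ u) (indicator X [ v ≔ line a ]) ≡ Vectors.D G (indicator X [ v ≔ line b ])
D-⋆-line G u v X {a} {b} e = trans (LocalComplement.D-⋆ G u (indicator X [ v ≔ line a ])) (Vectors.D-cong G turned)
  where
  turned : turnₛ G u (indicator X [ v ≔ line a ]) ≗ indicator X [ v ≔ line b ]
  turned i with i ≟ v
  ... | yes refl = e
  ... | no _     = turn-unlined (does (i ≟ u)) (adj G u i) (X ! i)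

-- All that the argument uses about a removal: the new vertex set and the new cut-ranks.
Removes : ∀ {n} → Graph n → Fin n → Direction → Graph n → Set
Removes G v a H = V H ≡ V G - v ×
  (∀ X → X ! v ≡ false → cutRank H X + Vectors.D G (indicator X [ v ≔ line a ]) ≡ ∣ X ∣)

removes-del : ∀ {n} (G : Graph n) v → Removes G v del (G ∖ v)
removes-del G v = refl , cutRank-delete G v

removes-star : ∀ {n} (G : Graph n) v → Removes G v star (G ⋆ v ∖ v)
removes-star G v = refl , λ X v∉X →
  trans (cong (cutRank (G ⋆ v ∖ v) X +_) (sym (D-⋆-line G v v X
    (cong (λ δ → turn δ (adj G v v) (line del)) (dec-true (v ≟ v) refl)))))
  (cutRank-delete (G ⋆ v) v X v∉X)

-- Traced backwards at `v`, the last complementation fixes `del`, the middle one turns it into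
-- `star`, and the first one, by adjacency, turns that into `piv`. The outcome does not depend on
-- `u`, so the pivots on all neighbours count as one removal.
removes-piv : ∀ {n} (G : Graph n) u v → Adjacent G u v → Removes G v piv (G ∧[ u , v ] ∖ v)
removes-piv G u v uv = refl , λ X v∉X →
  trans (cong (cutRank (G ∧[ u , v ] ∖ v) X +_) (sym (begin
    Vectors.D (G ⋆ u ⋆ v ⋆ u) (indicator X [ v ≔ line del ])
      ≡⟨ D-⋆-line (G ⋆ u ⋆ v) u v X (trans (cong (λ δ → turn δ (adj (G ⋆ u ⋆ v) u v) (line del)) v≢ᵇu) (turn-del (adj (G ⋆ u ⋆ v) u v))) ⟩
    Vectors.D (G ⋆ u ⋆ v) (indicator X [ v ≔ line del ])
      ≡⟨ D-⋆-line (G ⋆ u) v v X (cong (λ δ → turn δ (adj (G ⋆ u) v v) (line del)) (dec-true (v ≟ v) refl)) ⟩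
    Vectors.D (G ⋆ u) (indicator X [ v ≔ line star ])
      ≡⟨ D-⋆-line G u v X (cong₂ (λ δ b → turn δ b (line star)) v≢ᵇu uv) ⟩
    Vectors.D G (indicator X [ v ≔ line piv ]) ∎)))
  (cutRank-delete (G ⋆ u ⋆ v ⋆ u) v X v∉X)
  where
  open ≡-Reasoning
  v≢ᵇu : does (v ≟ u) ≡ false
  v≢ᵇu = dec-false (v ≟ u) λ { refl → true≢false uv (adj-irrefl G u) }
  turn-del : ∀ b → turn false b (line del) ≡ line del
  turn-del true  = refl
  turn-del false = refl

-- Pairs of terminal sets as linkages

poleOf : Bool → Bool → Pole
poleOf true  _     = src
poleOf false true  = mid
-- The second flag will be membership in `V G ─ R`, so indices outside the graph become sinks
-- together with `R`.
poleOf false false = snk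

poleOf-fits : ∀ q m x → (q ≡ true → x ≡ true) → (x ≡ true → m ≡ true) →
  Fits (poleOf q m) nothing (if x then free else null)
poleOf-fits true  m     true  _   _   = fits-src
poleOf-fits true  m     false q⇒x _   = contradiction (q⇒x refl) λ ()
poleOf-fits false true  true  _   _   = fits-free
poleOf-fits false true  false _   _   = fits-null
poleOf-fits false false true  _   x⇒m = contradiction (x⇒m refl) λ ()
poleOf-fits false false false _   _   = fits-snk

fits-poleOf : ∀ q m {s} → (q ≡ true → m ≡ true) → Fits (poleOf q m) nothing s →
  (q ≡ true → isFree s ≡ true) × (isFree s ≡ true → m ≡ true) × s ≡ (if isFree s then free else null)
fits-poleOf true  m     q⇒m fits-src  = (λ _ → refl) , (λ _ → q⇒m refl) , refl
fits-poleOf false true  _   fits-free = (λ ()) , (λ _ → refl) , refl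
fits-poleOf false true  _   fits-null = (λ ()) , (λ ()) , refl
fits-poleOf false false _   fits-snk  = (λ ()) , (λ ()) , refl

module Terminals {n} (G : Graph n) (Q R : Subset n) (Q⊆V─R : Q ⊆ (V G ─ R)) where
  open Vectors G

  k : ℕ
  k = κ G Q R

  pole : Fin n → Pole
  pole i = poleOf (Q ! i) ((V G ─ R) ! i)

  separates-fits : ∀ {X} → Separates G Q R X → ∀ i → Fits (pole i) nothing (indicator X i)
  separates-fits {X} (Q⊆X , X⊆) i = poleOf-fits (Q ! i) ((V G ─ R) ! i) (X ! i) (⊆⇒! Q⊆X i) (⊆⇒! X⊆ i)

  connected : ∀ σ → (∀ i → Fits (pole i) nothing (σ i)) → Conn k σ
  connected σ fits = Conn-cong (λ i → sym (σ≡ i)) (conn-bound (begin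
    D (indicator X) + k             ≤⟨ +-monoʳ-≤ (D (indicator X)) (κ≤cutRank G Q R (Q⊆X , X⊆)) ⟩
    D (indicator X) + cutRank G X   ≡⟨ +-comm (D (indicator X)) _ ⟩
    cutRank G X + D (indicator X)   ≡⟨ cutRank-indicator G X ⟩
    ∣ X ∣                           ≡⟨ free#-indicator X ⟨
    free# (indicator X)             ∎))
    where
    open ≤-Reasoning
    X = freeSet σ
    X! : ∀ i → X ! i ≡ isFree (σ i)
    X! = lookup∘tabulate (isFree ∘ σ)
    bits : ∀ i → _
    bits i = fits-poleOf (Q ! i) ((V G ─ R) ! i) (⊆⇒! Q⊆V─R i) (fits i)
    Q⊆X : Q ⊆ X
    Q⊆X = !⇒⊆ λ i i∈Q → trans (X! i) (proj₁ (bits i) i∈Q)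
    X⊆ : X ⊆ (V G ─ R)
    X⊆ = !⇒⊆ λ i i∈X → proj₁ (proj₂ (bits i)) (trans (sym (X! i)) i∈X)
    σ≡ : ∀ i → σ i ≡ indicator X i
    σ≡ i = trans (proj₂ (proj₂ (bits i))) (cong (if_then free else null) (sym (X! i)))

  Fails : Fin n → Direction → State n → Set
  Fails v a σ = (∀ i → Fits (pole i) (((λ _ → nothing) [ v ≔ just a ]) i) (σ i)) × ¬ Conn k σ

  fails-unique : ∀ {v a b σ τ} → Fails v a σ → Fails v b τ → a ≡ b
  fails-unique {v} {a} {b} (fσ , ¬σ) (fτ , ¬τ) with a ≟ᵈ b
  ... | yes a≡b = a≡b
  ... | no  a≢b = contradiction (Conn-lattice v (split-¬Clash pole (λ _ → nothing) v refl a≢b fσ fτ)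
      (connected _ (split-meet pole (λ _ → nothing) v refl a≢b fσ fτ))
      (connected _ (split-join pole (λ _ → nothing) v refl a≢b fσ fτ)))
    [ ¬σ , ¬τ ]′

  cut : ∃ λ X → Separates G Q R X × cutRank G X ≡ k
  cut = κ-attained G Q R Q⊆V─R

  cut-tight : free# (indicator (proj₁ cut)) ≡ D (indicator (proj₁ cut)) + k
  cut-tight = begin
    free# (indicator X)             ≡⟨ free#-indicator X ⟩
    ∣ X ∣                           ≡⟨ cutRank-indicator G X ⟨
    cutRank G X + D (indicator X)   ≡⟨ +-comm (cutRank G X) _ ⟩
    D (indicator X) + cutRank G X   ≡⟨ cong (D (indicator X) +_) (proj₂ (proj₂ cut)) ⟩
    D (indicator X) + k             ∎
    where
    open ≡-Reasoning
    X = proj₁ cut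

  module _ {v a H} (removes : Removes G v a H) (v-mid : pole v ≡ mid) where

    private
      Q∌v : Q ! v ≡ false
      Q∌v = ¬-not λ v∈Q → contradiction (trans (sym v-mid) (cong (λ q → poleOf q ((V G ─ R) ! v)) v∈Q)) λ ()

      into-H : ∀ i → i ≢ v → (V G ─ R) ! i ≡ true → (V H ─ R) ! i ≡ true
      into-H i i≢v i∈ with ∈-─⁻ (V G) R i i∈
      ... | i∈V , i∉R = ∈-─⁺ (V H) R i
        (subst (λ W → W ! i ≡ true) (sym (proj₁ removes)) (∈-─⁺ (V G) ⁅ v ⁆ i i∈V (⁅⁆-other i≢v))) i∉R

      from-H : ∀ i → (V H ─ R) ! i ≡ true → (V G ─ R) ! i ≡ true × i ≢ v
      from-H i i∈ with ∈-─⁻ (V H) R i i∈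
      ... | i∈VH , i∉R with ∈-─⁻ (V G) ⁅ v ⁆ i (subst (λ W → W ! i ≡ true) (proj₁ removes) i∈VH)
      ... | i∈V , i∉v = ∈-─⁺ (V G) R i i∈V i∉R , λ { refl → true≢false (⁅⁆-self i) i∉v }

    -- Turns a changed connectivity into a smaller one. A minimum cut of `G`, with `v` taken out if
    -- present, has by `D-relax` no larger cut-rank in `H`.
    κ-removal-≤ : κ H Q R ≤ k
    κ-removal-≤ = +-cancelʳ-≤ (D τ + free# σ) _ _ (begin
      κ H Q R + (D τ + free# σ)        ≤⟨ +-monoˡ-≤ _ (κ≤cutRank H Q R (Q⊆X′ , X′⊆)) ⟩
      cutRank H X′ + (D τ + free# σ)   ≡⟨ +-assoc (cutRank H X′) _ _ ⟨
      cutRank H X′ + D τ + free# σ     ≡⟨ cong (_+ free# σ) (trans (proj₂ removes X′ X′∌v) (sym (free#-off X′ v X′∌v))) ⟩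
      free# τ + free# σ                ≡⟨ cong (free# τ +_) cut-tight ⟩
      free# τ + (D σ + k)              ≡⟨ rotate (free# τ) (D σ) k ⟩
      k + (D σ + free# τ)              ≤⟨ +-monoʳ-≤ k (D-relax relaxed) ⟩
      k + (D τ + free# σ)              ∎)
      where
      open ≤-Reasoning
      X = proj₁ cut
      X′ = X - v
      σ = indicator X
      τ = indicator X′ [ v ≔ line a ]
      rotate : ∀ a b c → a + (b + c) ≡ c + (b + a)
      rotate = solve-∀
      X′∌v : X′ ! v ≡ false
      X′∌v = ¬-not λ v∈ → true≢false (⁅⁆-self v) (proj₂ (∈-─⁻ X ⁅ v ⁆ v v∈))
      X′-off : ∀ i → i ≢ v → X′ ! i ≡ X ! i
      X′-off i i≢v = trans (!-─ X ⁅ v ⁆ i) (trans (cong (λ l → X ! i ∧ not l) (⁅⁆-other i≢v)) (∧-identityʳ (X ! i)))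
      Q⊆X′ : Q ⊆ X′
      Q⊆X′ = !⇒⊆ λ i i∈Q → trans (X′-off i λ { refl → true≢false i∈Q Q∌v }) (⊆⇒! (proj₁ (proj₁ (proj₂ cut))) i i∈Q)
      X′⊆ : X′ ⊆ (V H ─ R)
      X′⊆ = !⇒⊆ λ i i∈X′ → let i∈X , i∉v = ∈-─⁻ X ⁅ v ⁆ i i∈X′ in
        into-H i (λ { refl → true≢false (⁅⁆-self i) i∉v }) (⊆⇒! (proj₂ (proj₁ (proj₂ cut))) i i∈X)
      relaxed : ∀ i → Relax (σ i) (τ i)
      relaxed i = at-or-off i v
        (λ { refl → subst (Relax (σ i)) (sym ([≔]-same (indicator X′) i)) (fix (X ! i)) })
        (λ i≢v → subst (Relax (σ i)) (sym (trans ([≔]-other (indicator X′) v i≢v)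
          (cong (if_then free else null) (X′-off i i≢v)))) same)
        where
        fix : ∀ b → Relax (if b then free else null) (line a)
        fix true  = fix-free
        fix false = fix-null

    removal-fails : κ H Q R ≢ k → ∃ (Fails v a)
    removal-fails κ≢k = τ , fits , λ { (conn-bound c) → <⇒≱ below c }
      where
      Q⊆VH─R : Q ⊆ (V H ─ R)
      Q⊆VH─R = !⇒⊆ λ i i∈Q → into-H i (λ { refl → true≢false i∈Q Q∌v }) (⊆⇒! Q⊆V─R i i∈Q)
      attained = κ-attained H Q R Q⊆VH─R
      X = proj₁ attained
      Q⊆X = proj₁ (proj₁ (proj₂ attained))
      X⊆ = proj₂ (proj₁ (proj₂ attained))
      τ = indicator X [ v ≔ line a ]
      X∌v : X ! v ≡ false
      X∌v = ¬-not λ v∈X → proj₂ (from-H v (⊆⇒! X⊆ v v∈X)) refl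
      below : free# τ < D τ + k
      below = begin-strict
        free# τ               ≡⟨ free#-off X v X∌v ⟩
        ∣ X ∣                 ≡⟨ proj₂ removes X X∌v ⟨
        cutRank H X + D τ     ≡⟨ +-comm (cutRank H X) _ ⟩
        D τ + cutRank H X     <⟨ +-monoʳ-< (D τ) (subst (_< k) (sym (proj₂ (proj₂ attained))) (≤∧≢⇒< κ-removal-≤ κ≢k)) ⟩
        D τ + k               ∎
        where open ≤-Reasoning
      fits : ∀ i → Fits (pole i) (((λ _ → nothing) [ v ≔ just a ]) i) (τ i)
      fits i = at-or-off i v
        (λ { refl → subst₂ (Fits (pole i)) (sym ([≔]-same (λ _ → nothing) i)) (sym ([≔]-same (indicator X) i))
                      (subst (λ p → Fits p (just a) (line a)) (sym v-mid) fits-line) })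
        (λ i≢v → subst₂ (Fits (pole i)) (sym ([≔]-other (λ _ → nothing) v i≢v)) (sym ([≔]-other (indicator X) v i≢v))
          (separates-fits (Q⊆X , !⇒⊆ λ i i∈X → proj₁ (from-H i (⊆⇒! X⊆ i i∈X))) i))

  linkage : (F : Subset n) (type : Fin n → Direction) (bad : Fin n → State n) →
    (∀ v → F ! v ≡ true → pole v ≡ mid) → (∀ v → F ! v ≡ true → Fails v (type v) (bad v)) → Linkage G k F
  linkage F type bad F-mid fails = record
    { pole      = pole
    ; F-mid     = F-mid
    ; conn      = connected
    ; cut       = indicator (proj₁ cut)
    ; cut-fits  = separates-fits (proj₁ (proj₂ cut))
    ; cut-tight = cut-tight
    ; type      = type
    ; bad       = bad
    ; bad-fits  = λ v v∈F → proj₁ (fails v v∈F)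
    ; bad-¬conn = λ v v∈F → proj₂ (fails v v∈F)
    }

-- From failing removals to incompatible directions

two-failures : ∀ {A B C : Set} → Dec A → Dec B → Dec C → ¬ AtLeastTwo A B C →
  (¬ A × ¬ B) ⊎ (¬ A × ¬ C) ⊎ (¬ B × ¬ C)
two-failures (no ¬a) (no ¬b) _       _   = inj₁ (¬a , ¬b)
two-failures (no ¬a) (yes b) (no ¬c) _   = inj₂ (inj₁ (¬a , ¬c))
two-failures (no ¬a) (yes b) (yes c) ¬two = contradiction (inj₂ (inj₂ (b , c))) ¬two
two-failures (yes a) (no ¬b) (no ¬c) _   = inj₂ (inj₂ (¬b , ¬c))
two-failures (yes a) (no ¬b) (yes c) ¬two = contradiction (inj₂ (inj₁ (a , c))) ¬two
two-failures (yes a) (yes b) _       ¬two = contradiction (inj₁ (a , b)) ¬two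

poleOf-mid : ∀ {q m} → poleOf q m ≡ mid → q ≡ false × m ≡ true
poleOf-mid {false} {true} _ = refl , refl

⊆-─ : ∀ {n} {p q r : Subset n} → p ⊆ q → Empty (p ∩ r) → p ⊆ (q ─ r)
⊆-─ {p = p} {q} {r} p⊆q p∩r=∅ = !⇒⊆ λ i i∈p → ∈-─⁺ q r i (⊆⇒! p⊆q i i∈p) (¬-not λ i∈r →
  p∩r=∅ (i , x∈p∩q⁺ (lookup⇒[]= i p i∈p , lookup⇒[]= i r i∈r)))

outside-∪ : ∀ {n} (p q : Subset n) i → (p ∪ q) ! i ≡ false → p ! i ≡ false × q ! i ≡ false
outside-∪ p q i e with p ! i | q ! i | trans (sym (lookup-zipWith _∨_ i p q)) e
... | false | false | _ = refl , refl

outside-∪⁺ : ∀ {n} (p q : Subset n) i → p ! i ≡ false → q ! i ≡ false → (p ∪ q) ! i ≡ false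
outside-∪⁺ p q i i∉p i∉q = trans (lookup-zipWith _∨_ i p q) (cong₂ _∨_ i∉p i∉q)

module _ {n} (G : Graph n) (Q R S T : Subset n) (Q⊆V─R : Q ⊆ (V G ─ R)) (S⊆V─T : S ⊆ (V G ─ T)) where
  private
    module QR = Terminals G Q R Q⊆V─R
    module ST = Terminals G S T S⊆V─T
    F = V G ─ (Q ∪ R ∪ S ∪ T)

  Preserves : Graph n → Set
  Preserves H = κ H Q R ≡ QR.k × κ H S T ≡ ST.k

  preserves? : ∀ H → Dec (Preserves H)
  preserves? H = (κ H Q R ℕ.≟ QR.k) ×-dec (κ H S T ℕ.≟ ST.k)

  PivotsPreserve : Fin n → Set
  PivotsPreserve v = ∀ u → Adjacent G u v → Preserves (G ∧[ u , v ] ∖ v)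

  pivot-preserves? : ∀ v u → Dec (Adjacent G u v → Preserves (G ∧[ u , v ] ∖ v))
  pivot-preserves? v u = (adj G u v Bool.≟ true) →-dec preserves? (G ∧[ u , v ] ∖ v)

  TwoWays : Fin n → Set
  TwoWays v = AtLeastTwo (Preserves (G ∖ v)) (Preserves (G ⋆ v ∖ v)) (PivotsPreserve v)

  twoWays? : ∀ v → Dec (TwoWays v)
  twoWays? v = (del? ×-dec star?) ⊎-dec ((del? ×-dec piv?) ⊎-dec (star? ×-dec piv?))
    where
    del?  = preserves? (G ∖ v)
    star? = preserves? (G ⋆ v ∖ v)
    piv?  = all? (pivot-preserves? v)

  F-bits : ∀ v → F ! v ≡ true → QR.pole v ≡ mid × ST.pole v ≡ mid
  F-bits v v∈F with ∈-─⁻ (V G) (Q ∪ R ∪ S ∪ T) v v∈F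
  ... | v∈V , v∉ with outside-∪ Q (R ∪ S ∪ T) v v∉
  ... | v∉Q , v∉′ with outside-∪ R (S ∪ T) v v∉′
  ... | v∉R , v∉″ with outside-∪ S T v v∉″
  ... | v∉S , v∉T = cong₂ poleOf v∉Q (∈-─⁺ (V G) R v v∈V v∉R) , cong₂ poleOf v∉S (∈-─⁺ (V G) T v v∈V v∉T)

  covered : ∀ u → ST.pole u ≡ mid → F ! u ≡ true ⊎ QR.pole u ≢ mid
  covered u st with F ! u Bool.≟ true
  ... | yes u∈F = inj₁ u∈F
  ... | no  u∉F = inj₂ λ qr →
    let u∉Q , u∈V─R = poleOf-mid {Q ! u} {(V G ─ R) ! u} qr
        u∉S , u∈V─T = poleOf-mid {S ! u} {(V G ─ T) ! u} st
        u∈V , u∉R   = ∈-─⁻ (V G) R u u∈V─R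
        _   , u∉T   = ∈-─⁻ (V G) T u u∈V─T
    in u∉F (∈-─⁺ (V G) (Q ∪ R ∪ S ∪ T) u u∈V
         (outside-∪⁺ Q (R ∪ S ∪ T) u u∉Q (outside-∪⁺ R (S ∪ T) u u∉R (outside-∪⁺ S T u u∉S u∉T))))

  SomeFails : Fin n → Direction → Set
  SomeFails v a = ∃ (QR.Fails v a) ⊎ ∃ (ST.Fails v a)

  removal-someFails : ∀ {v a} H → F ! v ≡ true → Removes G v a H → ¬ Preserves H → SomeFails v a
  removal-someFails {v} {a} H v∈F removes ¬preserves with κ H Q R ℕ.≟ QR.k
  ... | no κ≢k  = inj₁ (QR.removal-fails {v} {a} {H} removes (proj₁ (F-bits v v∈F)) κ≢k)
  ... | yes κ≡k = inj₂ (ST.removal-fails {v} {a} {H} removes (proj₂ (F-bits v v∈F)) λ κ≡ℓ → ¬preserves (κ≡k , κ≡ℓ))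

  pivots-someFails : ∀ {v} → F ! v ≡ true → ¬ PivotsPreserve v → SomeFails v piv
  pivots-someFails {v} v∈F ¬preserve = by-pivot (¬∀⟶∃¬ n _ (pivot-preserves? v) ¬preserve)
    where
    by-pivot : ∃ (λ u → ¬ (Adjacent G u v → Preserves (G ∧[ u , v ] ∖ v))) → SomeFails v piv
    by-pivot (u , ¬pres) = by-adjacency (adj G u v Bool.≟ true)
      where
      by-adjacency : Dec (Adjacent G u v) → SomeFails v piv
      by-adjacency (yes uv) = removal-someFails (G ∧[ u , v ] ∖ v) v∈F (removes-piv G u v uv) λ pres → ¬pres λ _ → pres
      by-adjacency (no ¬uv) = contradiction (λ uv → contradiction uv ¬uv) ¬pres

  Incompatible : Fin n → (Direction × State n) × (Direction × State n) → Set
  Incompatible v ((a , σ) , (b , τ)) = a ≢ b × QR.Fails v a σ × ST.Fails v b τ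

  -- By `fails-unique` two distinct directions cannot both fail for the same pair of terminal sets,
  -- so each pair has one of them.
  incompatible : ∀ {v a b} → a ≢ b → SomeFails v a → SomeFails v b → ∃ (Incompatible v)
  incompatible a≢b (inj₁ (σ , f)) (inj₁ (τ , g)) = contradiction (QR.fails-unique f g) a≢b
  incompatible a≢b (inj₁ (σ , f)) (inj₂ (τ , g)) = _ , a≢b , f , g
  incompatible a≢b (inj₂ (σ , f)) (inj₁ (τ , g)) = _ , a≢b ∘ sym , g , f
  incompatible a≢b (inj₂ (σ , f)) (inj₂ (τ , g)) = contradiction (ST.fails-unique f g) a≢b

  ¬twoWays⇒incompatible : ∀ v → F ! v ≡ true → ¬ TwoWays v → ∃ (Incompatible v)
  ¬twoWays⇒incompatible v v∈F ¬two =
    [ (λ (¬d , ¬s) → incompatible (λ ()) (del-fails ¬d) (star-fails ¬s))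
    , [ (λ (¬d , ¬p) → incompatible (λ ()) (del-fails ¬d) (pivots-someFails v∈F ¬p))
      , (λ (¬s , ¬p) → incompatible (λ ()) (star-fails ¬s) (pivots-someFails v∈F ¬p)) ]′ ]′
    (two-failures (preserves? (G ∖ v)) (preserves? (G ⋆ v ∖ v)) (all? (pivot-preserves? v)) ¬two)
    where
    del-fails : ¬ Preserves (G ∖ v) → SomeFails v del
    del-fails = removal-someFails (G ∖ v) v∈F (removes-del G v)
    star-fails : ¬ Preserves (G ⋆ v ∖ v) → SomeFails v star
    star-fails = removal-someFails (G ⋆ v ∖ v) v∈F (removes-star G v)

  some-twoWays : (2 * ST.k + 1) * 2 ^ (2 * QR.k) ≤ ∣ F ∣ → ∃ λ v → v ∈ F × TwoWays v
  -- The statement is decidable, so a refutation of its negation yields a vertex; this is why the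
  -- doubly negated form of `linking` is enough.
  some-twoWays large = decidable-stable (any? λ v → (v ∈? F) ×-dec twoWays? v) λ none →
    few-twoWays none large
    where
    few-twoWays : ¬ (∃ λ v → v ∈ F × TwoWays v) → ¬ (2 * ST.k + 1) * 2 ^ (2 * QR.k) ≤ ∣ F ∣
    few-twoWays none = Intertwining.few-incompatible-vertices G A B
      (λ v v∈F → proj₁ (proj₂ data-F v v∈F)) covered
      where
      data-F : Σ (Fin n → (Direction × State n) × (Direction × State n)) λ f → ∀ v → F ! v ≡ true → Incompatible v (f v)
      data-F = choice F ((del , λ _ → free) , (del , λ _ → free)) λ v v∈F →
        ¬twoWays⇒incompatible v v∈F λ two → none (v , lookup⇒[]= v F v∈F , two)
      f = proj₁ data-F
      A : Linkage G QR.k F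
      A = QR.linkage F (λ v → proj₁ (proj₁ (f v))) (λ v → proj₂ (proj₁ (f v)))
        (λ v v∈F → proj₁ (F-bits v v∈F)) λ v v∈F → proj₁ (proj₂ (proj₂ data-F v v∈F))
      B : Linkage G ST.k F
      B = ST.linkage F (λ v → proj₁ (proj₂ (f v))) (λ v → proj₂ (proj₂ (f v)))
        (λ v v∈F → proj₂ (F-bits v v∈F)) λ v v∈F → proj₂ (proj₂ (proj₂ data-F v v∈F))

theorem1p2 : ∀ {n : ℕ} (G : Graph n) (Q R S T : Subset n) →
    Q ⊆ V G → R ⊆ V G → S ⊆ V G → T ⊆ V G →
    Empty (Q ∩ R) → Empty (S ∩ T) →
    (k ℓ : ℕ) → κ G Q R ≡ k → κ G S T ≡ ℓ →
    let F = V G ─ (Q ∪ R ∪ S ∪ T) in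
    ∣ F ∣ ≥ (2 * ℓ + 1) * 2 ^ (2 * k) →
    ∃[ v ] v ∈ F × AtLeastTwo
    (κ (G ∖ v) Q R ≡ k × κ (G ∖ v) S T ≡ ℓ)
    (κ (G ⋆ v ∖ v) Q R ≡ k × κ (G ⋆ v ∖ v) S T ≡ ℓ)
    (∀ (u : Fin n) → Adjacent G u v →
    κ (G ∧[ u , v ] ∖ v) Q R ≡ k × κ (G ∧[ u , v ] ∖ v) S T ≡ ℓ)
theorem1p2 G Q R S T Q⊆V R⊆V S⊆V T⊆V Q∩R=∅ S∩T=∅ k ℓ refl refl =
  some-twoWays G Q R S T (⊆-─ Q⊆V Q∩R=∅) (⊆-─ S⊆V S∩T=∅)
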